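{- Suppose that $k$, $r$ and $s$ are natural numbers with $k\ge 3$, $$r\le \min\{k-2,\tfrac12(k+1)\}\quad\text{and}\quad s\ge k^2-rk+\tfrac12 r(r+3)-1.$$ Then for each $\varepsilon>0$, one has $$J_{s,k}(X)\ll X^{2s-\frac12k(k+1)+\delta_{s,k,r}+\varepsilon},$$ where $$\delta_{s,k,r}=\frac{r(r-1)(3k-2r-5)}{6(s-k+1)}.$$ In particular, when $s\ge (k-\tfrac12 r)^2+\tfrac14(r+3)^2$, one has $\delta_{s,k,r}<r^2/k$.
   Context: Natural numbers are positive integers. For natural numbers $s,k$ and a real number $X$, $J_{s,k}(X)$ denotes the number of integral solutions of the system $x_1^j+\ldots+x_s^j=y_1^j+\ldots+y_s^j$ $(1\le j\le k)$ with $1\le x_i,y_i\le X$ $(1\le i\le s)$. The notation $A\ll B$ means $|A|\le CB$ for all sufficiently large $X$, where the implicit constant $C$ may depend on $s$, $k$ and $\varepsilon$ only. -}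

module Defs where

open import Algebra.Definitions.RawSemiring using (_^_)
open import Data.Integer as ℤ using (ℤ; +_)
open import Data.List using (List; length)
open import Data.List.Membership.Propositional using (_∈_)
open import Data.List.Relation.Unary.Unique.Propositional using (Unique)
open import Data.Nat as ℕ using (ℕ; suc)
open import Data.Product using (_×_; _,_; Σ; ∃-syntax)
open import Data.Rational
open import Data.Rational.Properties
open import Data.Vec using (Vec; map; foldr′)
open import Data.Vec.Relation.Unary.All using (All)
open import Function using (_⇔_)
open import Relation.Binary.PropositionalEquality hiding (J)

fromℕ : ℕ → ℚ
fromℕ n = + n / 1

fromℤ : ℤ → ℚ
fromℤ z = z / 1

infixr 8 _^ℚ_
_^ℚ_ : ℚ → ℕ → ℚ
_^ℚ_ = _^_ +-*-rawSemiring

-- Bishop's real numbers: `seq n` is within 1/(n+1) of the number represented.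

1/1+_ : ℕ → ℚ
1/1+ n = + 1 / suc n

record ℝ : Set where
  field
    seq     : ℕ → ℚ
    regular : ∀ m n → ∣ seq m - seq n ∣ ≤ 1/1+ m + 1/1+ n

open ℝ public

infix 4 _<ʳ_ _<ˡ_ _≤ˡ_

_<ʳ_ : ℝ → ℚ → Set
X <ʳ q = ∃[ n ] seq X n + 1/1+ n < q

_<ˡ_ : ℚ → ℝ → Set
q <ˡ X = ∃[ n ] q < seq X n - 1/1+ n

_≤ˡ_ : ℚ → ℝ → Set
q ≤ˡ X = ∀ n → q ≤ seq X n + 1/1+ n

private
  cancel : ∀ q a b → (q + a) - (q + b) ≡ a - b
  cancel q a b = begin
    (q + a) - (q + b)       ≡⟨ cong₂ (λ u v → u + v) (+-comm q a) (neg-distrib-+ q b) ⟩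
    (a + q) + (- q + - b)   ≡⟨ +-assoc a q (- q + - b) ⟩
    a + (q + (- q + - b))   ≡⟨ cong (λ u → a + u) (+-assoc q (- q) (- b)) ⟨
    a + ((q - q) + - b)     ≡⟨ cong (λ u → a + (u + - b)) (+-inverseʳ q) ⟩
    a + (0ℚ + - b)          ≡⟨ cong (λ u → a + u) (+-identityˡ (- b)) ⟩
    a - b                   ∎
    where open ≡-Reasoning

infixl 6 _+ˡ_
_+ˡ_ : ℚ → ℝ → ℝ
q +ˡ X = record
  { seq     = λ n → q + seq X n
  ; regular = λ m n → subst (λ u → ∣ u ∣ ≤ 1/1+ m + 1/1+ n)
                        (sym (cancel q (seq X m) (seq X n))) (regular X m n)
  }

-- For X ≥ 1, `X ^ θ <ᵖ q` says that the real power X^θ is less than q.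
-- By monotonicity and continuity of the power, this holds iff x^t < q for
-- some rationals x > X and t > θ.  With t = (a - b)/(d + 1) and q > 0, the
-- inequality x^t < q is x^a < q^(d+1) x^b.

infix 4 _^_<ᵖ_
_^_<ᵖ_ : ℝ → ℝ → ℚ → Set
X ^ θ <ᵖ q =
  ∃[ x ] ∃[ a ] ∃[ b ] ∃[ d ]
    X <ʳ x × θ <ʳ (a ℤ.⊖ b) / suc d × 0ℚ < q × x ^ℚ a < q ^ℚ suc d * x ^ℚ b

-- For X ≥ 1 and C ≥ 0: N ≤ C · X^θ.

infix 4 _≤_·_^ʳ_
_≤_·_^ʳ_ : ℕ → ℚ → ℝ → ℝ → Set
N ≤ C · X ^ʳ θ = ∀ q → X ^ θ <ᵖ q → fromℕ N ≤ C * q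

HasCardinality : {A : Set} → (A → Set) → ℕ → Set
HasCardinality {A} P N =
  Σ (List A) λ xs → length xs ≡ N × Unique xs × (∀ a → (a ∈ xs) ⇔ P a)

powerSum : ∀ {s} → ℕ → Vec ℤ s → ℤ
powerSum j x = foldr′ ℤ._+_ ℤ.0ℤ (map (ℤ._^ j) x)

InRange : ∀ {s} → ℝ → Vec ℤ s → Set
InRange X = All λ z → ℤ.1ℤ ℤ.≤ z × fromℤ z ≤ˡ X

IsSolution : (s k : ℕ) → ℝ → Vec ℤ s × Vec ℤ s → Set
IsSolution s k X (x , y) =
  InRange X x × InRange X y ×
  (∀ j → 1 ℕ.≤ j → j ℕ.≤ k → powerSum j x ≡ powerSum j y)

-- J_{s,k}(X) = N.  A relation, because the integer part of a real number is
-- not a computable function of it.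

J : (s k : ℕ) → ℝ → ℕ → Set
J s k X N = HasCardinality (IsSolution s k X) N

-- The denominator is 6(s - k + 1) when k ≤ s; other pairs (s, k) are
-- excluded by k ≥ 3, r ≤ k - 2 and s ≥ k² - rk + r(r + 3)/2 - 1, which
-- together imply s ≥ k.

δ : (s k r : ℕ) → ℚ
δ s k r =
  (+ r ℤ.* (+ r ℤ.- + 1) ℤ.* (+ 3 ℤ.* + k ℤ.- + 2 ℤ.* + r ℤ.- + 5))
    / (6 ℕ.* suc (s ℕ.∸ k))

exponent : (s k r : ℕ) → ℚ
exponent s k r =
  fromℕ 2 * fromℕ s - ½ * fromℕ k * (fromℕ k + 1ℚ) + δ s k r

{-# OPTIONS --safe #-}
-- Since δ ≥ 0 and the lower bound on s exceeds k(k+1)/2, it suffices to prove the sharp bound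
-- X^(2s - k(k+1)/2 + ε) of Vinogradov's mean value theorem, and the trivial bound for the surplus
-- variables reduces this to s = k(k+1)/2.  There it follows from a decoupling inequality for the
-- moment curve in which the classes modulo powers of a fixed prime p > k + 8 play the part of short
-- intervals; all norms are numbers of solutions, so that only nonnegative integers are compared.
--
-- Let f_ξ,n be the sum over the class of ξ modulo p^n.  For l + m = k and incongruent ξ, η one
-- compares the mixed moments in which f_ξ,a carries the l(l+1)/2 moment and f_η,b the remaining
-- variables.  Fixing the variables near η leaves a nondegenerate system of degree l near ξ, so the
-- inequality in degree l < k refines a at no cost; Hölder's inequality relates the moments for l to
-- those for l - 1 and, with ξ and η exchanged, for k - l.  The resulting linear recursion has the fixed
-- vector l(k - l), and iterating it lowers every positive decoupling exponent.
module Submission where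

open import Algebra.Structures using (IsAbelianGroup)
open import Relation.Binary using (DecidableEquality)
open import Relation.Binary.PropositionalEquality using (_≡_)
open import Data.Nat as ℕ using (ℕ)
open import Data.Nat.Primality using (Prime)
open import Data.Integer using (ℤ)
open import Data.List using (List)
open import Defs using (powerSum)

-- The decoupling inequality is quantified over an auxiliary measure `W`. Freezing the variables
-- near η enlarges `W`, so the inequality in degree l must hold for every `W` that respects the
-- congruences, and this is what `Valid` records.
--
-- The gain comes from the end of the recursion. At l = 0 only the moment near η is left; it starts
-- at level b instead of 0, which saves p^(e b) when p^(e h) is the loss at scale h. Carried through
-- n rounds this saving grows linearly in n, while the trivial passage to the levels where the
-- recursion starts costs a fixed multiple of the scale t. For n large the balance exceeds p^h, and
-- e drops by one.
--
-- Each round multiplies a scale by (m + 1)/m with m < k; therefore t carries a factor (k!)^n. No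
-- root is ever taken: a loss p^(B/q) is stated for q-th powers.
--
-- The prime exceeds k so that 1, ..., k are units. It exceeds 8 so that passing to a single class
-- costs exactly the sharp power of p, with no constant that would accumulate over h levels; only
-- pairs of distinct classes cost a constant, and they are met once.

module Naturals where

  open import Data.Nat public
  open import Data.Nat.Properties public
  open import Data.Nat.Tactic.RingSolver public using (solve-∀)
  open import Data.Product using (_,_; _×_; ∃-syntax; proj₁; proj₂)
  open import Data.Sum using (inj₁; inj₂)
  open import Relation.Binary.PropositionalEquality
  open import Relation.Nullary using (yes; no; contradiction)

  -- Elementary inequalities, log-convex sequences and triangular numbers.

  m≤n⇒2mn≤m²+n² : ∀ {m n} → m ≤ n → 2 * (m * n) ≤ m * m + n * n
  m≤n⇒2mn≤m²+n² {m} {n} m≤n with d , refl ← m≤n⇒∃[o]m+o≡n m≤n = begin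
    2 * (m * (m + d))                   ≤⟨ m≤m+n _ (d * d) ⟩
    2 * (m * (m + d)) + d * d           ≡⟨ identity m d ⟩
    m * m + (m + d) * (m + d)           ∎
    where
    open ≤-Reasoning
    identity : ∀ m d → 2 * (m * (m + d)) + d * d ≡ m * m + (m + d) * (m + d)
    identity = solve-∀

  2mn≤m²+n² : ∀ m n → 2 * (m * n) ≤ m * m + n * n
  2mn≤m²+n² m n with ≤-total m n
  ... | inj₁ m≤n = m≤n⇒2mn≤m²+n² m≤n
  ... | inj₂ n≤m = begin
    2 * (m * n)    ≡⟨ cong (2 *_) (*-comm m n) ⟩
    2 * (n * m)    ≤⟨ m≤n⇒2mn≤m²+n² n≤m ⟩
    n * n + m * m  ≡⟨ +-comm (n * n) (m * m) ⟩
    m * m + n * n  ∎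
    where open ≤-Reasoning

  m²≤n²⇒m≤n : ∀ {m n} → m * m ≤ n * n → m ≤ n
  m²≤n²⇒m≤n {m} {n} m²≤n² with m ≤? n
  ... | yes m≤n = m≤n
  ... | no  m≰n = contradiction m²≤n² (<⇒≱ (*-mono-< (≰⇒> m≰n) (≰⇒> m≰n)))

  -- In the form X² ≤ P Q ⇒ 2 X x y ≤ P y² + Q x², this is the inductive step of the
  -- Cauchy–Schwarz inequality.
  cross-term : ∀ {X P Q} x y → X * X ≤ P * Q → 2 * (X * (x * y)) ≤ P * (y * y) + Q * (x * x)
  cross-term {X} {P} {Q} x y X²≤PQ = m²≤n²⇒m≤n (begin
    2 * (X * (x * y)) * (2 * (X * (x * y)))   ≡⟨ e₁ X x y ⟩
    4 * ((X * X) * ((x * y) * (x * y)))       ≤⟨ *-monoʳ-≤ 4 (*-monoˡ-≤ _ X²≤PQ) ⟩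
    4 * ((P * Q) * ((x * y) * (x * y)))       ≡⟨ e₂ P Q x y ⟩
    2 * (s * t) + 2 * (s * t)                 ≤⟨ +-monoʳ-≤ (2 * (s * t)) (2mn≤m²+n² s t) ⟩
    2 * (s * t) + (s * s + t * t)             ≡⟨ e₃ s t ⟩
    (s + t) * (s + t)                         ∎)
    where
    open ≤-Reasoning
    s = P * (y * y)
    t = Q * (x * x)
    e₁ : ∀ X x y → 2 * (X * (x * y)) * (2 * (X * (x * y))) ≡ 4 * ((X * X) * ((x * y) * (x * y)))
    e₁ = solve-∀
    e₂ : ∀ P Q x y → 4 * ((P * Q) * ((x * y) * (x * y))) ≡
         2 * (P * (y * y) * (Q * (x * x))) + 2 * (P * (y * y) * (Q * (x * x)))
    e₂ = solve-∀
    e₃ : ∀ s t → 2 * (s * t) + (s * s + t * t) ≡ (s + t) * (s + t)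
    e₃ = solve-∀

  [m+n]+[o+p]≡[m+o]+[n+p] : ∀ m n o p → m + n + (o + p) ≡ m + o + (n + p)
  [m+n]+[o+p]≡[m+o]+[n+p] = solve-∀

  argmax : ∀ (g : ℕ → ℕ) n → ∃[ i ] i ≤ n × (∀ j → j ≤ n → g j ≤ g i)
  argmax g zero = 0 , z≤n , λ { zero _ → ≤-refl }
  argmax g (suc n) with argmax g n
  ... | i , i≤n , max with ≤-total (g i) (g (suc n))
  ...   | inj₁ gi≤gn = suc n , ≤-refl , λ j j≤1+n → case j j≤1+n
    where
    case : ∀ j → j ≤ suc n → g j ≤ g (suc n)
    case j j≤1+n with m≤n⇒m<n∨m≡n j≤1+n
    ... | inj₁ (s≤s j≤n) = ≤-trans (max j j≤n) gi≤gn
    ... | inj₂ refl      = ≤-refl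
  ...   | inj₂ gn≤gi = i , m≤n⇒m≤1+n i≤n , case
    where
    case : ∀ j → j ≤ suc n → g j ≤ g i
    case j j≤1+n with m≤n⇒m<n∨m≡n j≤1+n
    ... | inj₁ (s≤s j≤n) = max j j≤n
    ... | inj₂ refl      = gn≤gi

  argmax₂ : ∀ (g : ℕ → ℕ → ℕ) n → ∃[ i ] ∃[ j ] i ≤ n × j ≤ n × (∀ i' j' → i' ≤ n → j' ≤ n → g i' j' ≤ g i j)
  argmax₂ g n =
    let best i       = argmax (g i) n
        i , i≤n , max = argmax (λ i → g i (proj₁ (best i))) n
    in i , proj₁ (best i) , i≤n , proj₁ (proj₂ (best i)) ,
       λ i' j' i'≤n j'≤n → ≤-trans (proj₂ (proj₂ (best i')) j' j'≤n) (max i' i'≤n)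

  ^-cancelʳ-≤ : ∀ n {x y} → x ^ suc n ≤ y ^ suc n → x ≤ y
  ^-cancelʳ-≤ n {x} {y} xⁿ≤yⁿ with x ≤? y
  ... | yes x≤y = x≤y
  ... | no  x≰y = contradiction xⁿ≤yⁿ (<⇒≱ (^-monoˡ-< (suc n) (≰⇒> x≰y)))

  1≤⇒1≤^ : ∀ {p} → 1 ≤ p → ∀ n → 1 ≤ p ^ n
  1≤⇒1≤^ {p} 1≤p n = subst (_≤ p ^ n) (^-zeroˡ n) (^-monoˡ-≤ n 1≤p)

  *-^-comm : ∀ x y n → (x * y) ^ n ≡ x ^ n * y ^ n
  *-^-comm x y zero    = refl
  *-^-comm x y (suc n) = begin
    x * y * (x * y) ^ n        ≡⟨ cong (x * y *_) (*-^-comm x y n) ⟩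
    x * y * (x ^ n * y ^ n)    ≡⟨ [m*n]*[o*p]≡[m*o]*[n*p] x y (x ^ n) (y ^ n) ⟩
    x * x ^ n * (y * y ^ n)    ∎
    where open ≡-Reasoning

  pow-swap : ∀ x m n → (x ^ m) ^ n ≡ (x ^ n) ^ m
  pow-swap x m n = begin
    (x ^ m) ^ n   ≡⟨ ^-*-assoc x m n ⟩
    x ^ (m * n)   ≡⟨ cong (x ^_) (*-comm m n) ⟩
    x ^ (n * m)   ≡⟨ ^-*-assoc x n m ⟨
    (x ^ n) ^ m   ∎
    where open ≡-Reasoning

  module LogConvex (e : ℕ → ℕ) where

    private
      cancel : ∀ c {x y} → c * x ≤ c * y → (c ≡ 0 → x ≤ y) → x ≤ y
      cancel zero    _       zero-case = zero-case refl
      cancel (suc c) cx≤cy   _         = *-cancelˡ-≤ (suc c) cx≤cy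

    -- Log-convexity makes the ratios of consecutive terms increase, so the ratio at `j` is at least
    -- the geometric mean of the earlier ones, whose product is `e j` over `e 0`. This is the
    -- inequality with denominators cleared.
    slope : ∀ j → (∀ i → i < j → e (suc i) * e (suc i) ≤ e i * e (suc (suc i))) →
            e j ^ suc j ≤ e (suc j) ^ j * e 0
    slope zero convex = ≤-reflexive (trans (*-identityʳ (e 0)) (sym (*-identityˡ (e 0))))
    slope (suc j) convex = cancel (e (suc j) ^ j) (begin
      a ^ j * (a * (a * a ^ j))        ≡⟨ l₁ a (a ^ j) ⟩
      (a * a) * (a ^ j * a ^ j)        ≡⟨ cong (a * a *_) (*-^-comm a a j) ⟨
      (a * a) ^ suc j                  ≤⟨ ^-monoˡ-≤ (suc j) (convex j ≤-refl) ⟩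
      (e j * c) ^ suc j                ≡⟨ *-^-comm (e j) c (suc j) ⟩
      e j ^ suc j * c ^ suc j          ≤⟨ *-monoˡ-≤ (c ^ suc j) (slope j λ i i<j → convex i (m<n⇒m<1+n i<j)) ⟩
      a ^ j * e 0 * c ^ suc j          ≡⟨ l₂ (a ^ j) (e 0) (c ^ suc j) ⟩
      a ^ j * (c ^ suc j * e 0)        ∎) zero-case
      where
      open ≤-Reasoning
      a = e (suc j)
      c = e (suc (suc j))
      l₁ : ∀ a b → b * (a * (a * b)) ≡ (a * a) * (b * b)
      l₁ = solve-∀
      l₂ : ∀ x y z → x * y * z ≡ x * (z * y)
      l₂ = solve-∀
      -- A vanishing factor `a ^ j` cannot be cancelled, but it also kills the left side.
      zero-case : a ^ j ≡ 0 → a ^ suc (suc j) ≤ c ^ suc j * e 0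
      zero-case eq = subst (_≤ c ^ suc j * e 0)
        (sym (trans (cong (λ u → a * (a * u)) eq) (trans (cong (a *_) (*-zeroʳ a)) (*-zeroʳ a)))) z≤n

    -- Induction on the right endpoint: `e i` is bounded through `e N'`, and `slope` then exchanges
    -- `e N'` for `e (suc N')`. The exponents match after raising to the power `suc N'` and taking
    -- an `N'`-th root.
    interpolate : ∀ N i j → i + j ≡ N →
                  (∀ i → suc i < N → e (suc i) * e (suc i) ≤ e i * e (suc (suc i))) →
                  e i ^ N ≤ e N ^ i * e 0 ^ j
    interpolate zero zero zero refl convex = ≤-refl
    interpolate (suc N) i zero i+0≡1+N convex
      rewrite trans (sym (+-identityʳ i)) i+0≡1+N = ≤-reflexive (sym (*-identityʳ _))
    interpolate (suc N) i (suc j) i+j≡1+N convex with N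
    ... | zero with refl ← m+n≡0⇒m≡0 i (suc-injective (trans (sym (+-suc i j)) i+j≡1+N))
               with refl ← suc-injective i+j≡1+N = ≤-reflexive (sym (*-identityˡ _))
    ... | N'@(suc N″) = ^-cancelʳ-≤ N″ (begin
      (e i ^ suc N') ^ N'                                  ≡⟨ pow-swap (e i) (suc N') N' ⟩
      (e i ^ N') ^ suc N'                                  ≤⟨ ^-monoˡ-≤ (suc N') IH ⟩
      (e N' ^ i * e 0 ^ j) ^ suc N'                        ≡⟨ *-^-comm (e N' ^ i) (e 0 ^ j) (suc N') ⟩
      (e N' ^ i) ^ suc N' * (e 0 ^ j) ^ suc N'             ≡⟨ cong (_* (e 0 ^ j) ^ suc N') (pow-swap (e N') i (suc N')) ⟩
      (e N' ^ suc N') ^ i * (e 0 ^ j) ^ suc N'             ≤⟨ *-monoˡ-≤ _ (^-monoˡ-≤ i (slope N' λ i i<N' → convex i (s≤s i<N'))) ⟩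
      (e (suc N') ^ N' * e 0) ^ i * (e 0 ^ j) ^ suc N'     ≡⟨ exponents ⟩
      (e (suc N') ^ i * e 0 ^ suc j) ^ N'                  ∎)
      where
      open ≤-Reasoning
      i+j≡N' : i + j ≡ N'
      i+j≡N' = suc-injective (trans (sym (+-suc i j)) i+j≡1+N)
      IH : e i ^ N' ≤ e N' ^ i * e 0 ^ j
      IH = interpolate N' i j i+j≡N' λ i i<N → convex i (m<n⇒m<1+n i<N)
      count : i + j * suc N' ≡ suc j * N'
      count = subst (λ n → i + j * suc n ≡ suc j * n) i+j≡N' (l i j)
        where
        l : ∀ i j → i + j * suc (i + j) ≡ suc j * (i + j)
        l = solve-∀
      exponents : (e (suc N') ^ N' * e 0) ^ i * (e 0 ^ j) ^ suc N' ≡ (e (suc N') ^ i * e 0 ^ suc j) ^ N'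
      exponents = ≡.begin
        (e (suc N') ^ N' * e 0) ^ i * (e 0 ^ j) ^ suc N'         ≡.≡⟨ cong₂ _*_ (*-^-comm (e (suc N') ^ N') (e 0) i) (^-*-assoc (e 0) j (suc N')) ⟩
        ((e (suc N') ^ N') ^ i * e 0 ^ i) * e 0 ^ (j * suc N')   ≡.≡⟨ *-assoc ((e (suc N') ^ N') ^ i) _ _ ⟩
        (e (suc N') ^ N') ^ i * (e 0 ^ i * e 0 ^ (j * suc N'))   ≡.≡⟨ cong₂ _*_ (pow-swap (e (suc N')) N' i) (sym (^-distribˡ-+-* (e 0) i (j * suc N'))) ⟩
        (e (suc N') ^ i) ^ N' * e 0 ^ (i + j * suc N')           ≡.≡⟨ cong (λ u → (e (suc N') ^ i) ^ N' * e 0 ^ u) count ⟩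
        (e (suc N') ^ i) ^ N' * e 0 ^ (suc j * N')               ≡.≡⟨ cong ((e (suc N') ^ i) ^ N' *_) (^-*-assoc (e 0) (suc j) N') ⟨
        (e (suc N') ^ i) ^ N' * (e 0 ^ suc j) ^ N'               ≡.≡⟨ *-^-comm (e (suc N') ^ i) (e 0 ^ suc j) N' ⟨
        (e (suc N') ^ i * e 0 ^ suc j) ^ N'                      ≡.∎
        where module ≡ = ≡-Reasoning

  -- k(k+1)/2, the number of variables on each side at the critical exponent.
  △ : ℕ → ℕ
  △ zero    = 0
  △ (suc k) = suc k + △ k

  -- How a mixed moment distributes the critical number of variables: `△ l` of them near ξ, the
  -- other `△ D + l * D` near η.
  △-+ : ∀ l D → △ (l + D) ≡ △ l + (△ D + l * D)
  △-+ zero    D = sym (+-identityʳ (△ D))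
  △-+ (suc l) D rewrite △-+ l D = lemma l D (△ l) (△ D)
    where
    lemma : ∀ l D a b → suc (l + D + (a + (b + l * D))) ≡ suc (l + a + (b + (D + l * D)))
    lemma = solve-∀

-- Finite sums over lists and the Kronecker delta.

module Sums where

  open Naturals
  open import Data.Bool using (if_then_else_)
  open import Data.List using (List; []; _∷_; _++_; map; cartesianProductWith)
  open import Data.List.Membership.Propositional using (_∈_)
  open import Data.List.Relation.Unary.Any using (here; there)
  open import Data.List.Relation.Unary.All as All using ([]; _∷_)
  open import Data.List.Relation.Unary.AllPairs using ([]; _∷_)
  open import Data.List.Relation.Unary.Unique.Propositional using (Unique)
  open import Relation.Binary.PropositionalEquality
  open import Relation.Nullary using (yes; no; does; contradiction)
  open import Relation.Binary using (DecidableEquality)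

  ∑ : ∀ {A : Set} → List A → (A → ℕ) → ℕ
  ∑ []       φ = 0
  ∑ (x ∷ xs) φ = φ x + ∑ xs φ

  module _ {A : Set} where

    ∑-cong-∈ : ∀ (xs : List A) {φ ψ : A → ℕ} → (∀ {x} → x ∈ xs → φ x ≡ ψ x) → ∑ xs φ ≡ ∑ xs ψ
    ∑-cong-∈ []       φ≡ψ = refl
    ∑-cong-∈ (x ∷ xs) φ≡ψ = cong₂ _+_ (φ≡ψ (here refl)) (∑-cong-∈ xs λ x∈ → φ≡ψ (there x∈))

    ∑-cong : ∀ (xs : List A) {φ ψ : A → ℕ} → (∀ x → φ x ≡ ψ x) → ∑ xs φ ≡ ∑ xs ψ
    ∑-cong xs φ≡ψ = ∑-cong-∈ xs λ {x} _ → φ≡ψ x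

    ∑-mono : ∀ (xs : List A) {φ ψ : A → ℕ} → (∀ x → φ x ≤ ψ x) → ∑ xs φ ≤ ∑ xs ψ
    ∑-mono []       φ≤ψ = z≤n
    ∑-mono (x ∷ xs) φ≤ψ = +-mono-≤ (φ≤ψ x) (∑-mono xs φ≤ψ)

    ∑-++ : ∀ (xs ys : List A) (φ : A → ℕ) → ∑ (xs ++ ys) φ ≡ ∑ xs φ + ∑ ys φ
    ∑-++ []       ys φ = refl
    ∑-++ (x ∷ xs) ys φ = trans (cong (φ x +_) (∑-++ xs ys φ)) (sym (+-assoc (φ x) _ _))

    ∑-zero : ∀ (xs : List A) {φ : A → ℕ} → (∀ {x} → x ∈ xs → φ x ≡ 0) → ∑ xs φ ≡ 0
    ∑-zero []       φ≡0 = refl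
    ∑-zero (x ∷ xs) φ≡0 = cong₂ _+_ (φ≡0 (here refl)) (∑-zero xs λ x∈ → φ≡0 (there x∈))

    ∑-+ : ∀ (xs : List A) (φ ψ : A → ℕ) → ∑ xs (λ x → φ x + ψ x) ≡ ∑ xs φ + ∑ xs ψ
    ∑-+ []       φ ψ = refl
    ∑-+ (x ∷ xs) φ ψ = begin
      φ x + ψ x + ∑ xs (λ x → φ x + ψ x)  ≡⟨ cong (φ x + ψ x +_) (∑-+ xs φ ψ) ⟩
      φ x + ψ x + (∑ xs φ + ∑ xs ψ)       ≡⟨ [m+n]+[o+p]≡[m+o]+[n+p] (φ x) (ψ x) _ _ ⟩
      φ x + ∑ xs φ + (ψ x + ∑ xs ψ)       ∎
      where open ≡-Reasoning

    ∑-*ʳ : ∀ (xs : List A) (φ : A → ℕ) c → ∑ xs (λ x → φ x * c) ≡ ∑ xs φ * c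
    ∑-*ʳ []       φ c = refl
    ∑-*ʳ (x ∷ xs) φ c = trans (cong (φ x * c +_) (∑-*ʳ xs φ c)) (sym (*-distribʳ-+ c (φ x) _))

    ∑-cauchy-schwarz : ∀ (xs : List A) (φ ψ : A → ℕ) →
      ∑ xs (λ x → φ x * ψ x) * ∑ xs (λ x → φ x * ψ x) ≤
      ∑ xs (λ x → φ x * φ x) * ∑ xs (λ x → ψ x * ψ x)
    ∑-cauchy-schwarz []       φ ψ = z≤n
    ∑-cauchy-schwarz (v ∷ xs) φ ψ = begin
      (x * y + X) * (x * y + X)                          ≡⟨ l₁ x y X ⟩
      (x * x) * (y * y) + 2 * (X * (x * y)) + X * X      ≤⟨ +-mono-≤ (+-monoʳ-≤ ((x * x) * (y * y)) (cross-term {X} {P} {Q} x y IH)) IH ⟩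
      (x * x) * (y * y) + (P * (y * y) + Q * (x * x)) + P * Q  ≡⟨ l₂ (x * x) (y * y) P Q ⟩
      (x * x + P) * (y * y + Q)                          ∎
      where
      open ≤-Reasoning
      x = φ v
      y = ψ v
      X = ∑ xs (λ x → φ x * ψ x)
      P = ∑ xs (λ x → φ x * φ x)
      Q = ∑ xs (λ x → ψ x * ψ x)
      IH = ∑-cauchy-schwarz xs φ ψ
      l₁ : ∀ x y X → (x * y + X) * (x * y + X) ≡ (x * x) * (y * y) + 2 * (X * (x * y)) + X * X
      l₁ = solve-∀
      l₂ : ∀ s t P Q → s * t + (P * t + Q * s) + P * Q ≡ (s + P) * (t + Q)
      l₂ = solve-∀

  module _ {A B : Set} where

    ∑-map : ∀ (f : A → B) xs (φ : B → ℕ) → ∑ (map f xs) φ ≡ ∑ xs (λ x → φ (f x))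
    ∑-map f []       φ = refl
    ∑-map f (x ∷ xs) φ = cong (φ (f x) +_) (∑-map f xs φ)

    ∑-swap : ∀ (xs : List A) (ys : List B) (φ : A → B → ℕ) →
             ∑ xs (λ x → ∑ ys (λ y → φ x y)) ≡ ∑ ys (λ y → ∑ xs (λ x → φ x y))
    ∑-swap []       ys φ = sym (∑-zero ys λ _ → refl)
    ∑-swap (x ∷ xs) ys φ = begin
      ∑ ys (φ x) + ∑ xs (λ x → ∑ ys (φ x))                ≡⟨ cong (∑ ys (φ x) +_) (∑-swap xs ys φ) ⟩
      ∑ ys (φ x) + ∑ ys (λ y → ∑ xs (λ x → φ x y))        ≡⟨ ∑-+ ys (φ x) _ ⟨
      ∑ ys (λ y → φ x y + ∑ xs (λ x → φ x y))             ∎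
      where open ≡-Reasoning

  ∑-cartesian : ∀ {A B C : Set} (f : A → B → C) xs ys (φ : C → ℕ) →
                ∑ (cartesianProductWith f xs ys) φ ≡ ∑ xs (λ x → ∑ ys (λ y → φ (f x y)))
  ∑-cartesian f []       ys φ = refl
  ∑-cartesian f (x ∷ xs) ys φ = trans (∑-++ (map (f x) ys) _ φ)
    (cong₂ _+_ (∑-map (f x) ys φ) (∑-cartesian f xs ys φ))

  module Kronecker {A : Set} (_≟_ : DecidableEquality A) where

    δ : A → A → ℕ
    δ a b = if does (a ≟ b) then 1 else 0

    δ-≡ : ∀ {a b} → a ≡ b → δ a b ≡ 1
    δ-≡ {a} {b} a≡b with a ≟ b
    ... | yes _   = refl
    ... | no  a≢b = contradiction a≡b a≢b

    δ-≢ : ∀ {a b} → a ≢ b → δ a b ≡ 0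
    δ-≢ {a} {b} a≢b with a ≟ b
    ... | yes a≡b = contradiction a≡b a≢b
    ... | no  _   = refl

    δ-⇔ : ∀ {a b c d} → (a ≡ b → c ≡ d) → (c ≡ d → a ≡ b) → δ a b ≡ δ c d
    δ-⇔ {a} {b} to from with a ≟ b
    ... | yes a≡b = sym (δ-≡ (to a≡b))
    ... | no  a≢b = sym (δ-≢ λ c≡d → a≢b (from c≡d))

    ∑-δ : ∀ {a xs} → Unique xs → a ∈ xs → ∀ (φ : A → ℕ) → ∑ xs (λ x → δ a x * φ x) ≡ φ a
    ∑-δ {a} {x ∷ xs} (x∉xs ∷ _) (here refl) φ = begin
      δ a a * φ a + ∑ xs (λ y → δ a y * φ y)
        ≡⟨ cong₂ (λ u v → u * φ a + v) (δ-≡ refl) (∑-zero xs λ {y} y∈ → cong (_* φ y) (δ-≢ (All.lookup x∉xs y∈))) ⟩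
      1 * φ a + 0  ≡⟨ trans (+-identityʳ _) (*-identityˡ _) ⟩
      φ a          ∎
      where open ≡-Reasoning
    ∑-δ {a} {x ∷ xs} (x∉xs ∷ xs!) (there a∈) φ = begin
      δ a x * φ x + ∑ xs (λ y → δ a y * φ y)
        ≡⟨ cong₂ _+_ (cong (_* φ x) (δ-≢ λ a≡x → All.lookup x∉xs a∈ (sym a≡x))) (∑-δ xs! a∈ φ) ⟩
      φ a ∎
      where open ≡-Reasoning

-- Finite measures on an abelian group, their inner products and moments.

module Measures
  {Γ : Set} (_≟Γ_ : DecidableEquality Γ) {_∙_ : Γ → Γ → Γ} {ε : Γ} {_⁻¹ : Γ → Γ}
  (isAbelianGroup : IsAbelianGroup _≡_ _∙_ ε _⁻¹)
  where

  open Naturals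
  open Sums
  open Kronecker _≟Γ_
  open import Algebra.Bundles using (CommutativeSemiring)
  open import Algebra.Structures.Biased using (isCommutativeSemiringˡ)
  open import Data.Fin.Patterns using (0F; 1F; 2F; 3F; 4F)
  open import Data.List as List using (List; []; _∷_; _++_; map; cartesianProductWith; deduplicate; length)
  open import Data.List.Membership.Propositional using (_∈_)
  open import Data.List.Membership.Propositional.Properties using (∈-deduplicate⁺; ∈-++⁺ˡ; ∈-++⁺ʳ)
  open import Data.List.Relation.Unary.Unique.DecPropositional.Properties _≟Γ_ using (deduplicate-!)
  open import Data.Product using (_,_)
  open import Data.Sum using (inj₁; inj₂)
  open import Data.Vec using ([]; _∷_)
  open import Level using (0ℓ)
  open import Relation.Binary.PropositionalEquality
  open import Relation.Nullary using (yes; no; contradiction)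
  private module G = IsAbelianGroup isAbelianGroup

  -- A list of elements of Γ stands for the finite measure counting its members, equivalently for the
  -- exponential sum ∑ e(γ); the product is convolution.
  Measure : Set
  Measure = List Γ

  infix 4 _≈_ _≼_
  infixl 6 _⊕_
  infixl 7 _⊛_

  -- Testing against every function compares multiplicities and forgets the order of the lists.
  record _≈_ (A B : Measure) : Set where
    constructor mk≈
    field ∑≡ : ∀ φ → ∑ A φ ≡ ∑ B φ

  record _≼_ (A B : Measure) : Set where
    constructor mk≼
    field ∑≤ : ∀ φ → ∑ A φ ≤ ∑ B φ

  open _≈_ public
  open _≼_ public

  _⊕_ _⊛_ : Measure → Measure → Measure
  _⊕_ = _++_
  _⊛_ = cartesianProductWith _∙_

  ≈⇒≼ : ∀ {A B} → A ≈ B → A ≼ B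
  ≈⇒≼ A≈B = mk≼ λ φ → ≤-reflexive (∑≡ A≈B φ)

  ≼-refl : ∀ {A} → A ≼ A
  ≼-refl = mk≼ λ φ → ≤-refl

  ≼-trans : ∀ {A B C} → A ≼ B → B ≼ C → A ≼ C
  ≼-trans A≼B B≼C = mk≼ λ φ → ≤-trans (∑≤ A≼B φ) (∑≤ B≼C φ)

  ∑-⊛ : ∀ A B φ → ∑ (A ⊛ B) φ ≡ ∑ A (λ a → ∑ B (λ b → φ (a ∙ b)))
  ∑-⊛ = ∑-cartesian _∙_

  ∑-⊕ : ∀ A B φ → ∑ (A ⊕ B) φ ≡ ∑ A φ + ∑ B φ
  ∑-⊕ = ∑-++

  ⊛-mono : ∀ {A A' B B'} → A ≼ A' → B ≼ B' → A ⊛ B ≼ A' ⊛ B'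
  ⊛-mono {A} {A'} {B} {B'} A≼A' B≼B' = mk≼ λ φ → begin
    ∑ (A ⊛ B) φ                            ≡⟨ ∑-⊛ A B φ ⟩
    ∑ A (λ a → ∑ B (λ b → φ (a ∙ b)))      ≤⟨ ∑-mono A (λ a → ∑≤ B≼B' _) ⟩
    ∑ A (λ a → ∑ B' (λ b → φ (a ∙ b)))     ≤⟨ ∑≤ A≼A' _ ⟩
    ∑ A' (λ a → ∑ B' (λ b → φ (a ∙ b)))    ≡⟨ ∑-⊛ A' B' φ ⟨
    ∑ (A' ⊛ B') φ                          ∎
    where open ≤-Reasoning

  ⊕-mono : ∀ {A A' B B'} → A ≼ A' → B ≼ B' → A ⊕ B ≼ A' ⊕ B'
  ⊕-mono {A} {A'} {B} {B'} A≼A' B≼B' = mk≼ λ φ → begin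
    ∑ (A ⊕ B) φ        ≡⟨ ∑-⊕ A B φ ⟩
    ∑ A φ + ∑ B φ      ≤⟨ +-mono-≤ (∑≤ A≼A' φ) (∑≤ B≼B' φ) ⟩
    ∑ A' φ + ∑ B' φ    ≡⟨ ∑-⊕ A' B' φ ⟨
    ∑ (A' ⊕ B') φ      ∎
    where open ≤-Reasoning

  private
    ⊛-cong : ∀ {A A' B B'} → A ≈ A' → B ≈ B' → A ⊛ B ≈ A' ⊛ B'
    ⊛-cong {A} {A'} {B} {B'} A≈A' B≈B' = mk≈ λ φ → begin
      ∑ (A ⊛ B) φ                            ≡⟨ ∑-⊛ A B φ ⟩
      ∑ A (λ a → ∑ B (λ b → φ (a ∙ b)))      ≡⟨ ∑-cong A (λ a → ∑≡ B≈B' _) ⟩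
      ∑ A (λ a → ∑ B' (λ b → φ (a ∙ b)))     ≡⟨ ∑≡ A≈A' _ ⟩
      ∑ A' (λ a → ∑ B' (λ b → φ (a ∙ b)))    ≡⟨ ∑-⊛ A' B' φ ⟨
      ∑ (A' ⊛ B') φ                          ∎
      where open ≡-Reasoning

    ⊛-assoc : ∀ A B C → (A ⊛ B) ⊛ C ≈ A ⊛ (B ⊛ C)
    ⊛-assoc A B C = mk≈ λ φ → begin
      ∑ ((A ⊛ B) ⊛ C) φ                                        ≡⟨ ∑-⊛ (A ⊛ B) C φ ⟩
      ∑ (A ⊛ B) (λ x → ∑ C (λ c → φ (x ∙ c)))                  ≡⟨ ∑-⊛ A B _ ⟩
      ∑ A (λ a → ∑ B (λ b → ∑ C (λ c → φ ((a ∙ b) ∙ c))))      ≡⟨ ∑-cong A (λ a → ∑-cong B λ b → ∑-cong C λ c → cong φ (G.assoc a b c)) ⟩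
      ∑ A (λ a → ∑ B (λ b → ∑ C (λ c → φ (a ∙ (b ∙ c)))))      ≡⟨ ∑-cong A (λ a → ∑-⊛ B C _) ⟨
      ∑ A (λ a → ∑ (B ⊛ C) (λ x → φ (a ∙ x)))                  ≡⟨ ∑-⊛ A (B ⊛ C) φ ⟨
      ∑ (A ⊛ (B ⊛ C)) φ                                        ∎
      where open ≡-Reasoning

    ⊛-comm : ∀ A B → A ⊛ B ≈ B ⊛ A
    ⊛-comm A B = mk≈ λ φ → begin
      ∑ (A ⊛ B) φ                            ≡⟨ ∑-⊛ A B φ ⟩
      ∑ A (λ a → ∑ B (λ b → φ (a ∙ b)))      ≡⟨ ∑-swap A B _ ⟩
      ∑ B (λ b → ∑ A (λ a → φ (a ∙ b)))      ≡⟨ ∑-cong B (λ b → ∑-cong A λ a → cong φ (G.comm a b)) ⟩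
      ∑ B (λ b → ∑ A (λ a → φ (b ∙ a)))      ≡⟨ ∑-⊛ B A φ ⟨
      ∑ (B ⊛ A) φ                            ∎
      where open ≡-Reasoning

    ⊛-identityˡ : ∀ A → List.[ ε ] ⊛ A ≈ A
    ⊛-identityˡ A = mk≈ λ φ → begin
      ∑ (List.[ ε ] ⊛ A) φ         ≡⟨ ∑-⊛ List.[ ε ] A φ ⟩
      ∑ A (λ a → φ (ε ∙ a)) + 0    ≡⟨ +-identityʳ _ ⟩
      ∑ A (λ a → φ (ε ∙ a))        ≡⟨ ∑-cong A (λ a → cong φ (G.identityˡ a)) ⟩
      ∑ A φ                        ∎
      where open ≡-Reasoning

    ⊛-distribʳ-⊕ : ∀ C A B → (A ⊕ B) ⊛ C ≈ A ⊛ C ⊕ B ⊛ C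
    ⊛-distribʳ-⊕ C A B = mk≈ λ φ → begin
      ∑ ((A ⊕ B) ⊛ C) φ                             ≡⟨ ∑-⊛ (A ⊕ B) C φ ⟩
      ∑ (A ⊕ B) (λ x → ∑ C (λ c → φ (x ∙ c)))       ≡⟨ ∑-⊕ A B _ ⟩
      ∑ A _ + ∑ B _                                 ≡⟨ cong₂ _+_ (∑-⊛ A C φ) (∑-⊛ B C φ) ⟨
      ∑ (A ⊛ C) φ + ∑ (B ⊛ C) φ                     ≡⟨ ∑-⊕ (A ⊛ C) (B ⊛ C) φ ⟨
      ∑ (A ⊛ C ⊕ B ⊛ C) φ                           ∎
      where open ≡-Reasoning

  -- Supplies the powers `_↑_` and the solver that rearranges products of measures.
  measureSemiring : CommutativeSemiring 0ℓ 0ℓ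
  measureSemiring = record
    { Carrier = Measure
    ; _≈_ = _≈_
    ; _+_ = _⊕_
    ; _*_ = _⊛_
    ; 0# = []
    ; 1# = List.[ ε ]
    ; isCommutativeSemiring = isCommutativeSemiringˡ record
      { +-isCommutativeMonoid = record
        { isMonoid = record
          { isSemigroup = record
            { isMagma = record { isEquivalence = ≈-isEquivalence ; ∙-cong = ⊕-cong }
            ; assoc = λ A B C → mk≈ λ φ → trans (trans (∑-⊕ (A ⊕ B) C φ) (cong (_+ _) (∑-⊕ A B φ)))
                (trans (+-assoc (∑ A φ) _ _) (sym (trans (∑-⊕ A (B ⊕ C) φ) (cong (_ +_) (∑-⊕ B C φ))))) }
          ; identity = (λ A → mk≈ λ φ → refl) , λ A → mk≈ λ φ → trans (∑-⊕ A [] φ) (+-identityʳ _) }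
        ; comm = λ A B → mk≈ λ φ → trans (∑-⊕ A B φ) (trans (+-comm (∑ A φ) _) (sym (∑-⊕ B A φ))) }
      ; *-isCommutativeMonoid = record
        { isMonoid = record
          { isSemigroup = record
            { isMagma = record { isEquivalence = ≈-isEquivalence ; ∙-cong = ⊛-cong }
            ; assoc = ⊛-assoc }
          ; identity = ⊛-identityˡ , λ A → mk≈ λ φ → trans (∑≡ (⊛-comm A List.[ ε ]) φ) (∑≡ (⊛-identityˡ A) φ) }
        ; comm = ⊛-comm }
      ; distribʳ = ⊛-distribʳ-⊕
      ; zeroˡ = λ A → mk≈ λ φ → refl } }
    where
    ≈-isEquivalence = record
      { refl = mk≈ λ φ → refl
      ; sym = λ A≈B → mk≈ λ φ → sym (∑≡ A≈B φ)
      ; trans = λ A≈B B≈C → mk≈ λ φ → trans (∑≡ A≈B φ) (∑≡ B≈C φ) }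
    ⊕-cong : ∀ {A A' B B'} → A ≈ A' → B ≈ B' → A ⊕ B ≈ A' ⊕ B'
    ⊕-cong {A} {A'} {B} {B'} A≈A' B≈B' = mk≈ λ φ →
      trans (∑-⊕ A B φ) (trans (cong₂ _+_ (∑≡ A≈A' φ) (∑≡ B≈B' φ)) (sym (∑-⊕ A' B' φ)))

  module 𝕄 = CommutativeSemiring measureSemiring
  open import Algebra.Properties.CommutativeSemiring.Exp measureSemiring public
    renaming (_^_ to _↑_; ^-homo-* to ↑-homo-⊛; ^-assocʳ to ↑-assocʳ)
    using ()
  open import Algebra.Solver.CommutativeMonoid 𝕄.*-commutativeMonoid public
    using (prove; var) renaming (_⊕_ to _:∙_; id to :1)

  -- By orthogonality of characters, the L² inner product of the two exponential sums.
  ∑∑δ : Measure → Measure → ℕ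
  ∑∑δ A B = ∑ A λ a → ∑ B λ b → δ a b

  -- Grouped by the common value v, the pairing becomes a sum of products of multiplicities, to
  -- which the Cauchy-Schwarz inequality for finite sums applies. `V` contains both supports without
  -- repetition, so the same index set serves all three pairings.
  δ-cauchy-schwarz : ∀ A B → ∑∑δ A B * ∑∑δ A B ≤ ∑∑δ A A * ∑∑δ B B
  δ-cauchy-schwarz A B = begin
    ∑∑δ A B * ∑∑δ A B                         ≡⟨ cong₂ _*_ AB AB ⟩
    ∑ V (λ v → ∑ A (λ a → δ a v) * ∑ B (λ b → δ b v)) * ∑ V (λ v → ∑ A (λ a → δ a v) * ∑ B (λ b → δ b v))
                                                  ≤⟨ ∑-cauchy-schwarz V (λ v → ∑ A (λ a → δ a v)) (λ v → ∑ B (λ b → δ b v)) ⟩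
    ∑ V (λ v → ∑ A (λ a → δ a v) * ∑ A (λ b → δ b v)) * ∑ V (λ v → ∑ B (λ a → δ a v) * ∑ B (λ b → δ b v))
                                                  ≡⟨ cong₂ _*_ (expand A A inˡ) (expand B B inʳ) ⟨
    ∑∑δ A A * ∑∑δ B B                                     ∎
    where
    open ≤-Reasoning
    V = deduplicate _≟Γ_ (A ++ B)
    inˡ : ∀ {a} → a ∈ A → a ∈ V
    inˡ a∈A = ∈-deduplicate⁺ _≟Γ_ (∈-++⁺ˡ a∈A)
    inʳ : ∀ {b} → b ∈ B → b ∈ V
    inʳ b∈B = ∈-deduplicate⁺ _≟Γ_ (∈-++⁺ʳ A b∈B)
    expand : ∀ C D → (∀ {c} → c ∈ C → c ∈ V) →
             ∑∑δ C D ≡ ∑ V (λ v → ∑ C (λ c → δ c v) * ∑ D (λ d → δ d v))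
    expand C D C⊆V = ≡.begin
      ∑ C (λ c → ∑ D (λ d → δ c d))                            ≡.≡⟨ ∑-cong C (λ c → ∑-cong D λ d → δ-⇔ sym sym) ⟩
      ∑ C (λ c → ∑ D (λ d → δ d c))                            ≡.≡⟨ ∑-cong-∈ C (λ c∈C → ∑-δ (deduplicate-! (A ++ B)) (C⊆V c∈C) (λ v → ∑ D (λ d → δ d v))) ⟨
      ∑ C (λ c → ∑ V (λ v → δ c v * ∑ D (λ d → δ d v)))        ≡.≡⟨ ∑-swap C V _ ⟩
      ∑ V (λ v → ∑ C (λ c → δ c v * ∑ D (λ d → δ d v)))        ≡.≡⟨ ∑-cong V (λ v → ∑-*ʳ C (λ c → δ c v) _) ⟩
      ∑ V (λ v → ∑ C (λ c → δ c v) * ∑ D (λ d → δ d v))        ≡.∎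
      where module ≡ = ≡-Reasoning
    AB = expand A B inˡ

  ⊛-congˡ : ∀ W {X Y} → X ≈ Y → W ⊛ X ≈ W ⊛ Y
  ⊛-congˡ W X≈Y = 𝕄.*-cong {W} 𝕄.refl X≈Y

  ⊛-congʳ : ∀ W {X Y} → X ≈ Y → X ⊛ W ≈ Y ⊛ W
  ⊛-congʳ W X≈Y = 𝕄.*-cong {v = W} X≈Y 𝕄.refl

  infix 8 ⟨_,_⟩

  opaque
    ⟨_,_⟩ : Measure → Measure → ℕ
    ⟨_,_⟩ = ∑∑δ

  -- The squared L² norm; hence `E (A ↑ s)` is the moment of order 2s of the exponential sum of `A`.
  E : Measure → ℕ
  E A = ⟨ A , A ⟩

  infix 9 _˘

  -- Complex conjugation of the exponential sum.
  _˘ : Measure → Measure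
  A ˘ = map _⁻¹ A

  opaque
    unfolding ⟨_,_⟩

    ⟨⟩-cong : ∀ {A A' B B'} → A ≈ A' → B ≈ B' → ⟨ A , B ⟩ ≡ ⟨ A' , B' ⟩
    ⟨⟩-cong {A' = A'} A≈A' B≈B' = trans (∑≡ A≈A' _) (∑-cong A' λ a → ∑≡ B≈B' _)

    ⟨⟩-congʳ : ∀ A {B B'} → B ≈ B' → ⟨ A , B ⟩ ≡ ⟨ A , B' ⟩
    ⟨⟩-congʳ A B≈B' = ⟨⟩-cong {A} 𝕄.refl B≈B'

    E-cong : ∀ {A B} → A ≈ B → E A ≡ E B
    E-cong A≈B = ⟨⟩-cong A≈B A≈B

    E-mono : ∀ {A B} → A ≼ B → E A ≤ E B
    E-mono {A} {B} A≼B = ≤-trans (∑-mono A λ a → ∑≤ A≼B _) (∑≤ A≼B _)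

    ⟨⟩-comm : ∀ A B → ⟨ A , B ⟩ ≡ ⟨ B , A ⟩
    ⟨⟩-comm A B = trans (∑-swap A B δ) (∑-cong B λ b → ∑-cong A λ a → δ-⇔ sym sym)

    E-⊕ : ∀ A B → E (A ⊕ B) ≡ E A + 2 * ⟨ A , B ⟩ + E B
    E-⊕ A B = begin
      ∑ (A ⊕ B) (λ x → ∑ (A ⊕ B) (δ x))                           ≡⟨ ∑-⊕ A B _ ⟩
      ∑ A (λ x → ∑ (A ⊕ B) (δ x)) + ∑ B (λ x → ∑ (A ⊕ B) (δ x))   ≡⟨ cong₂ _+_ (split A) (split B) ⟩
      (E A + ⟨ A , B ⟩) + (⟨ B , A ⟩ + E B)                       ≡⟨ cong (λ u → (E A + ⟨ A , B ⟩) + (u + E B)) (⟨⟩-comm B A) ⟩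
      (E A + ⟨ A , B ⟩) + (⟨ A , B ⟩ + E B)                       ≡⟨ l (E A) ⟨ A , B ⟩ (E B) ⟩
      E A + 2 * ⟨ A , B ⟩ + E B                                   ∎
      where
      open ≡-Reasoning
      split : ∀ C → ∑ C (λ x → ∑ (A ⊕ B) (δ x)) ≡ ⟨ C , A ⟩ + ⟨ C , B ⟩
      split C = trans (∑-cong C λ x → ∑-⊕ A B (δ x)) (∑-+ C _ _)
      l : ∀ a b c → (a + b) + (b + c) ≡ a + 2 * b + c
      l = solve-∀

    cauchy-schwarz : ∀ A B → ⟨ A , B ⟩ * ⟨ A , B ⟩ ≤ E A * E B
    cauchy-schwarz = δ-cauchy-schwarz

    private
      ∑-⟨⊛⟩ : ∀ A C B → ⟨ A ⊛ C , B ⟩ ≡ ∑ A (λ a → ∑ C (λ c → ∑ B (λ b → δ (a ∙ c) b)))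
      ∑-⟨⊛⟩ A C B = ∑-⊛ A C _

      ∑-⟨,⊛⟩ : ∀ A B C → ⟨ A , B ⊛ C ⟩ ≡ ∑ A (λ a → ∑ C (λ c → ∑ B (λ b → δ a (b ∙ c))))
      ∑-⟨,⊛⟩ A B C = ∑-cong A λ a → trans (∑-⊛ B C (δ a)) (∑-swap B C _)

      move : ∀ a c b → a ∙ c ≡ b → a ≡ b ∙ (c ⁻¹)
      move a c b ac≡b = begin
        a                    ≡⟨ G.identityʳ a ⟨
        a ∙ ε                ≡⟨ cong (a ∙_) (G.inverseʳ c) ⟨
        a ∙ (c ∙ (c ⁻¹))     ≡⟨ G.assoc a c (c ⁻¹) ⟨
        (a ∙ c) ∙ (c ⁻¹)     ≡⟨ cong (_∙ (c ⁻¹)) ac≡b ⟩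
        b ∙ (c ⁻¹)           ∎
        where open ≡-Reasoning

      move⁻ : ∀ a c b → a ≡ b ∙ (c ⁻¹) → a ∙ c ≡ b
      move⁻ a c b a≡bc⁻¹ = begin
        a ∙ c                ≡⟨ cong (_∙ c) a≡bc⁻¹ ⟩
        (b ∙ (c ⁻¹)) ∙ c     ≡⟨ G.assoc b (c ⁻¹) c ⟩
        b ∙ ((c ⁻¹) ∙ c)     ≡⟨ cong (b ∙_) (G.inverseˡ c) ⟩
        b ∙ ε                ≡⟨ G.identityʳ b ⟩
        b                    ∎
        where open ≡-Reasoning

    -- The adjoint of a multiplication operator is multiplication by the conjugate.
    ⟨⟩-adjointˡ : ∀ A B C → ⟨ A ⊛ C , B ⟩ ≡ ⟨ A , B ⊛ C ˘ ⟩
    ⟨⟩-adjointˡ A B C = begin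
      ⟨ A ⊛ C , B ⟩                                             ≡⟨ ∑-⟨⊛⟩ A C B ⟩
      ∑ A (λ a → ∑ C (λ c → ∑ B (λ b → δ (a ∙ c) b)))           ≡⟨ ∑-cong A (λ a → ∑-cong C λ c → ∑-cong B λ b → δ-⇔ (move a c b) (move⁻ a c b)) ⟩
      ∑ A (λ a → ∑ C (λ c → ∑ B (λ b → δ a (b ∙ (c ⁻¹)))))      ≡⟨ ∑-cong A (λ a → ∑-map _⁻¹ C _) ⟨
      ∑ A (λ a → ∑ (C ˘) (λ c → ∑ B (λ b → δ a (b ∙ c))))       ≡⟨ ∑-⟨,⊛⟩ A B (C ˘) ⟨
      ⟨ A , B ⊛ C ˘ ⟩                                           ∎
      where open ≡-Reasoning

    ⟨⟩-adjointʳ : ∀ A B C → ⟨ A ⊛ C ˘ , B ⟩ ≡ ⟨ A , B ⊛ C ⟩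
    ⟨⟩-adjointʳ A B C = begin
      ⟨ A ⊛ C ˘ , B ⟩    ≡⟨ ⟨⟩-comm (A ⊛ C ˘) B ⟩
      ⟨ B , A ⊛ C ˘ ⟩    ≡⟨ ⟨⟩-adjointˡ B A C ⟨
      ⟨ B ⊛ C , A ⟩      ≡⟨ ⟨⟩-comm (B ⊛ C) A ⟩
      ⟨ A , B ⊛ C ⟩      ∎
      where open ≡-Reasoning

  opaque
    unfolding ⟨_,_⟩

    ⟨⟩≡0 : ∀ {A B} → (∀ {a b} → a ∈ A → b ∈ B → a ≢ b) → ⟨ A , B ⟩ ≡ 0
    ⟨⟩≡0 {A} {B} A≢B = ∑-zero A λ a∈A → ∑-zero B λ b∈B → δ-≢ (A≢B a∈A b∈B)

    ⟨⟩-⊕ˡ : ∀ A B C → ⟨ A ⊕ B , C ⟩ ≡ ⟨ A , C ⟩ + ⟨ B , C ⟩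
    ⟨⟩-⊕ˡ A B C = ∑-⊕ A B _

    ⟨⟩-∑ : ∀ A B → ⟨ A , B ⟩ ≡ ∑ A λ a → ∑ B λ b → δ a b
    ⟨⟩-∑ A B = refl

    ⟨⟩-[]ˡ : ∀ A → ⟨ [] , A ⟩ ≡ 0
    ⟨⟩-[]ˡ A = refl

  -- |W|²|f|²|g|² is the product of |W|²|f|² and |W|²|g|² up to moving factors across the pairing.
  E-cauchy-schwarz : ∀ W f g → E (W ⊛ f ⊛ g) * E (W ⊛ f ⊛ g) ≤ E (W ⊛ f ⊛ f) * E (W ⊛ g ⊛ g)
  E-cauchy-schwarz W f g = begin
    E (W ⊛ f ⊛ g) * E (W ⊛ f ⊛ g)                                            ≡⟨ cong₂ _*_ cross cross ⟩
    ⟨ W ⊛ f ⊛ f ˘ , W ⊛ g ⊛ g ˘ ⟩ * ⟨ W ⊛ f ⊛ f ˘ , W ⊛ g ⊛ g ˘ ⟩            ≤⟨ cauchy-schwarz (W ⊛ f ⊛ f ˘) (W ⊛ g ⊛ g ˘) ⟩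
    E (W ⊛ f ⊛ f ˘) * E (W ⊛ g ⊛ g ˘)                                        ≡⟨ cong₂ _*_ (diagonal f) (diagonal g) ⟩
    E (W ⊛ f ⊛ f) * E (W ⊛ g ⊛ g)                                            ∎
    where
    open ≤-Reasoning
    swap-last : ∀ A B C → A ⊛ B ⊛ C ≈ A ⊛ C ⊛ B
    swap-last A B C = prove 3 ((var 0F :∙ var 1F) :∙ var 2F) ((var 0F :∙ var 2F) :∙ var 1F) (A ∷ B ∷ C ∷ [])
    cross : E (W ⊛ f ⊛ g) ≡ ⟨ W ⊛ f ⊛ f ˘ , W ⊛ g ⊛ g ˘ ⟩
    cross = ≡.begin
      ⟨ W ⊛ f ⊛ g , W ⊛ f ⊛ g ⟩            ≡.≡⟨ ⟨⟩-congʳ (W ⊛ f ⊛ g) (swap-last W f g) ⟩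
      ⟨ W ⊛ f ⊛ g , W ⊛ g ⊛ f ⟩            ≡.≡⟨ ⟨⟩-adjointˡ (W ⊛ f) (W ⊛ g ⊛ f) g ⟩
      ⟨ W ⊛ f , W ⊛ g ⊛ f ⊛ g ˘ ⟩          ≡.≡⟨ ⟨⟩-congʳ (W ⊛ f) (swap-last (W ⊛ g) f (g ˘)) ⟩
      ⟨ W ⊛ f , W ⊛ g ⊛ g ˘ ⊛ f ⟩          ≡.≡⟨ ⟨⟩-adjointʳ (W ⊛ f) (W ⊛ g ⊛ g ˘) f ⟨
      ⟨ W ⊛ f ⊛ f ˘ , W ⊛ g ⊛ g ˘ ⟩        ≡.∎
      where module ≡ = ≡-Reasoning
    diagonal : ∀ f → E (W ⊛ f ⊛ f ˘) ≡ E (W ⊛ f ⊛ f)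
    diagonal f = ≡.begin
      ⟨ W ⊛ f ⊛ f ˘ , W ⊛ f ⊛ f ˘ ⟩        ≡.≡⟨ ⟨⟩-adjointʳ (W ⊛ f) (W ⊛ f ⊛ f ˘) f ⟩
      ⟨ W ⊛ f , W ⊛ f ⊛ f ˘ ⊛ f ⟩          ≡.≡⟨ ⟨⟩-congʳ (W ⊛ f) (swap-last (W ⊛ f) (f ˘) f) ⟩
      ⟨ W ⊛ f , W ⊛ f ⊛ f ⊛ f ˘ ⟩          ≡.≡⟨ ⟨⟩-adjointˡ (W ⊛ f) (W ⊛ f ⊛ f) f ⟨
      ⟨ W ⊛ f ⊛ f , W ⊛ f ⊛ f ⟩            ≡.∎
      where module ≡ = ≡-Reasoning

  -- A single character has modulus 1.
  E-⊛-singleton : ∀ W g → E (W ⊛ List.[ g ]) ≡ E W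
  E-⊛-singleton W g = begin
    ⟨ W ⊛ List.[ g ] , W ⊛ List.[ g ] ⟩           ≡⟨ ⟨⟩-adjointˡ W (W ⊛ List.[ g ]) List.[ g ] ⟩
    ⟨ W , W ⊛ List.[ g ] ⊛ List.[ g ⁻¹ ] ⟩        ≡⟨ ⟨⟩-congʳ W (𝕄.*-assoc W List.[ g ] List.[ g ⁻¹ ]) ⟩
    ⟨ W , W ⊛ List.[ g ∙ (g ⁻¹) ] ⟩               ≡⟨ cong (λ h → ⟨ W , W ⊛ List.[ h ] ⟩) (G.inverseʳ g) ⟩
    ⟨ W , W ⊛ List.[ ε ] ⟩                        ≡⟨ ⟨⟩-congʳ W (𝕄.*-identityʳ W) ⟩
    ⟨ W , W ⟩                                     ∎
    where open ≡-Reasoning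

  -- Hölder's inequality with integral exponents: by `E-cauchy-schwarz` the moments are log-convex
  -- in the number of factors `X`.
  interpolation : ∀ W X Y i j →
    E (W ⊛ (X ↑ i ⊛ Y ↑ j)) ^ (i + j) ≤ E (W ⊛ X ↑ (i + j)) ^ i * E (W ⊛ Y ↑ (i + j)) ^ j
  interpolation W X Y i j = begin
    E (W ⊛ (X ↑ i ⊛ Y ↑ j)) ^ N         ≡⟨ cong (λ u → E (W ⊛ (X ↑ i ⊛ Y ↑ u)) ^ N) (m+n∸m≡n i j) ⟨
    e i ^ N                             ≤⟨ LogConvex.interpolate e N i j refl convex ⟩
    e N ^ i * e 0 ^ j                   ≡⟨ cong₂ (λ u v → u ^ i * v ^ j) e-N e-0 ⟩
    E (W ⊛ X ↑ N) ^ i * E (W ⊛ Y ↑ N) ^ j   ∎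
    where
    open ≤-Reasoning
    N = i + j
    e : ℕ → ℕ
    e i = E (W ⊛ (X ↑ i ⊛ Y ↑ (N ∸ i)))
    e-N : e N ≡ E (W ⊛ X ↑ N)
    e-N rewrite n∸n≡0 N = E-cong (⊛-congˡ W (𝕄.*-identityʳ (X ↑ N)))
    e-0 : e 0 ≡ E (W ⊛ Y ↑ N)
    e-0 = E-cong (⊛-congˡ W (𝕄.*-identityˡ (Y ↑ N)))
    convex : ∀ i → suc i < N → e (suc i) * e (suc i) ≤ e i * e (suc (suc i))
    convex i 1+i<N with r , eq ← m≤n⇒∃[o]m+o≡n 1+i<N = subst₂ _≤_
      (cong (λ u → u * u) (sym mid)) (trans (*-comm (E (V ⊛ X ⊛ X)) _) (sym (cong₂ _*_ low high))) (E-cauchy-schwarz V X Y)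
      where
      -- The factor common to three consecutive moments; what remains of them is Y Y, X Y and X X.
      V = W ⊛ (X ↑ i ⊛ Y ↑ r)
      N∸ : ∀ m → m + (suc (suc i) ∸ m) ≡ suc (suc i) → N ∸ m ≡ (suc (suc i) ∸ m) + r
      N∸ m m+ = trans (cong (_∸ m) (trans (sym eq) (trans (cong (_+ r) (sym m+)) (+-assoc m _ r)))) (m+n∸m≡n m _)
      rearrange : ∀ W A B X Y → W ⊛ ((X ⊛ A) ⊛ (Y ⊛ B)) ≈ W ⊛ (A ⊛ B) ⊛ X ⊛ Y
      rearrange W A B X Y = prove 5
        (var 0F :∙ ((var 3F :∙ var 1F) :∙ (var 4F :∙ var 2F)))
        (((var 0F :∙ (var 1F :∙ var 2F)) :∙ var 3F) :∙ var 4F) (W ∷ A ∷ B ∷ X ∷ Y ∷ [])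
      rearrange₂ : ∀ W A B Y → W ⊛ (A ⊛ (Y ⊛ (Y ⊛ B))) ≈ W ⊛ (A ⊛ B) ⊛ Y ⊛ Y
      rearrange₂ W A B Y = prove 4
        (var 0F :∙ (var 1F :∙ (var 3F :∙ (var 3F :∙ var 2F))))
        (((var 0F :∙ (var 1F :∙ var 2F)) :∙ var 3F) :∙ var 3F) (W ∷ A ∷ B ∷ Y ∷ [])
      rearrange₃ : ∀ W A B X → W ⊛ ((X ⊛ (X ⊛ A)) ⊛ B) ≈ W ⊛ (A ⊛ B) ⊛ X ⊛ X
      rearrange₃ W A B X = prove 4
        (var 0F :∙ ((var 3F :∙ (var 3F :∙ var 1F)) :∙ var 2F))
        (((var 0F :∙ (var 1F :∙ var 2F)) :∙ var 3F) :∙ var 3F) (W ∷ A ∷ B ∷ X ∷ [])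
      1+i+[2+i∸1+i]≡2+i : suc i + (suc (suc i) ∸ suc i) ≡ suc (suc i)
      1+i+[2+i∸1+i]≡2+i = m+[n∸m]≡n (n≤1+n (suc i))
      i+[2+i∸i]≡2+i : i + (suc (suc i) ∸ i) ≡ suc (suc i)
      i+[2+i∸i]≡2+i = m+[n∸m]≡n (m≤n⇒m≤1+n (n≤1+n i))
      mid : e (suc i) ≡ E (V ⊛ X ⊛ Y)
      mid rewrite N∸ (suc i) 1+i+[2+i∸1+i]≡2+i | m+n∸n≡m 1 i = E-cong (rearrange W (X ↑ i) (Y ↑ r) X Y)
      low : e i ≡ E (V ⊛ Y ⊛ Y)
      low rewrite N∸ i i+[2+i∸i]≡2+i | m+n∸n≡m 2 i = E-cong (rearrange₂ W (X ↑ i) (Y ↑ r) Y)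
      high : e (suc (suc i)) ≡ E (V ⊛ X ⊛ X)
      high rewrite N∸ (suc (suc i)) (m+[n∸m]≡n (≤-refl {suc (suc i)})) | n∸n≡0 i = E-cong (rearrange₃ W (X ↑ i) (Y ↑ r) X)

  E-max : ∀ W X Y i j {V} → 1 ≤ i + j → E (W ⊛ X ↑ (i + j)) ≤ V → E (W ⊛ Y ↑ (i + j)) ≤ V →
          E (W ⊛ (X ↑ i ⊛ Y ↑ j)) ≤ V
  E-max W X Y i j {V} 1≤i+j EX≤V EY≤V = root (i + j) 1≤i+j (begin
    E (W ⊛ (X ↑ i ⊛ Y ↑ j)) ^ (i + j)                             ≤⟨ interpolation W X Y i j ⟩
    E (W ⊛ X ↑ (i + j)) ^ i * E (W ⊛ Y ↑ (i + j)) ^ j             ≤⟨ *-mono-≤ (^-monoˡ-≤ i EX≤V) (^-monoˡ-≤ j EY≤V) ⟩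
    V ^ i * V ^ j                                                 ≡⟨ ^-distribˡ-+-* V i j ⟨
    V ^ (i + j)                                                   ∎)
    where
    open ≤-Reasoning
    root : ∀ n → 1 ≤ n → ∀ {x} → x ^ n ≤ V ^ n → x ≤ V
    root (suc n) _ = ^-cancelʳ-≤ n

  -- A bound x²V on the energy says that the norm is at most x√V. In this form the inequalities for
  -- norms need no square roots.
  ⟨⟩≤ : ∀ A B x y V → E A ≤ x * x * V → E B ≤ y * y * V → ⟨ A , B ⟩ ≤ x * y * V
  ⟨⟩≤ A B x y V EA≤ EB≤ = m²≤n²⇒m≤n (begin
    ⟨ A , B ⟩ * ⟨ A , B ⟩        ≤⟨ cauchy-schwarz A B ⟩
    E A * E B                    ≤⟨ *-mono-≤ EA≤ EB≤ ⟩
    x * x * V * (y * y * V)      ≡⟨ l x y V ⟩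
    x * y * V * (x * y * V)      ∎)
    where
    open ≤-Reasoning
    l : ∀ x y V → x * x * V * (y * y * V) ≡ x * y * V * (x * y * V)
    l = solve-∀

  E-triangle : ∀ A B x y V → E A ≤ x * x * V → E B ≤ y * y * V → E (A ⊕ B) ≤ (x + y) * (x + y) * V
  E-triangle A B x y V EA≤ EB≤ = begin
    E (A ⊕ B)                                       ≡⟨ E-⊕ A B ⟩
    E A + 2 * ⟨ A , B ⟩ + E B                       ≤⟨ +-mono-≤ (+-mono-≤ EA≤ (*-monoʳ-≤ 2 (⟨⟩≤ A B x y V EA≤ EB≤))) EB≤ ⟩
    x * x * V + 2 * (x * y * V) + y * y * V         ≡⟨ l x y V ⟩
    (x + y) * (x + y) * V                           ∎
    where
    open ≤-Reasoning
    l : ∀ x y V → x * x * V + 2 * (x * y * V) + y * y * V ≡ (x + y) * (x + y) * V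
    l = solve-∀

  E-parallelogram : ∀ A B → E (A ⊕ B) ≤ 2 * E A + 2 * E B
  E-parallelogram A B = begin
    E (A ⊕ B)                      ≡⟨ E-⊕ A B ⟩
    E A + 2 * ⟨ A , B ⟩ + E B      ≤⟨ +-monoˡ-≤ (E B) (+-monoʳ-≤ (E A) 2AB≤) ⟩
    E A + (E A + E B) + E B        ≡⟨ l (E A) (E B) ⟩
    2 * E A + 2 * E B              ∎
    where
    open ≤-Reasoning
    l : ∀ a b → a + (a + b) + b ≡ 2 * a + 2 * b
    l = solve-∀
    2AB≤ : 2 * ⟨ A , B ⟩ ≤ E A + E B
    2AB≤ = begin
      2 * ⟨ A , B ⟩                       ≡⟨ cong (2 *_) (*-identityʳ ⟨ A , B ⟩) ⟨
      2 * (⟨ A , B ⟩ * (1 * 1))           ≤⟨ cross-term {⟨ A , B ⟩} {E A} {E B} 1 1 (cauchy-schwarz A B) ⟩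
      E A * (1 * 1) + E B * (1 * 1)       ≡⟨ cong₂ _+_ (*-identityʳ (E A)) (*-identityʳ (E B)) ⟩
      E A + E B                           ∎

  -- The sup norm of an exponential sum is at most its number of terms, here obtained from the
  -- triangle inequality for the translates of `W`.
  E-⊛-length : ∀ W A → E (W ⊛ A) ≤ length A * length A * E W
  E-⊛-length W []      = ≤-reflexive (trans (E-cong (𝕄.zeroʳ W)) (⟨⟩-[]ˡ []))
  E-⊛-length W (g ∷ A) = ≤-trans (≤-reflexive (E-cong (𝕄.distribˡ W List.[ g ] A)))
    (E-triangle (W ⊛ List.[ g ]) (W ⊛ A) 1 (length A) (E W)
      (≤-reflexive (trans (E-⊛-singleton W g) (sym (*-identityˡ (E W))))) (E-⊛-length W A))

  E-⊛-↑-length : ∀ W A r → E (W ⊛ A ↑ r) ≤ (length A * length A) ^ r * E W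
  E-⊛-↑-length W A zero    = ≤-reflexive (trans (E-cong (𝕄.*-identityʳ W)) (sym (*-identityˡ (E W))))
  E-⊛-↑-length W A (suc r) = begin
    E (W ⊛ (A ⊛ A ↑ r))                                  ≡⟨ E-cong (𝕄.trans (⊛-congˡ W (𝕄.*-comm A (A ↑ r))) (𝕄.sym (𝕄.*-assoc W (A ↑ r) A))) ⟩
    E (W ⊛ A ↑ r ⊛ A)                                    ≤⟨ E-⊛-length (W ⊛ A ↑ r) A ⟩
    m * E (W ⊛ A ↑ r)                                    ≤⟨ *-monoʳ-≤ m (E-⊛-↑-length W A r) ⟩
    m * (m ^ r * E W)                                    ≡⟨ *-assoc m (m ^ r) (E W) ⟨
    m ^ suc r * E W                                      ∎
    where
    open ≤-Reasoning
    m = length A * length A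

  E-one : E List.[ ε ] ≡ 1
  E-one = trans (⟨⟩-∑ List.[ ε ] List.[ ε ]) (cong (λ n → n + 0 + 0) (δ-≡ {ε} refl))

  ⨁ : (ℕ → Measure) → ℕ → Measure
  ⨁ F zero    = []
  ⨁ F (suc n) = ⨁ F n ⊕ F n

  ⊛-⨁ : ∀ W F n → W ⊛ ⨁ F n ≈ ⨁ (λ i → W ⊛ F i) n
  ⊛-⨁ W F zero    = 𝕄.zeroʳ W
  ⊛-⨁ W F (suc n) = 𝕄.trans (𝕄.distribˡ W (⨁ F n) (F n)) (𝕄.+-congʳ (⊛-⨁ W F n))

  ⨁-mono : ∀ {F G} n → (∀ i → i < n → F i ≼ G i) → ⨁ F n ≼ ⨁ G n
  ⨁-mono zero    F≼G = ≼-refl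
  ⨁-mono (suc n) F≼G = ⊕-mono (⨁-mono n λ i i<n → F≼G i (m<n⇒m<1+n i<n)) (F≼G n ≤-refl)

  E-⨁ : ∀ F n {V} → (∀ i → i < n → E (F i) ≤ V) → E (⨁ F n) ≤ n * n * V
  E-⨁ F zero    F≤V = ≤-reflexive (⟨⟩-[]ˡ [])
  E-⨁ F (suc n) {V} F≤V = subst (λ m → E (⨁ F (suc n)) ≤ m * m * V) (+-comm n 1)
    (E-triangle (⨁ F n) (F n) n 1 V (E-⨁ F n λ i i<n → F≤V i (m<n⇒m<1+n i<n))
      (≤-trans (F≤V n ≤-refl) (≤-reflexive (sym (+-identityʳ V)))))

  -- Without cross terms the factor n² of the triangle inequality becomes n. This saving is the
  -- whole of decoupling in degree 1.
  E-⨁-orthogonal : ∀ F n {V} → (∀ i → i < n → E (F i) ≤ V) →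
                   (∀ i j → i < j → j < n → ⟨ F i , F j ⟩ ≡ 0) → E (⨁ F n) ≤ n * V
  E-⨁-orthogonal F zero    F≤V F⊥F = ≤-reflexive (⟨⟩-[]ˡ [])
  E-⨁-orthogonal F (suc n) {V} F≤V F⊥F = begin
    E (⨁ F n ⊕ F n)                              ≡⟨ E-⊕ (⨁ F n) (F n) ⟩
    E (⨁ F n) + 2 * ⟨ ⨁ F n , F n ⟩ + E (F n)    ≡⟨ cong (λ u → E (⨁ F n) + 2 * u + E (F n)) (⊥-⨁ n λ i i<n → F⊥F i n i<n ≤-refl) ⟩
    E (⨁ F n) + 0 + E (F n)                      ≡⟨ cong (_+ E (F n)) (+-identityʳ _) ⟩
    E (⨁ F n) + E (F n)                          ≤⟨ +-mono-≤ (E-⨁-orthogonal F n (λ i i<n → F≤V i (m<n⇒m<1+n i<n)) λ i j i<j j<n → F⊥F i j i<j (m<n⇒m<1+n j<n)) (F≤V n ≤-refl) ⟩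
    n * V + V                                    ≡⟨ +-comm (n * V) V ⟩
    V + n * V                                    ∎
    where
    open ≤-Reasoning
    ⊥-⨁ : ∀ m → (∀ i → i < m → ⟨ F i , F n ⟩ ≡ 0) → ⟨ ⨁ F m , F n ⟩ ≡ 0
    ⊥-⨁ zero    _   = ⟨⟩-[]ˡ (F n)
    ⊥-⨁ (suc m) F⊥ = trans (⟨⟩-⊕ˡ (⨁ F m) (F m) (F n)) (cong₂ _+_ (⊥-⨁ m λ i i<m → F⊥ i (m<n⇒m<1+n i<m)) (F⊥ m ≤-refl))

  E-⊛-⨁ : ∀ W F G n {V} → F ≼ ⨁ G n → (∀ i → i < n → E (W ⊛ G i) ≤ V) → E (W ⊛ F) ≤ n * n * V
  E-⊛-⨁ W F G n F≼ G≤V = ≤-trans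
    (E-mono (≼-trans (⊛-mono (≼-refl {W}) F≼) (≈⇒≼ (⊛-⨁ W G n))))
    (E-⨁ (λ i → W ⊛ G i) n G≤V)

  -- Only one factor `F` is opened. The largest resulting term is compared, by Hölder's inequality,
  -- with a pure power of `G j` and with the left side `T` itself, and then `T ^ r` cancels.
  E-↑-⨁ : ∀ W F G n r {V} → F ≼ ⨁ G n → (∀ i → i < n → E (W ⊛ G i ↑ r) ≤ V) → 1 ≤ n →
          E (W ⊛ F ↑ r) ≤ (n * n) ^ r * V
  E-↑-⨁ W F G n zero F≼ G≤V 1≤n = ≤-trans (G≤V 0 1≤n) (≤-reflexive (sym (+-identityʳ _)))
  E-↑-⨁ W F G n (suc r) {V} F≼ G≤V 1≤n = cancel T refl power
    where
    open ≤-Reasoning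
    T = E (W ⊛ F ↑ suc r)
    T≤ : ∀ {j} → j < n → (∀ i → i < n → E (W ⊛ (G i ↑ 1 ⊛ F ↑ r)) ≤ E (W ⊛ (G j ↑ 1 ⊛ F ↑ r))) →
         T ≤ n * n * E (W ⊛ (G j ↑ 1 ⊛ F ↑ r))
    T≤ {j} j<n max = begin
      E (W ⊛ (F ⊛ F ↑ r))                      ≡⟨ E-cong (shuffle W F (F ↑ r)) ⟩
      E ((W ⊛ F ↑ r) ⊛ F)                      ≤⟨ E-⊛-⨁ (W ⊛ F ↑ r) F G n F≼ (λ i i<n → ≤-trans (≤-reflexive (E-cong (shuffle₁ W (F ↑ r) (G i)))) (max i i<n)) ⟩
      n * n * E (W ⊛ (G j ↑ 1 ⊛ F ↑ r))        ∎
      where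
      shuffle : ∀ W F X → W ⊛ (F ⊛ X) ≈ (W ⊛ X) ⊛ F
      shuffle W F X = prove 3 (var 0F :∙ (var 1F :∙ var 2F)) ((var 0F :∙ var 2F) :∙ var 1F) (W ∷ F ∷ X ∷ [])
      shuffle₁ : ∀ W X G → (W ⊛ X) ⊛ G ≈ W ⊛ (G ↑ 1 ⊛ X)
      shuffle₁ W X G = prove 3 ((var 0F :∙ var 1F) :∙ var 2F) (var 0F :∙ ((var 2F :∙ :1) :∙ var 1F)) (W ∷ X ∷ G ∷ [])
    power : T ^ suc r ≤ T ^ r * ((n * n) ^ suc r * V)
    power with j , j≤n-1 , max ← argmax (λ i → E (W ⊛ (G i ↑ 1 ⊛ F ↑ r))) (n ∸ 1) = begin
      T ^ suc r                                                ≤⟨ ^-monoˡ-≤ (suc r) (T≤ j<n λ i i<n → max i (∸-monoˡ-≤ 1 i<n)) ⟩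
      (n * n * E (W ⊛ (G j ↑ 1 ⊛ F ↑ r))) ^ suc r              ≡⟨ *-^-comm (n * n) _ (suc r) ⟩
      (n * n) ^ suc r * E (W ⊛ (G j ↑ 1 ⊛ F ↑ r)) ^ suc r      ≤⟨ *-monoʳ-≤ ((n * n) ^ suc r) (interpolation W (G j) F 1 r) ⟩
      (n * n) ^ suc r * (E (W ⊛ G j ↑ suc r) ^ 1 * T ^ r)      ≤⟨ *-monoʳ-≤ ((n * n) ^ suc r) (*-monoˡ-≤ (T ^ r) (≤-trans (≤-reflexive (*-identityʳ _)) (G≤V j j<n))) ⟩
      (n * n) ^ suc r * (V * T ^ r)                            ≡⟨ l ((n * n) ^ suc r) V (T ^ r) ⟩
      T ^ r * ((n * n) ^ suc r * V)                            ∎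
      where
      j<n : j < n
      j<n = ≤-trans (s≤s j≤n-1) (≤-reflexive (m+[n∸m]≡n 1≤n))
      l : ∀ a b c → a * (b * c) ≡ c * (a * b)
      l = solve-∀
    cancel : ∀ t → T ≡ t → t ^ suc r ≤ t ^ r * ((n * n) ^ suc r * V) → T ≤ (n * n) ^ suc r * V
    cancel zero    T≡0 _ = ≤-trans (≤-reflexive T≡0) z≤n
    cancel (suc t) T≡t p = ≤-trans (≤-reflexive T≡t) (*-cancelˡ-≤ (suc t ^ r) {{m^n≢0 (suc t) r}}
      (≤-trans (≤-reflexive (*-comm (suc t ^ r) (suc t))) p))

  -- The broad-narrow dichotomy.

  private
    others : (ℕ → Measure) → ℕ → ℕ → Measure
    others G a b with a ≟ b
    ... | yes _ = []
    ... | no  _ = G b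

    others-≢ : ∀ G {a b} → a ≢ b → others G a b ≡ G b
    others-≢ G {a} {b} a≢b with a ≟ b
    ... | yes a≡b = contradiction a≡b a≢b
    ... | no  _   = refl

    others-≡ : ∀ G {a b} → a ≡ b → others G a b ≡ []
    others-≡ G {a} {b} a≡b with a ≟ b
    ... | yes _   = refl
    ... | no  a≢b = contradiction a≡b a≢b

    ⨁-extract : ∀ G n {a} → a < n → ⨁ G n ≼ G a ⊕ ⨁ (others G a) n
    ⨁-extract G (suc n) {a} (s≤s a≤n) with m≤n⇒m<n∨m≡n a≤n
    ... | inj₁ a<n rewrite others-≢ G (<⇒≢ a<n) = ≼-trans (⊕-mono (⨁-extract G n a<n) ≼-refl)
      (≈⇒≼ (𝕄.+-assoc (G a) (⨁ (others G a) n) (G n)))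
    ... | inj₂ refl rewrite others-≡ G {n} refl = ≼-trans (≈⇒≼ (𝕄.+-comm (⨁ G n) (G n)))
      (⊕-mono (≼-refl {G n}) (≼-trans (⨁-mono n λ i i<n → ≡⇒≼ (sym (others-≢ G (>⇒≢ i<n)))) (≈⇒≼ (𝕄.sym (𝕄.+-identityʳ (⨁ (others G n) n))))))
      where
      ≡⇒≼ : ∀ {A B} → A ≡ B → A ≼ B
      ≡⇒≼ refl = ≼-refl

  -- With one `A` and one `B` set aside, the rest is a mixed power lying between the two extremes
  -- that the hypotheses bound.
  E-square-max : ∀ W A B N {β} → 1 ≤ N → E (W ⊛ (A ⊛ B ↑ suc N)) ≤ β → E (W ⊛ (B ⊛ A ↑ suc N)) ≤ β →
                 E ((W ⊛ A ⊛ A) ⊛ B ↑ N) ≤ β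
  E-square-max W A B (suc N) {β} _ ABᴺ≤β BAᴺ≤β = ≤-trans (≤-reflexive (E-cong (rearrange W A B (B ↑ N))))
    (E-max (W ⊛ A ⊛ B) A B 1 N (s≤s z≤n)
      (≤-trans (≤-reflexive (E-cong (swap₁ W A B (A ↑ N)))) BAᴺ≤β)
      (≤-trans (≤-reflexive (E-cong (swap₂ W A B (B ↑ N)))) ABᴺ≤β))
    where
    rearrange : ∀ W A B C → (W ⊛ A ⊛ A) ⊛ (B ⊛ C) ≈ (W ⊛ A ⊛ B) ⊛ (A ↑ 1 ⊛ C)
    rearrange W A B C = prove 4 (((var 0F :∙ var 1F) :∙ var 1F) :∙ (var 2F :∙ var 3F))
      (((var 0F :∙ var 1F) :∙ var 2F) :∙ ((var 1F :∙ :1) :∙ var 3F)) (W ∷ A ∷ B ∷ C ∷ [])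
    swap₁ : ∀ W A B C → (W ⊛ A ⊛ B) ⊛ (A ⊛ C) ≈ W ⊛ (B ⊛ (A ⊛ (A ⊛ C)))
    swap₁ W A B C = prove 4 (((var 0F :∙ var 1F) :∙ var 2F) :∙ (var 1F :∙ var 3F))
      (var 0F :∙ (var 2F :∙ (var 1F :∙ (var 1F :∙ var 3F)))) (W ∷ A ∷ B ∷ C ∷ [])
    swap₂ : ∀ W A B C → (W ⊛ A ⊛ B) ⊛ (B ⊛ C) ≈ W ⊛ (A ⊛ (B ⊛ (B ⊛ C)))
    swap₂ W A B C = prove 4 (((var 0F :∙ var 1F) :∙ var 2F) :∙ (var 2F :∙ var 3F))
      (var 0F :∙ (var 1F :∙ (var 2F :∙ (var 2F :∙ var 3F)))) (W ∷ A ∷ B ∷ C ∷ [])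

  module BroadNarrow
    (W F : Measure) (G : ℕ → Measure) (n N : ℕ) {V β : ℕ}
    (1≤n : 1 ≤ n) (1≤N : 1 ≤ N) (F≼⨁G : F ≼ ⨁ G n)
    (narrow : ∀ a → a < n → E (W ⊛ G a ↑ suc (suc N)) ≤ V)
    (broad : ∀ a b → a < n → b < n → a ≢ b → E (W ⊛ (G a ⊛ G b ↑ suc N)) ≤ β)
    where

    private
      β' = (n * n) ^ N * β

      two-one : ∀ a b → a < n → b < n → a ≢ b → E ((W ⊛ G a ⊛ G a) ⊛ G b ↑ N) ≤ β
      two-one a b a<n b<n a≢b = E-square-max W (G a) (G b) N 1≤N
        (broad a b a<n b<n a≢b) (broad b a b<n a<n λ b≡a → a≢b (sym b≡a))

      -- For a third class `c`, Cauchy-Schwarz replaces the product of `G a` and `G b` by two equal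
      -- factors, which brings the number of classes back to two.
      three : ∀ a b c → a < n → b < n → c < n → a ≢ b → E ((W ⊛ G a ⊛ G b) ⊛ G c ↑ N) ≤ β
      three a b c a<n b<n c<n a≢b with c ≟ a | c ≟ b
      ... | yes refl | _ = ≤-trans (≤-reflexive (E-cong (swap W (G c) (G b) (G c ↑ N)))) (broad b c b<n c<n λ b≡c → a≢b (sym b≡c))
        where
        swap : ∀ W A B C → (W ⊛ A ⊛ B) ⊛ C ≈ W ⊛ (B ⊛ (A ⊛ C))
        swap W A B C = prove 4 (((var 0F :∙ var 1F) :∙ var 2F) :∙ var 3F)
          (var 0F :∙ (var 2F :∙ (var 1F :∙ var 3F))) (W ∷ A ∷ B ∷ C ∷ [])
      ... | no _ | yes refl = ≤-trans (≤-reflexive (E-cong (swap W (G a) (G c) (G c ↑ N)))) (broad a c a<n c<n a≢b)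
        where
        swap : ∀ W A B C → (W ⊛ A ⊛ B) ⊛ C ≈ W ⊛ (A ⊛ (B ⊛ C))
        swap W A B C = prove 4 (((var 0F :∙ var 1F) :∙ var 2F) :∙ var 3F)
          (var 0F :∙ (var 1F :∙ (var 2F :∙ var 3F))) (W ∷ A ∷ B ∷ C ∷ [])
      ... | no c≢a | no c≢b = ≤-trans (≤-reflexive (E-cong (swap W (G a) (G b) (G c ↑ N))))
        (E-max (W ⊛ G c ↑ N) (G a) (G b) 1 1 (s≤s z≤n)
          (≤-trans (≤-reflexive (E-cong (square W (G a) (G c ↑ N)))) (two-one a c a<n c<n λ a≡c → c≢a (sym a≡c)))
          (≤-trans (≤-reflexive (E-cong (square W (G b) (G c ↑ N)))) (two-one b c b<n c<n λ b≡c → c≢b (sym b≡c))))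
        where
        swap : ∀ W A B C → (W ⊛ A ⊛ B) ⊛ C ≈ (W ⊛ C) ⊛ (A ↑ 1 ⊛ B ↑ 1)
        swap W A B C = prove 4 (((var 0F :∙ var 1F) :∙ var 2F) :∙ var 3F)
          ((var 0F :∙ var 3F) :∙ ((var 1F :∙ :1) :∙ (var 2F :∙ :1))) (W ∷ A ∷ B ∷ C ∷ [])
        square : ∀ W A C → (W ⊛ C) ⊛ A ↑ 2 ≈ (W ⊛ A ⊛ A) ⊛ C
        square W A C = prove 3 ((var 0F :∙ var 2F) :∙ (var 1F :∙ (var 1F :∙ :1)))
          (((var 0F :∙ var 1F) :∙ var 1F) :∙ var 2F) (W ∷ A ∷ C ∷ [])

      two-full : ∀ a b → a < n → b < n → a ≢ b → E ((W ⊛ G a ⊛ G b) ⊛ F ↑ N) ≤ β'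
      two-full a b a<n b<n a≢b = E-↑-⨁ (W ⊛ G a ⊛ G b) F G n N F≼⨁G
        (λ c c<n → three a b c a<n b<n c<n a≢b) 1≤n

      mixed : ∀ a b j i → j + i ≡ N → a < n → b < n → a ≢ b →
              E ((W ⊛ G a ⊛ G b) ⊛ (G a ↑ j ⊛ F ↑ i)) ≤ β'
      mixed a b j i refl a<n b<n a≢b = E-max (W ⊛ G a ⊛ G b) (G a) F j i 1≤N
        (≤-trans (three a b a a<n b<n a<n a≢b) (m≤n*m β _ {{m^n≢0 (n * n) (j + i) {{m*n≢0 n n {{>-nonZero 1≤n}} {{>-nonZero 1≤n}}}}}}))
        (two-full a b a<n b<n a≢b)

      -- Each remaining factor `F` is opened as `G a` plus the other classes. A term with another
      -- class is bilinear and leaves the induction through `mixed`; otherwise one more factor `G a`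
      -- is gained. The parallelogram inequality costs a factor 2 per opened factor.
      narrow-step : ∀ a j i → j + i ≡ suc N → a < n →
                    E (W ⊛ (G a ↑ suc j ⊛ F ↑ i)) ≤ 2 ^ i * V + (4 * (n * n)) ^ i * β'
      narrow-step a j zero j+0≡1+N a<n with trans (sym (+-identityʳ j)) j+0≡1+N
      ... | refl = begin
        E (W ⊛ (G a ↑ suc (suc N) ⊛ List.[ ε ]))        ≡⟨ E-cong (⊛-congˡ W (𝕄.*-identityʳ (G a ↑ suc (suc N)))) ⟩
        E (W ⊛ G a ↑ suc (suc N))                       ≤⟨ narrow a a<n ⟩
        V                                               ≡⟨ +-identityʳ V ⟨
        1 * V                                           ≤⟨ m≤m+n (1 * V) _ ⟩
        1 * V + 1 * β'                                  ∎
        where open ≤-Reasoning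
      narrow-step a j (suc i) j+1+i≡1+N a<n = begin
        E (W ⊛ (G a ↑ suc j ⊛ (F ⊛ F ↑ i)))             ≤⟨ E-mono (⊛-mono (≼-refl {W}) (⊛-mono (≼-refl {G a ↑ suc j}) (⊛-mono F≼ (≼-refl {F ↑ i})))) ⟩
        E (W ⊛ (G a ↑ suc j ⊛ ((G a ⊕ H) ⊛ F ↑ i)))     ≡⟨ E-cong distribute ⟩
        E (A₁ ⊕ A₂)                                     ≤⟨ E-parallelogram A₁ A₂ ⟩
        2 * E A₁ + 2 * E A₂                             ≤⟨ +-mono-≤ (*-monoʳ-≤ 2 (narrow-step a (suc j) i (trans (sym (+-suc j i)) j+1+i≡1+N) a<n)) (*-monoʳ-≤ 2 EA₂≤) ⟩
        2 * (2 ^ i * V + y * β') + 2 * (n * n * β')     ≡⟨ l (2 ^ i) V y β' (n * n) ⟩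
        2 * 2 ^ i * V + (2 * y + 2 * (n * n)) * β'      ≤⟨ +-monoʳ-≤ (2 * 2 ^ i * V) (*-monoˡ-≤ β' numeric) ⟩
        2 * 2 ^ i * V + 4 * (n * n) * y * β'            ∎
        where
        open ≤-Reasoning
        y = (4 * (n * n)) ^ i
        H = ⨁ (others G a) n
        A₁ = W ⊛ (G a ↑ suc (suc j) ⊛ F ↑ i)
        A₂ = (W ⊛ (G a ↑ suc j ⊛ F ↑ i)) ⊛ H
        F≼ : F ≼ G a ⊕ H
        F≼ = ≼-trans F≼⨁G (⨁-extract G n a<n)
        distribute : W ⊛ (G a ↑ suc j ⊛ ((G a ⊕ H) ⊛ F ↑ i)) ≈ A₁ ⊕ A₂
        distribute = 𝕄.trans (front W (G a ↑ suc j) (G a ⊕ H) (F ↑ i))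
          (𝕄.trans (𝕄.distribˡ (W ⊛ (G a ↑ suc j ⊛ F ↑ i)) (G a) H) (𝕄.+-congʳ (back W (G a ↑ suc j) (G a) (F ↑ i))))
          where
          front : ∀ W A B C → W ⊛ (A ⊛ (B ⊛ C)) ≈ (W ⊛ (A ⊛ C)) ⊛ B
          front W A B C = prove 4 (var 0F :∙ (var 1F :∙ (var 2F :∙ var 3F)))
            ((var 0F :∙ (var 1F :∙ var 3F)) :∙ var 2F) (W ∷ A ∷ B ∷ C ∷ [])
          back : ∀ W A B C → (W ⊛ (A ⊛ C)) ⊛ B ≈ W ⊛ ((B ⊛ A) ⊛ C)
          back W A B C = prove 4 ((var 0F :∙ (var 1F :∙ var 3F)) :∙ var 2F)
            (var 0F :∙ ((var 2F :∙ var 1F) :∙ var 3F)) (W ∷ A ∷ B ∷ C ∷ [])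
        EA₂≤ : E A₂ ≤ n * n * β'
        EA₂≤ = E-⊛-⨁ (W ⊛ (G a ↑ suc j ⊛ F ↑ i)) H (others G a) n ≼-refl case
          where
          shuffle : ∀ W A B X Y → (W ⊛ ((A ⊛ X) ⊛ Y)) ⊛ B ≈ (W ⊛ A ⊛ B) ⊛ (X ⊛ Y)
          shuffle W A B X Y = prove 5 ((var 0F :∙ ((var 1F :∙ var 3F) :∙ var 4F)) :∙ var 2F)
            (((var 0F :∙ var 1F) :∙ var 2F) :∙ (var 3F :∙ var 4F)) (W ∷ A ∷ B ∷ X ∷ Y ∷ [])
          case : ∀ b → b < n → E ((W ⊛ (G a ↑ suc j ⊛ F ↑ i)) ⊛ others G a b) ≤ β'
          case b b<n with a ≟ b
          ... | yes _   = ≤-trans (≤-reflexive (trans (E-cong (𝕄.zeroʳ (W ⊛ (G a ↑ suc j ⊛ F ↑ i)))) (⟨⟩-[]ˡ []))) z≤n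
          ... | no  a≢b = ≤-trans (≤-reflexive (E-cong (shuffle W (G a) (G b) (G a ↑ j) (F ↑ i))))
            (mixed a b j i (suc-injective (trans (sym (+-suc j i)) j+1+i≡1+N)) a<n b<n a≢b)
        numeric : 2 * y + 2 * (n * n) ≤ 4 * (n * n) * y
        numeric = begin
          2 * y + 2 * (n * n)                     ≤⟨ +-mono-≤ (*-monoʳ-≤ 2 (m≤n*m y (n * n) {{m*n≢0 n n {{>-nonZero 1≤n}} {{>-nonZero 1≤n}}}})) (*-monoʳ-≤ 2 (m≤m*n (n * n) y {{m^n≢0 _ i {{m*n≢0 4 (n * n) {{_}} {{m*n≢0 n n {{>-nonZero 1≤n}} {{>-nonZero 1≤n}}}}}}}})) ⟩
          2 * (n * n * y) + 2 * (n * n * y)       ≡⟨ l' (n * n) y ⟩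
          4 * (n * n) * y                         ∎
          where
          l' : ∀ a b → 2 * (a * b) + 2 * (a * b) ≡ 4 * a * b
          l' = solve-∀
        l : ∀ t V y b m → 2 * (t * V + y * b) + 2 * (m * b) ≡ 2 * t * V + (2 * y + 2 * m) * b
        l = solve-∀

    -- Opening the first factor selects a class `a`; `narrow-step` then separates the terms that
    -- stay in this class from those that meet a second one.
    broad-narrow : E (W ⊛ F ↑ suc (suc N)) ≤ n * n * (2 ^ suc N * V + (4 * (n * n)) ^ suc N * ((n * n) ^ N * β))
    broad-narrow = ≤-trans (≤-reflexive (E-cong (𝕄.trans (⊛-congˡ W (𝕄.*-comm F (F ↑ suc N))) (𝕄.sym (𝕄.*-assoc W (F ↑ suc N) F)))))
      (E-⊛-⨁ (W ⊛ F ↑ suc N) F G n F≼⨁G λ a a<n →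
        ≤-trans (≤-reflexive (E-cong (shuffle W (F ↑ suc N) (G a)))) (narrow-step a 0 (suc N) refl a<n))
      where
      shuffle : ∀ W X A → (W ⊛ X) ⊛ A ≈ W ⊛ (A ↑ 1 ⊛ X)
      shuffle W X A = prove 3 ((var 0F :∙ var 1F) :∙ var 2F) (var 0F :∙ ((var 2F :∙ :1) :∙ var 1F)) (W ∷ X ∷ A ∷ [])

-- Binomial transforms and systems of consecutive congruences.

module Binomials where

  open import Data.Integer hiding (suc)
  open import Data.Integer.Properties hiding (_≟_)
  open import Data.Integer.Divisibility.Signed
  open import Data.Integer.Tactic.RingSolver using (solve-∀)
  open import Data.Nat as ℕ using (ℕ; zero; suc; z≤n; s≤s; _!)
  import Data.Nat.DivMod as ℕ
  import Data.Nat.Divisibility as ℕ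
  import Data.Nat.Properties as ℕ
  open import Relation.Binary.PropositionalEquality
  open import Relation.Nullary using (yes; no)

  -- The binomial transform ∑ᵢ C(j,i) τ^(j-i) cᵢ.
  ev : ℤ → (ℕ → ℤ) → ℕ → ℤ
  ev τ c zero    = c 0
  ev τ c (suc j) = τ * ev τ c j + ev τ (λ i → c (suc i)) j

  ev-cong : ∀ τ {c d} → (∀ i → c i ≡ d i) → ∀ j → ev τ c j ≡ ev τ d j
  ev-cong τ c≡d zero    = c≡d 0
  ev-cong τ c≡d (suc j) = cong₂ (λ u v → τ * u + v) (ev-cong τ c≡d j) (ev-cong τ (λ i → c≡d (suc i)) j)

  ev-+ : ∀ τ c d j → ev τ (λ i → c i + d i) j ≡ ev τ c j + ev τ d j
  ev-+ τ c d zero    = refl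
  ev-+ τ c d (suc j) rewrite ev-+ τ c d j | ev-+ τ (λ i → c (suc i)) (λ i → d (suc i)) j = l τ _ _ _ _
    where
    l : ∀ τ a b c d → τ * (a + b) + (c + d) ≡ τ * a + c + (τ * b + d)
    l = solve-∀

  ev-* : ∀ τ a c j → ev τ (λ i → a * c i) j ≡ a * ev τ c j
  ev-* τ a c zero    = refl
  ev-* τ a c (suc j) rewrite ev-* τ a c j | ev-* τ a (λ i → c (suc i)) j = l τ a _ _
    where
    l : ∀ τ a x y → τ * (a * x) + a * y ≡ a * (τ * x + y)
    l = solve-∀

  ev-power : ∀ τ v w j → ev τ (λ i → v ^ i * w) j ≡ (τ + v) ^ j * w
  ev-power τ v w zero    = refl
  ev-power τ v w (suc j) = begin
    τ * ev τ (λ i → v ^ i * w) j + ev τ (λ i → v ^ suc i * w) j   ≡⟨ cong₂ (λ x y → τ * x + y) (ev-power τ v w j) (trans (ev-cong τ (λ i → l₁ v (v ^ i) w) j) (ev-power τ v (v * w) j)) ⟩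
    τ * ((τ + v) ^ j * w) + (τ + v) ^ j * (v * w)                 ≡⟨ l₂ τ v ((τ + v) ^ j) w ⟩
    (τ + v) ^ suc j * w                                           ∎
    where
    open ≡-Reasoning
    l₁ : ∀ v x w → v * x * w ≡ x * (v * w)
    l₁ = solve-∀
    l₂ : ∀ τ v x w → τ * (x * w) + x * (v * w) ≡ (τ + v) * x * w
    l₂ = solve-∀

  ev-∣ : ∀ {q} τ {c} → (∀ i → q ∣ c i) → ∀ j → q ∣ ev τ c j
  ev-∣ τ q∣c zero    = q∣c 0
  ev-∣ τ q∣c (suc j) = ∣m∣n⇒∣m+n (∣n⇒∣m*n τ (ev-∣ τ q∣c j)) (ev-∣ τ (λ i → q∣c (suc i)) j)

  -- Homogeneity: the j-th value has weight j when `τ` has weight 1 and `c i` has weight i.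
  ev-scale : ∀ π τ c j → ev (π * τ) (λ i → π ^ i * c i) j ≡ π ^ j * ev τ c j
  ev-scale π τ c zero    = refl
  ev-scale π τ c (suc j) = begin
    π * τ * ev (π * τ) (λ i → π ^ i * c i) j + ev (π * τ) (λ i → π ^ suc i * c (suc i)) j
      ≡⟨ cong₂ (λ x y → π * τ * x + y) (ev-scale π τ c j) shifted ⟩
    π * τ * (π ^ j * ev τ c j) + π * (π ^ j * ev τ (λ i → c (suc i)) j)
      ≡⟨ l π τ (π ^ j) _ _ ⟩
    π ^ suc j * ev τ c (suc j) ∎
    where
    open ≡-Reasoning
    shifted : ev (π * τ) (λ i → π ^ suc i * c (suc i)) j ≡ π * (π ^ j * ev τ (λ i → c (suc i)) j)
    shifted = trans (ev-cong (π * τ) (λ i → *-assoc π (π ^ i) (c (suc i))) j)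
      (trans (ev-* (π * τ) π (λ i → π ^ i * c (suc i)) j) (cong (π *_) (ev-scale π τ (λ i → c (suc i)) j)))
    l : ∀ π τ x u v → π * τ * (x * u) + π * (x * v) ≡ π * x * (τ * u + v)
    l = solve-∀

  shift* : (ℕ → ℤ) → ℕ → ℤ
  shift* e zero    = 0ℤ
  shift* e (suc i) = + suc i * e i

  -- In terms of binomial coefficients: i C(j,i) = j C(j-1,i-1).
  ev-shift* : ∀ τ e j → ev τ (shift* e) (suc j) ≡ + suc j * ev τ e j
  ev-shift* τ e j = begin
    τ * ev τ (shift* e) j + ev τ (λ i → + suc i * e i) j              ≡⟨ cong (λ u → τ * ev τ (shift* e) j + u) (ev-cong τ split j) ⟩
    τ * ev τ (shift* e) j + ev τ (λ i → e i + shift* e' i) j          ≡⟨ cong (λ u → τ * ev τ (shift* e) j + u) (ev-+ τ e (shift* e') j) ⟩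
    τ * ev τ (shift* e) j + (ev τ e j + ev τ (shift* e') j)           ≡⟨ rest j ⟩
    + suc j * ev τ e j                                                ∎
    where
    open ≡-Reasoning
    e' : ℕ → ℤ
    e' i = e (suc i)
    split : ∀ i → + suc i * e i ≡ e i + shift* e' i
    split zero    = trans (*-identityˡ (e 0)) (sym (+-identityʳ (e 0)))
    split (suc i) = l (+ suc i) (e (suc i))
      where
      l : ∀ a b → (1ℤ + a) * b ≡ b + a * b
      l = solve-∀
    rest : ∀ j → τ * ev τ (shift* e) j + (ev τ e j + ev τ (shift* e') j) ≡ + suc j * ev τ e j
    rest zero    = l τ (e 0)
      where
      l : ∀ a b → a * 0ℤ + (b + 0ℤ) ≡ 1ℤ * b
      l = solve-∀
    rest (suc j) = trans (cong₂ (λ u v → τ * u + (ev τ e (suc j) + v)) (ev-shift* τ e j) (ev-shift* τ e' j))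
      (l τ (+ suc j) (ev τ e j) (ev τ e' j))
      where
      l : ∀ τ a x y → τ * (a * x) + ((τ * x + y) + a * y) ≡ (1ℤ + a) * (τ * x + y)
      l = solve-∀

  -- Invertibility of `u` modulo `q`, as a cancellation law, so that no inverse has to be chosen.
  Cancellable : ℤ → ℤ → Set
  Cancellable q u = ∀ {z} → q ∣ u * z → q ∣ z

  module _ {q τ : ℤ} (τ-unit : Cancellable q τ) where

    -- Modulo `q` the only surviving term of the transform is τ^j times `c 0`.
    ev-∣-head : ∀ {c} → (∀ i → q ∣ c (suc i)) → ∀ j → q ∣ ev τ c j → q ∣ c 0
    ev-∣-head q∣c zero    q∣ = q∣
    ev-∣-head q∣c (suc j) q∣ = ev-∣-head q∣c j (τ-unit (∣m+n∣n⇒∣m q∣ (ev-∣ τ q∣c j)))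

    -- A polynomial of degree < n is determined by n consecutive values.
    consecutive-zeros : ∀ n j₀ {c} → (∀ i → n ℕ.≤ i → q ∣ c i) →
                        (∀ j → j ℕ.< n → q ∣ ev τ c (j₀ ℕ.+ j)) → ∀ i → q ∣ c i
    consecutive-zeros zero    j₀ high zeros i = high i z≤n
    consecutive-zeros (suc n) j₀ {c} high zeros = λ { zero → head ; (suc i) → tail i }
      where
      -- The value at j + 1 minus `τ` times the value at j is the transform of the shifted sequence,
      -- whose degree is one lower and which has one zero fewer.
      tail : ∀ i → q ∣ c (suc i)
      tail = consecutive-zeros n j₀ (λ i n≤i → high (suc i) (s≤s n≤i)) λ j j<n →
        ∣m+n∣m⇒∣n (subst (λ u → q ∣ ev τ c u) (ℕ.+-suc j₀ j) (zeros (suc j) (s≤s j<n)))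
          (∣n⇒∣m*n τ (zeros j (ℕ.m<n⇒m<1+n j<n)))
      head : q ∣ c 0
      head = ev-∣-head tail (j₀ ℕ.+ 0) (zeros 0 (s≤s z≤n))

    -- Without the constant term, l consecutive values suffice for degree l: divide by j.
    nondegeneracy : ∀ l m {c} → (∀ i → 1 ℕ.≤ i → i ℕ.≤ m ℕ.+ l → Cancellable q (+ i)) →
                    q ∣ c 0 → (∀ i → l ℕ.< i → q ∣ c i) →
                    (∀ j → j ℕ.< l → q ∣ ev τ c (suc m ℕ.+ j)) → ∀ i → i ℕ.≤ l → q ∣ c i
    nondegeneracy l m {c} units q∣c₀ high zeros zero    i≤l = q∣c₀
    nondegeneracy l m {c} units q∣c₀ high zeros (suc i) 1+i≤l = factorial-unit l ℕ.≤-refl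
      (subst (q ∣_) (sym (shift-e i 1+i≤l)) (∣n⇒∣m*n (+ suc i)
        (consecutive-zeros l m (λ i l≤i → ∣n⇒∣m*n (cof i) (high (suc i) (s≤s l≤i))) vanish i)))
      where
      cof d : ℕ → ℤ
      -- The factor l! makes the division by i + 1 exact for i < l: `d i` stands for l!
      -- c(i+1)/(i+1).
      cof i = + ((l !) ℕ./ suc i)
      d i = cof i * c (suc i)
      ∣! : ∀ {i} → suc i ℕ.≤ l → suc i ℕ.∣ l !
      ∣! {i} 1+i≤l = ℕ.∣-trans (ℕ.m∣m*n (i !)) (ℕ.m≤n⇒m!∣n! 1+i≤l)
      shift-e : ∀ i → suc i ℕ.≤ l → + (l !) * c (suc i) ≡ + suc i * d i
      shift-e i 1+i≤l = begin
        + (l !) * c (suc i)                                      ≡⟨ cong (λ u → + u * c (suc i)) (ℕ.m*[n/m]≡n (∣! 1+i≤l)) ⟨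
        + (suc i ℕ.* ((l !) ℕ./ suc i)) * c (suc i)              ≡⟨ cong (_* c (suc i)) (pos-* (suc i) ((l !) ℕ./ suc i)) ⟩
        + suc i * + ((l !) ℕ./ suc i) * c (suc i)                ≡⟨ *-assoc (+ suc i) (cof i) (c (suc i)) ⟩
        + suc i * d i                                            ∎
        where open ≡-Reasoning
      factorial-unit : ∀ n → n ℕ.≤ l → Cancellable q (+ (n !))
      factorial-unit zero    _   {z} q∣ = subst (q ∣_) (*-identityˡ z) q∣
      factorial-unit (suc n) n<l {z} q∣ = factorial-unit n (ℕ.≤-trans (ℕ.n≤1+n n) n<l)
        (units (suc n) (s≤s z≤n) (ℕ.≤-trans n<l (ℕ.m≤n+m l m))
          (subst (q ∣_) (trans (cong (_* z) (pos-* (suc n) (n !))) (*-assoc (+ suc n) (+ (n !)) z)) q∣))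
      -- The two sequences agree exactly for 1 ≤ i ≤ l. Outside this range both vanish modulo `q`,
      -- by the hypotheses on `c 0` and on the coefficients beyond l.
      difference : ∀ i → q ∣ shift* d i - + (l !) * c i
      difference zero    = ∣m∣n⇒∣m-n (subst (q ∣_) (*-zeroˡ q) (∣n⇒∣m*n 0ℤ ∣-refl)) (∣n⇒∣m*n (+ (l !)) q∣c₀)
      difference (suc i) with suc i ℕ.≤? l
      ... | yes 1+i≤l = subst (q ∣_) (sym (trans (cong (_- + (l !) * c (suc i)) (sym (shift-e i 1+i≤l))) (+-inverseʳ (+ (l !) * c (suc i)))))
                          (subst (q ∣_) (*-zeroˡ q) (∣n⇒∣m*n 0ℤ ∣-refl))
      ... | no  1+i≰l = ∣m∣n⇒∣m-n (∣n⇒∣m*n (+ suc i) (∣n⇒∣m*n (cof i) q∣)) (∣n⇒∣m*n (+ (l !)) q∣)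
        where q∣ = high (suc i) (ℕ.≰⇒> 1+i≰l)
      -- The factor that `ev-shift*` brings out is the exponent itself, a unit for every exponent of
      -- the window.
      vanish : ∀ j → j ℕ.< l → q ∣ ev τ d (m ℕ.+ j)
      vanish j j<l = units (suc (m ℕ.+ j)) (s≤s z≤n) (ℕ.+-monoʳ-< m j<l)
        (subst (q ∣_) total
          (∣m∣n⇒∣m+n (ev-∣ τ difference (suc (m ℕ.+ j))) (∣n⇒∣m*n (+ (l !)) (zeros j j<l))))
        where
        total : ev τ (λ i → shift* d i - + (l !) * c i) (suc (m ℕ.+ j)) + + (l !) * ev τ c (suc (m ℕ.+ j)) ≡
                + suc (m ℕ.+ j) * ev τ d (m ℕ.+ j)
        total = begin
          ev τ (λ i → shift* d i - + (l !) * c i) j⁺ + + (l !) * ev τ c j⁺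
            ≡⟨ cong (λ u → ev τ (λ i → shift* d i - + (l !) * c i) j⁺ + u) (ev-* τ (+ (l !)) c j⁺) ⟨
          ev τ (λ i → shift* d i - + (l !) * c i) j⁺ + ev τ (λ i → + (l !) * c i) j⁺
            ≡⟨ ev-+ τ (λ i → shift* d i - + (l !) * c i) (λ i → + (l !) * c i) j⁺ ⟨
          ev τ (λ i → shift* d i - + (l !) * c i + + (l !) * c i) j⁺
            ≡⟨ ev-cong τ (λ i → x-y+y (shift* d i) (+ (l !) * c i)) j⁺ ⟩
          ev τ (shift* d) j⁺
            ≡⟨ ev-shift* τ d (m ℕ.+ j) ⟩
          + j⁺ * ev τ d (m ℕ.+ j) ∎
          where
          open ≡-Reasoning
          j⁺ = suc (m ℕ.+ j)
          x-y+y : ∀ x y → x - y + y ≡ x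
          x-y+y = solve-∀

-- Power sums and residue classes modulo powers of a prime.

module PowerSums (p : ℕ) (p-prime : Prime p) where

  open Binomials
  open import Data.Integer hiding (suc)
  open import Data.Integer.Properties hiding (_≟_)
  open import Data.Integer.Divisibility.Signed
  open import Data.Integer.Tactic.RingSolver using (solve-∀)
  open import Data.List using (List; []; _∷_; length; _++_)
  open import Data.List.Relation.Unary.All using (All; []; _∷_)
  open import Data.Nat using (zero; suc)
  import Data.Nat.Divisibility as ℕ
  import Data.Nat.Properties as ℕ
  import Data.Nat.Tactic.RingSolver as ℕ
  open import Data.Nat.Primality using (euclidsLemma; prime⇒nonZero)
  open import Data.Product using (_,_)
  open import Data.Sum using (inj₁; inj₂)
  open import Relation.Binary.PropositionalEquality
  open import Relation.Nullary using (contradiction; ¬_)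

  instance
    p-nonZero : ℕ.NonZero p
    p-nonZero = prime⇒nonZero p-prime

  opaque
    P : ℕ → ℤ
    P n = (+ p) ^ n

    P-0 : P 0 ≡ 1ℤ
    P-0 = refl

    P-suc : ∀ n → P (suc n) ≡ + p * P n
    P-suc n = refl

    P-nonZero : ∀ n → NonZero (P n)
    P-nonZero zero    = _
    P-nonZero (suc n) = i*j≢0 (+ p) (P n) {{p-nonZero}} {{P-nonZero n}}

    P-+ : ∀ m n → P (m ℕ.+ n) ≡ P m * P n
    P-+ = ^-distribˡ-+-* (+ p)

    P-* : ∀ m n → P m ^ n ≡ P (m ℕ.* n)
    P-* = ^-*-assoc (+ p)

    ∣P∣ : ∀ n → ∣ P n ∣ ≡ p ℕ.^ n
    ∣P∣ zero    = refl
    ∣P∣ (suc n) = trans (abs-* (+ p) (P n)) (cong (p ℕ.*_) (∣P∣ n))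

  P-pos : ∀ n → P n ≡ + (p ℕ.^ n)
  P-pos zero    = P-0
  P-pos (suc n) = trans (P-suc n) (trans (cong (+ p *_) (P-pos n)) (sym (pos-* p (p ℕ.^ n))))

  P-mono : ∀ {m n} → m ℕ.≤ n → P m ∣ P n
  P-mono {m} m≤n with o , refl ← ℕ.m≤n⇒∃[o]m+o≡n m≤n = subst (P m ∣_) (sym (P-+ m o)) (∣m⇒∣m*n (P o) ∣-refl)

  P-∣-weaken : ∀ {m n z} → m ℕ.≤ n → P n ∣ z → P m ∣ z
  P-∣-weaken m≤n = ∣-trans (P-mono m≤n)

  P-∣-* : ∀ m n {y z} → P m ∣ y → P n ∣ z → P (m ℕ.+ n) ∣ y * z
  P-∣-* m n {y} {z} Pm∣y Pn∣z = subst (_∣ y * z) (sym (P-+ m n))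
    (∣-trans (*-monoˡ-∣ (P n) Pm∣y) (*-monoʳ-∣ y Pn∣z))

  P-∣-^ : ∀ n j {z} → P n ∣ z → P (n ℕ.* j) ∣ z ^ j
  P-∣-^ n zero    {z} _ = subst (_∣ 1ℤ) (sym (trans (cong P (ℕ.*-zeroʳ n)) P-0)) ∣-refl
  P-∣-^ n (suc j) {z} Pn∣z = subst (λ u → P u ∣ z * z ^ j) (sym (ℕ.*-suc n j)) (P-∣-* n (n ℕ.* j) Pn∣z (P-∣-^ n j Pn∣z))

  P-∣-cancelˡ : ∀ m n {z} → P (m ℕ.+ n) ∣ P m * z → P n ∣ z
  P-∣-cancelˡ m n {z} ∣mz = *-cancelˡ-∣ (P m) {{P-nonZero m}} (subst (_∣ P m * z) (P-+ m n) ∣mz)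

  -- Euclid's lemma, applied to one factor p at a time.
  P-cancellable : ∀ n {u} → ¬ (+ p ∣ u) → Cancellable (P n) u
  P-cancellable zero    p∤u {z} _ = subst₂ _∣_ (sym P-0) (*-identityˡ z) (∣m⇒∣m*n z ∣-refl)
  P-cancellable (suc n) {u} p∤u {z} P∣uz rewrite P-suc n with euclidsLemma ∣ u ∣ ∣ z ∣ p-prime
        (subst (p ℕ.∣_) (abs-* u z) (∣⇒∣ᵤ (∣-trans (∣m⇒∣m*n {+ p} (P n) ∣-refl) P∣uz)))
  ... | inj₁ p∣u = contradiction (∣ᵤ⇒∣ p∣u) p∤u
  ... | inj₂ p∣z with divides z' z≡ ← ∣ᵤ⇒∣ {+ p} {z} p∣z =
    subst (+ p * P n ∣_) (sym (trans z≡ (*-comm z' (+ p)))) (*-monoʳ-∣ (+ p)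
      (P-cancellable n p∤u (*-cancelˡ-∣ (+ p) {{p-nonZero}}
        (subst (+ p * P n ∣_) (trans (cong (u *_) z≡) (l u z' (+ p))) P∣uz))))
    where
    l : ∀ u z q → u * (z * q) ≡ q * (u * z)
    l = solve-∀

  ∑^ : ℤ → List ℤ → ℕ → ℤ
  ∑^ c []       j = 0ℤ
  ∑^ c (x ∷ xs) j = (x - c) ^ j + ∑^ c xs j

  ∑^-∑^ : ℤ → List ℤ → List ℤ → ℕ → ℤ
  ∑^-∑^ c xs ys j = ∑^ c xs j - ∑^ c ys j

  ∑^-++ : ∀ c xs us j → ∑^ c (xs ++ us) j ≡ ∑^ c xs j + ∑^ c us j
  ∑^-++ c []       us j = sym (+-identityˡ _)
  ∑^-++ c (x ∷ xs) us j = trans (cong (λ u → (x - c) ^ j + u) (∑^-++ c xs us j)) (sym (+-assoc ((x - c) ^ j) _ _))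

  ∑^-∑^-++ : ∀ c xs us ys vs j → ∑^-∑^ c (xs ++ us) (ys ++ vs) j ≡ ∑^-∑^ c xs ys j + ∑^-∑^ c us vs j
  ∑^-∑^-++ c xs us ys vs j = trans (cong₂ _-_ (∑^-++ c xs us j) (∑^-++ c ys vs j))
    (l (∑^ c xs j) (∑^ c us j) (∑^ c ys j) (∑^ c vs j))
    where
    l : ∀ a b c d → a + b - (c + d) ≡ a - c + (b - d)
    l = solve-∀

  -- The binomial theorem for x - η = (ξ - η) + (x - ξ), summed over the list.
  ∑^-ev : ∀ ξ η xs j → ∑^ η xs j ≡ ev (ξ - η) (∑^ ξ xs) j
  ∑^-ev ξ η []       j = sym (ev-zero j)
    where
    ev-zero : ∀ j → ev (ξ - η) (λ _ → 0ℤ) j ≡ 0ℤ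
    ev-zero zero    = refl
    ev-zero (suc j) rewrite ev-zero j = trans (+-identityʳ _) (*-zeroʳ (ξ - η))
  ∑^-ev ξ η (x ∷ xs) j = begin
    (x - η) ^ j + ∑^ η xs j                                              ≡⟨ cong₂ _+_ power (∑^-ev ξ η xs j) ⟩
    ev (ξ - η) (λ i → (x - ξ) ^ i) j + ev (ξ - η) (∑^ ξ xs) j             ≡⟨ ev-+ (ξ - η) _ _ j ⟨
    ev (ξ - η) (∑^ ξ (x ∷ xs)) j                                         ∎
    where
    open ≡-Reasoning
    l : ∀ x ξ η → x - η ≡ ξ - η + (x - ξ)
    l = solve-∀
    power : (x - η) ^ j ≡ ev (ξ - η) (λ i → (x - ξ) ^ i) j
    power = begin
      (x - η) ^ j                                   ≡⟨ cong (_^ j) (l x ξ η) ⟩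
      (ξ - η + (x - ξ)) ^ j                         ≡⟨ *-identityʳ _ ⟨
      (ξ - η + (x - ξ)) ^ j * 1ℤ                    ≡⟨ ev-power (ξ - η) (x - ξ) 1ℤ j ⟨
      ev (ξ - η) (λ i → (x - ξ) ^ i * 1ℤ) j         ≡⟨ ev-cong (ξ - η) (λ i → *-identityʳ _) j ⟩
      ev (ξ - η) (λ i → (x - ξ) ^ i) j              ∎

  ∑^-∑^-ev : ∀ ξ η xs ys j → ∑^-∑^ η xs ys j ≡ ev (ξ - η) (∑^-∑^ ξ xs ys) j
  ∑^-∑^-ev ξ η xs ys j = begin
    ∑^ η xs j - ∑^ η ys j                                            ≡⟨ cong₂ _-_ (∑^-ev ξ η xs j) (∑^-ev ξ η ys j) ⟩
    ev τ (∑^ ξ xs) j - ev τ (∑^ ξ ys) j                              ≡⟨ cong (λ u → ev τ (∑^ ξ xs) j + u) (-1*i≡-i (ev τ (∑^ ξ ys) j)) ⟨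
    ev τ (∑^ ξ xs) j + -1ℤ * ev τ (∑^ ξ ys) j                        ≡⟨ cong (λ u → ev τ (∑^ ξ xs) j + u) (ev-* τ -1ℤ (∑^ ξ ys) j) ⟨
    ev τ (∑^ ξ xs) j + ev τ (λ i → -1ℤ * ∑^ ξ ys i) j                ≡⟨ ev-+ τ (∑^ ξ xs) _ j ⟨
    ev τ (λ i → ∑^ ξ xs i + -1ℤ * ∑^ ξ ys i) j                       ≡⟨ ev-cong τ (λ i → cong (λ u → ∑^ ξ xs i + u) (-1*i≡-i (∑^ ξ ys i))) j ⟩
    ev τ (∑^-∑^ ξ xs ys) j                                           ∎
    where
    open ≡-Reasoning
    τ = ξ - η

  module _ {k N c τ} {f : ℕ → ℤ} (P∣τ : P c ∣ τ) (P∣f : ∀ i → i ℕ.≤ k → P (N ℕ.+ c ℕ.* i) ∣ f i) where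

    -- Each factor `τ` brings p^c, the very weight that is missed where the index of `f` is not
    -- raised. The offset `i` is there for the induction.
    ev-weighted : ∀ j i → i ℕ.+ j ℕ.≤ k → P (N ℕ.+ c ℕ.* (i ℕ.+ j)) ∣ ev τ (λ i' → f (i ℕ.+ i')) j
    ev-weighted zero    i i+0≤k = P∣f (i ℕ.+ 0) i+0≤k
    ev-weighted (suc j) i i+1+j≤k = ∣m∣n⇒∣m+n
      (subst (λ u → P u ∣ τ * ev τ (λ i' → f (i ℕ.+ i')) j) (l N c i j)
        (P-∣-* c (N ℕ.+ c ℕ.* (i ℕ.+ j)) P∣τ (ev-weighted j i (ℕ.≤-trans (ℕ.+-monoʳ-≤ i (ℕ.n≤1+n j)) i+1+j≤k))))
      (subst₂ (λ u z → P (N ℕ.+ c ℕ.* u) ∣ z) (sym (ℕ.+-suc i j)) (ev-cong τ (λ i' → cong f (sym (ℕ.+-suc i i'))) j)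
        (ev-weighted j (suc i) (subst (ℕ._≤ k) (ℕ.+-suc i j) i+1+j≤k)))
      where
      l : ∀ N c i j → c ℕ.+ (N ℕ.+ c ℕ.* (i ℕ.+ j)) ≡ N ℕ.+ c ℕ.* (i ℕ.+ suc j)
      l = ℕ.solve-∀

  -- The weight `c ℕ.* j` expresses the coordinate (x - ξ)/p^c, in which power sums are compared
  -- modulo p^N.
  Congruent : (k N : ℕ) (ξ : ℤ) (c : ℕ) (xs ys : List ℤ) → Set
  Congruent k N ξ c xs ys = ∀ j → j ℕ.≤ k → P (N ℕ.+ c ℕ.* j) ∣ ∑^-∑^ ξ xs ys j

  -- In the rescaled coordinate a change of centre within the class is an integral translation, and
  -- it mixes each degree with lower ones only.
  recentre : ∀ {k N ξ η c xs ys} → P c ∣ ξ - η → Congruent k N ξ c xs ys → Congruent k N η c xs ys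
  recentre {k} {N} {ξ} {η} {c} {xs} {ys} P∣ξ-η cong-ξ j j≤k =
    subst (P (N ℕ.+ c ℕ.* j) ∣_) (sym (∑^-∑^-ev ξ η xs ys j)) (ev-weighted P∣ξ-η cong-ξ j 0 j≤k)

  -- Refining the coordinate by p^a divides the j-th power sum by p^(a j). The modulus shrinks
  -- accordingly, most of all in degree k.
  coarsen : ∀ {k N M ξ c a xs ys} → N ℕ.+ a ℕ.* k ℕ.≤ M → Congruent k M ξ c xs ys → Congruent k N ξ (c ℕ.+ a) xs ys
  coarsen {k} {N} {M} {ξ} {c} {a} N+ak≤M congruent j j≤k = P-∣-weaken (begin
      N ℕ.+ (c ℕ.+ a) ℕ.* j          ≡⟨ l N c a j ⟩
      (N ℕ.+ a ℕ.* j) ℕ.+ c ℕ.* j    ≤⟨ ℕ.+-monoˡ-≤ _ (ℕ.+-monoʳ-≤ N (ℕ.*-monoʳ-≤ a j≤k)) ⟩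
      (N ℕ.+ a ℕ.* k) ℕ.+ c ℕ.* j    ≤⟨ ℕ.+-monoˡ-≤ _ N+ak≤M ⟩
      M ℕ.+ c ℕ.* j                  ∎) (congruent j j≤k)
    where
    open ℕ.≤-Reasoning
    l : ∀ N c a j → N ℕ.+ (c ℕ.+ a) ℕ.* j ≡ (N ℕ.+ a ℕ.* j) ℕ.+ c ℕ.* j
    l = ℕ.solve-∀

  record Class (ξ : ℤ) (n : ℕ) (x : ℤ) : Set where
    constructor mkClass
    field ∣- : P n ∣ x - ξ

  open Class public

  P∣0 : ∀ n → P n ∣ 0ℤ
  P∣0 n = divides 0ℤ (sym (*-zeroˡ (P n)))

  ∑^-class : ∀ {η n xs} j → All (Class η n) xs → P (n ℕ.* j) ∣ ∑^ η xs j
  ∑^-class {n = n} j []             = P∣0 (n ℕ.* j)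
  ∑^-class {n = n} j (x∈ ∷ xs∈) = ∣m∣n⇒∣m+n (P-∣-^ n j (∣- x∈)) (∑^-class j xs∈)

  ∑^-∑^-class : ∀ {η n xs ys} j → All (Class η n) xs → All (Class η n) ys → P (n ℕ.* j) ∣ ∑^-∑^ η xs ys j
  ∑^-∑^-class j xs∈ ys∈ = ∣m∣n⇒∣m-n (∑^-class j xs∈) (∑^-class j ys∈)

  ∑^-0 : ∀ c xs → ∑^ c xs 0 ≡ + length xs
  ∑^-0 c []       = refl
  ∑^-0 c (x ∷ xs) = trans (cong (λ u → 1ℤ + u) (∑^-0 c xs)) refl

  ∑^-∑^-0 : ∀ c xs ys → length xs ≡ length ys → ∑^-∑^ c xs ys 0 ≡ 0ℤ
  ∑^-∑^-0 c xs ys eq = trans (cong₂ _-_ (∑^-0 c xs) (trans (∑^-0 c ys) (cong +_ (sym eq)))) (+-inverseʳ (+ length xs))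

  -- In the coordinate x − η the us, vs are divisible by p^b, so their powers of exponent > D vanish modulo
  -- p^((D+1)b); what remains is a nondegenerate system of l congruences for the xs, ys.
  descend : ∀ {l D c₀ c b N M ξ₀ ξ η τ xs ys us vs} →
    l ℕ.+ D ℕ.< p → Congruent (l ℕ.+ D) N ξ₀ c₀ (xs ++ us) (ys ++ vs) →
    P c₀ ∣ ξ₀ - η → ξ - η ≡ P c₀ * τ → ¬ (+ p ∣ τ) →
    All (Class ξ (c₀ ℕ.+ c)) xs → All (Class ξ (c₀ ℕ.+ c)) ys →
    All (Class η (c₀ ℕ.+ b)) us → All (Class η (c₀ ℕ.+ b)) vs →
    length xs ≡ length ys → suc D ℕ.* b ℕ.≤ N → M ℕ.≤ suc D ℕ.* b → M ℕ.≤ c ℕ.* suc l →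
    Congruent l M ξ c₀ xs ys
  descend {l} {D} {c₀} {c} {b} {N} {M} {ξ₀} {ξ} {η} {τ} {xs} {ys} {us} {vs}
          k<p total P∣ξ₀-η ξ-η≡ p∤τ xs∈ ys∈ us∈ vs∈ lengths [1+D]b≤N M≤[1+D]b M≤c[1+l] i i≤l =
    subst₂ _∣_ (trans (sym (P-+ (c₀ ℕ.* i) M)) (cong P (ℕ.+-comm (c₀ ℕ.* i) M))) (sym (d≡ i)) (*-monoʳ-∣ (P (c₀ ℕ.* i)) (ĉ∣ i i≤l))
    where
    d : ℕ → ℤ
    d = ∑^-∑^ ξ xs ys
    d∣ : ∀ i → P ((c₀ ℕ.+ c) ℕ.* i) ∣ d i
    d∣ i = ∑^-∑^-class i xs∈ ys∈
    -- The power sums in the coordinate (x - ξ)/p^c₀. They retain a factor p^(c i), which makes all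
    -- degrees above `l` vanish because M ≤ c (l + 1).
    ĉ : ℕ → ℤ
    ĉ i = P (c ℕ.* i) * quotient (d∣ i)
    d≡ : ∀ i → d i ≡ P (c₀ ℕ.* i) * ĉ i
    d≡ i = begin
      d i                                               ≡⟨ _∣_.equality (d∣ i) ⟩
      quotient (d∣ i) * P ((c₀ ℕ.+ c) ℕ.* i)            ≡⟨ *-comm (quotient (d∣ i)) (P ((c₀ ℕ.+ c) ℕ.* i)) ⟩
      P ((c₀ ℕ.+ c) ℕ.* i) * quotient (d∣ i)            ≡⟨ cong (_* quotient (d∣ i)) (trans (cong P (ℕ.*-distribʳ-+ i c₀ c)) (P-+ (c₀ ℕ.* i) (c ℕ.* i))) ⟩
      P (c₀ ℕ.* i) * P (c ℕ.* i) * quotient (d∣ i)      ≡⟨ *-assoc (P (c₀ ℕ.* i)) (P (c ℕ.* i)) (quotient (d∣ i)) ⟩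
      P (c₀ ℕ.* i) * ĉ i                                ∎
      where open ≡-Reasoning
    d-η : ∀ j → ∑^-∑^ η xs ys j ≡ P (c₀ ℕ.* j) * ev τ ĉ j
    d-η j = begin
      ∑^-∑^ η xs ys j                                   ≡⟨ ∑^-∑^-ev ξ η xs ys j ⟩
      ev (ξ - η) d j                                    ≡⟨ cong (λ u → ev u d j) ξ-η≡ ⟩
      ev (P c₀ * τ) d j                                 ≡⟨ ev-cong (P c₀ * τ) (λ i → trans (d≡ i) (cong (_* ĉ i) (sym (P-* c₀ i)))) j ⟩
      ev (P c₀ * τ) (λ i → P c₀ ^ i * ĉ i) j            ≡⟨ ev-scale (P c₀) τ ĉ j ⟩
      P c₀ ^ j * ev τ ĉ j                               ≡⟨ cong (_* ev τ ĉ j) (P-* c₀ j) ⟩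
      P (c₀ ℕ.* j) * ev τ ĉ j                           ∎
      where open ≡-Reasoning
    P∣ev : ∀ j → suc D ℕ.≤ j → j ℕ.≤ l ℕ.+ D → P M ∣ ev τ ĉ j
    P∣ev j D<j j≤k = P-∣-cancelˡ (c₀ ℕ.* j) M (subst (P (c₀ ℕ.* j ℕ.+ M) ∣_) (d-η j)
      (∣m+n∣n⇒∣m (subst (P (c₀ ℕ.* j ℕ.+ M) ∣_) (∑^-∑^-++ η xs us ys vs j) all) tail))
      where
      all : P (c₀ ℕ.* j ℕ.+ M) ∣ ∑^-∑^ η (xs ++ us) (ys ++ vs) j
      all = P-∣-weaken (ℕ.≤-trans (ℕ.≤-reflexive (ℕ.+-comm (c₀ ℕ.* j) M)) (ℕ.+-monoˡ-≤ (c₀ ℕ.* j) (ℕ.≤-trans M≤[1+D]b [1+D]b≤N)))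
        (recentre {l ℕ.+ D} {N} {ξ₀} {η} {c₀} {xs ++ us} {ys ++ vs} P∣ξ₀-η total j j≤k)
      tail : P (c₀ ℕ.* j ℕ.+ M) ∣ ∑^-∑^ η us vs j
      tail = P-∣-weaken (ℕ.≤-trans (ℕ.+-monoʳ-≤ (c₀ ℕ.* j) (ℕ.≤-trans M≤[1+D]b (ℕ.≤-trans (ℕ.*-monoˡ-≤ b D<j) (ℕ.≤-reflexive (ℕ.*-comm j b)))))
          (ℕ.≤-reflexive (sym (ℕ.*-distribʳ-+ j c₀ b))))
        (∑^-∑^-class {n = c₀ ℕ.+ b} j us∈ vs∈)
    units : ∀ i → 1 ℕ.≤ i → i ℕ.≤ D ℕ.+ l → Cancellable (P M) (+ i)
    units (suc i) _ i≤ {z} = P-cancellable M {+ suc i} (λ p∣i →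
      ℕ.<⇒≱ (ℕ.≤-<-trans (ℕ.≤-trans i≤ (ℕ.≤-reflexive (ℕ.+-comm D l))) k<p) (ℕ.∣⇒≤ (∣⇒∣ᵤ p∣i))) {z}
    ĉ∣ : ∀ i → i ℕ.≤ l → P M ∣ ĉ i
    ĉ∣ = nondegeneracy {τ = τ} (λ {z} → P-cancellable M p∤τ {z}) l D units
      (subst (P M ∣_) (trans (sym (∑^-∑^-0 ξ xs ys lengths)) (trans (d≡ 0) (trans (cong (_* ĉ 0) (trans (cong P (ℕ.*-zeroʳ c₀)) P-0)) (*-identityˡ (ĉ 0))))) (P∣0 M))
      (λ i l<i → ∣m⇒∣m*n (quotient (d∣ i)) (P-mono (ℕ.≤-trans M≤c[1+l] (ℕ.*-monoʳ-≤ c l<i))))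
      (λ j j<l → P∣ev (suc D ℕ.+ j) (ℕ.m≤m+n (suc D) j) (ℕ.≤-trans (ℕ.≤-reflexive (sym (ℕ.+-suc D j))) (ℕ.≤-trans (ℕ.+-monoʳ-≤ D j<l) (ℕ.≤-reflexive (ℕ.+-comm D l)))))

-- Exponential sums over residue classes and the decoupling inequality.

module Decoupling
  (p : ℕ) (p-prime : Prime p)
  {Γ : Set} (_≟Γ_ : DecidableEquality Γ) {_∙_ : Γ → Γ → Γ} {ε : Γ} {_⁻¹ : Γ → Γ}
  (isAbelianGroup : IsAbelianGroup _≡_ _∙_ ε _⁻¹)
  (γ : ℤ → Γ) (Ω : List ℤ)
  where

  open Naturals
  open Sums
  open Measures _≟Γ_ isAbelianGroup
  open PowerSums p p-prime
  open import Data.Fin.Patterns using (0F; 1F; 2F; 3F; 4F)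
  open import Data.Integer as ℤ using (+_; ∣_∣; 0ℤ; 1ℤ)
  import Data.Integer.Properties as ℤ
  import Data.Integer.DivMod as ℤ
  open import Data.Integer.Divisibility.Signed as ℤ using (_∣_; _∣?_; divides; quotient)
  import Data.Integer.Tactic.RingSolver as ℤ
  open import Data.List using ([]; _∷_; length; filter; map; _++_)
  open import Data.List.Membership.Propositional using (_∈_)
  open import Data.List.Membership.Propositional.Properties using (∈-map⁻; ∈-filter⁻; ∈-cartesianProductWith⁻)
  import Data.List.Properties as List
  open import Data.List.Relation.Unary.All using (All; []; _∷_)
  open import Data.List.Relation.Unary.All.Properties using (++⁺)
  open import Data.List.Relation.Unary.Any using (here)
  open import Data.Nat.DivMod using (_/_; _%_; m≡m%n+[m/n]*n; m%n<n; m/n*n≤m; m≥n⇒m/n>0)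
  import Data.Nat.Divisibility as ℕ
  open import Data.Product using (_,_; _×_; ∃-syntax; proj₂)
  open import Data.Sum using (_⊎_; inj₁; inj₂)
  open import Data.Vec using ([]; _∷_)
  open import Relation.Binary.Definitions using (tri<; tri≈; tri>)
  open import Relation.Binary.PropositionalEquality
  import Relation.Nullary as Nullary
  open import Relation.Nullary using (yes; no; contradiction; ¬_)
  private module G = IsAbelianGroup isAbelianGroup

  opaque
    class? : ∀ ξ n x → Nullary.Dec (Class ξ n x)
    class? ξ n x = Nullary.map′ mkClass ∣- (P n ∣? (x ℤ.- ξ))

  f : ℤ → ℕ → Measure
  f ξ n = map γ (filter (class? ξ n) Ω)

  ∈-f : ∀ {g ξ n} → g ∈ f ξ n → ∃[ x ] Class ξ n x × g ≡ γ x
  ∈-f {ξ = ξ} {n} g∈ with x , x∈ , g≡ ← ∈-map⁻ γ g∈ = x , proj₂ (∈-filter⁻ (class? ξ n) {xs = Ω} x∈) , g≡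

  p^-nonZero : ∀ n → NonZero (p ^ n)
  p^-nonZero n = m^n≢0 p n

  subclass : ℤ → ℕ → ℕ → ℤ
  subclass ξ n i = ξ ℤ.+ P n ℤ.* + i

  subclass-∈ : ∀ ξ n i → Class ξ n (subclass ξ n i)
  subclass-∈ ξ n i = mkClass (divides (+ i) (l ξ (P n) (+ i)))
    where
    l : ∀ ξ P i → ξ ℤ.+ P ℤ.* i ℤ.- ξ ≡ i ℤ.* P
    l = ℤ.solve-∀

  Class-trans : ∀ {ξ n ζ m x} → Class ξ n ζ → Class ζ (n + m) x → Class ξ n x
  Class-trans {ξ} {n} {ζ} {m} {x} ζ∈ x∈ = mkClass (subst (P n ∣_) (l x ζ ξ) (ℤ.∣m∣n⇒∣m+n (P-∣-weaken (m≤m+n n m) (∣- x∈)) (∣- ζ∈)))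
    where
    l : ∀ x ζ ξ → x ℤ.- ζ ℤ.+ (ζ ℤ.- ξ) ≡ x ℤ.- ξ
    l = ℤ.solve-∀

  Class-refl : ∀ ξ n → Class ξ n ξ
  Class-refl ξ n = mkClass (subst (P n ∣_) (sym (ℤ.+-inverseʳ ξ)) (P∣0 n))

  covering-index : ∀ {ξ n x} c → Class ξ n x → ∃[ i ] i < p ^ c × Class (subclass ξ n i) (n + c) x
  covering-index {ξ} {n} {x} c (mkClass (divides z x-ξ≡)) = i , ℤ.n%ℕd<d z (p ^ c) , mkClass (divides t (begin
    x ℤ.- (ξ ℤ.+ P n ℤ.* + i)                            ≡⟨ l₁ x ξ (P n) (+ i) ⟩
    x ℤ.- ξ ℤ.- P n ℤ.* + i                              ≡⟨ cong (ℤ._- P n ℤ.* + i) x-ξ≡ ⟩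
    z ℤ.* P n ℤ.- P n ℤ.* + i                            ≡⟨ cong (λ u → u ℤ.* P n ℤ.- P n ℤ.* + i) (ℤ.a≡a%ℕn+[a/ℕn]*n z (p ^ c)) ⟩
    (+ i ℤ.+ t ℤ.* + (p ^ c)) ℤ.* P n ℤ.- P n ℤ.* + i    ≡⟨ l₂ (+ i) t (+ (p ^ c)) (P n) ⟩
    t ℤ.* (P n ℤ.* + (p ^ c))                            ≡⟨ cong (t ℤ.*_) (trans (cong (P n ℤ.*_) (sym (P-pos c))) (sym (P-+ n c))) ⟩
    t ℤ.* P (n + c)                                      ∎))
    where
    open ≡-Reasoning
    instance
      _ : NonZero (p ^ c)
      _ = p^-nonZero c
    i = z ℤ.%ℕ (p ^ c)
    t = z ℤ./ℕ (p ^ c)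
    l₁ : ∀ x ξ P i → x ℤ.- (ξ ℤ.+ P ℤ.* i) ≡ x ℤ.- ξ ℤ.- P ℤ.* i
    l₁ = ℤ.solve-∀
    l₂ : ∀ i t q P → (i ℤ.+ t ℤ.* q) ℤ.* P ℤ.- P ℤ.* i ≡ t ℤ.* (P ℤ.* q)
    l₂ = ℤ.solve-∀

  private
    indicator : ℤ → ℕ → ℤ → ℕ
    indicator ξ n x with class? ξ n x
    ... | yes _ = 1
    ... | no  _ = 0

    indicator-yes : ∀ ξ n x → Class ξ n x → indicator ξ n x ≡ 1
    indicator-yes ξ n x x∈ with class? ξ n x
    ... | yes _ = refl
    ... | no x∉ = contradiction x∈ x∉

    ∑-f : ∀ ξ n φ → ∑ (f ξ n) φ ≡ ∑ Ω (λ x → indicator ξ n x * φ (γ x))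
    ∑-f ξ n φ = go Ω
      where
      go : ∀ Ω → ∑ (map γ (filter (class? ξ n) Ω)) φ ≡ ∑ Ω (λ x → indicator ξ n x * φ (γ x))
      go [] = refl
      go (x ∷ Ω) with class? ξ n x
      ... | yes _ = cong₂ _+_ (sym (+-identityʳ _)) (go Ω)
      ... | no  _ = go Ω

    multiplicity : ℤ → ℕ → ℕ → ℕ → ℤ → ℕ
    multiplicity ξ n c zero    x = 0
    multiplicity ξ n c (suc q) x = multiplicity ξ n c q x + indicator (subclass ξ n q) (n + c) x

    ∑-⨁-f : ∀ ξ n c q φ → ∑ (⨁ (λ i → f (subclass ξ n i) (n + c)) q) φ ≡ ∑ Ω (λ x → multiplicity ξ n c q x * φ (γ x))
    ∑-⨁-f ξ n c zero    φ = sym (∑-zero Ω λ _ → refl)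
    ∑-⨁-f ξ n c (suc q) φ = begin
      ∑ (F ⊕ f (subclass ξ n q) (n + c)) φ          ≡⟨ ∑-⊕ F _ φ ⟩
      ∑ F φ + ∑ (f (subclass ξ n q) (n + c)) φ      ≡⟨ cong₂ _+_ (∑-⨁-f ξ n c q φ) (∑-f (subclass ξ n q) (n + c) φ) ⟩
      ∑ Ω (λ x → multiplicity ξ n c q x * φ (γ x)) + ∑ Ω (λ x → indicator (subclass ξ n q) (n + c) x * φ (γ x))
                                                    ≡⟨ ∑-+ Ω _ _ ⟨
      ∑ Ω (λ x → multiplicity ξ n c q x * φ (γ x) + indicator (subclass ξ n q) (n + c) x * φ (γ x))
                                                    ≡⟨ ∑-cong Ω (λ x → *-distribʳ-+ (φ (γ x)) (multiplicity ξ n c q x) _) ⟨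
      ∑ Ω (λ x → multiplicity ξ n c (suc q) x * φ (γ x))   ∎
      where
      open ≡-Reasoning
      F = ⨁ (λ i → f (subclass ξ n i) (n + c)) q

    1≤multiplicity : ∀ ξ n c q {i} x → i < q → Class (subclass ξ n i) (n + c) x → 1 ≤ multiplicity ξ n c q x
    1≤multiplicity ξ n c (suc q) {i} x (s≤s i≤q) x∈ with m≤n⇒m<n∨m≡n i≤q
    ... | inj₁ i<q  = ≤-trans (1≤multiplicity ξ n c q x i<q x∈) (m≤m+n _ _)
    ... | inj₂ refl = ≤-trans (≤-reflexive (sym (indicator-yes (subclass ξ n i) (n + c) x x∈))) (m≤n+m _ _)

  f-covering : ∀ ξ n c → f ξ n ≼ ⨁ (λ i → f (subclass ξ n i) (n + c)) (p ^ c)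
  f-covering ξ n c = mk≼ λ φ → begin
    ∑ (f ξ n) φ                                                     ≡⟨ ∑-f ξ n φ ⟩
    ∑ Ω (λ x → indicator ξ n x * φ (γ x))                           ≤⟨ ∑-mono Ω (λ x → *-monoˡ-≤ (φ (γ x)) (below x)) ⟩
    ∑ Ω (λ x → multiplicity ξ n c (p ^ c) x * φ (γ x))              ≡⟨ ∑-⨁-f ξ n c (p ^ c) φ ⟨
    ∑ (⨁ (λ i → f (subclass ξ n i) (n + c)) (p ^ c)) φ              ∎
    where
    open ≤-Reasoning
    below : ∀ x → indicator ξ n x ≤ multiplicity ξ n c (p ^ c) x
    below x with class? ξ n x
    ... | no  _  = z≤n
    ... | yes x∈ = let i , i<q , x∈i = covering-index {ξ} {n} {x} c x∈ in 1≤multiplicity ξ n c (p ^ c) x i<q x∈i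

  f-mono : ∀ {ξ n ζ m} → (∀ x → Class ξ n x → Class ζ m x) → f ξ n ≼ f ζ m
  f-mono {ξ} {n} {ζ} {m} sub = mk≼ λ φ → begin
    ∑ (f ξ n) φ                              ≡⟨ ∑-f ξ n φ ⟩
    ∑ Ω (λ x → indicator ξ n x * φ (γ x))    ≤⟨ ∑-mono Ω (λ x → *-monoˡ-≤ (φ (γ x)) (below x)) ⟩
    ∑ Ω (λ x → indicator ζ m x * φ (γ x))    ≡⟨ ∑-f ζ m φ ⟨
    ∑ (f ζ m) φ                              ∎
    where
    open ≤-Reasoning
    below : ∀ x → indicator ξ n x ≤ indicator ζ m x
    below x with class? ξ n x
    ... | no  _  = z≤n
    ... | yes x∈ = ≤-reflexive (sym (indicator-yes ζ m x (sub x x∈)))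

  1≤p^ : ∀ n → 1 ≤ p ^ n
  1≤p^ n = 1≤⇒1≤^ (>-nonZero⁻¹ p) n

  -- The triangle inequality: the exponent 2 c r is twice that of square-root cancellation.
  trivial-decoupling : ∀ W ξ n c r → ∃[ ζ ] Class ξ n ζ ×
    E (W ⊛ f ξ n ↑ r) ≤ p ^ (2 * (c * r)) * E (W ⊛ f ζ (n + c) ↑ r)
  trivial-decoupling W ξ n c r
    with i , _ , max ← argmax (λ i → E (W ⊛ f (subclass ξ n i) (n + c) ↑ r)) (p ^ c) =
    subclass ξ n i , subclass-∈ ξ n i , (begin
      E (W ⊛ f ξ n ↑ r)                   ≤⟨ E-↑-⨁ W (f ξ n) (λ i → f (subclass ξ n i) (n + c)) (p ^ c) r (f-covering ξ n c) (λ j j<q → max j (<⇒≤ j<q)) (1≤p^ c) ⟩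
      (p ^ c * p ^ c) ^ r * Eᵢ            ≡⟨ cong (λ e → e ^ r * Eᵢ) (^-distribˡ-+-* p c c) ⟨
      (p ^ (c + c)) ^ r * Eᵢ              ≡⟨ cong (_* Eᵢ) (trans (^-*-assoc p (c + c) r) (cong (p ^_) (lemma c r))) ⟩
      p ^ (2 * (c * r)) * Eᵢ              ∎)
    where
    open ≤-Reasoning
    Eᵢ = E (W ⊛ f (subclass ξ n i) (n + c) ↑ r)
    lemma : ∀ c r → (c + c) * r ≡ 2 * (c * r)
    lemma = solve-∀

  ∑γ : List ℤ → Γ
  ∑γ []       = ε
  ∑γ (x ∷ xs) = γ x ∙ ∑γ xs

  ∑γ-++ : ∀ xs ys → ∑γ (xs ++ ys) ≡ ∑γ xs ∙ ∑γ ys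
  ∑γ-++ []       ys = sym (G.identityˡ (∑γ ys))
  ∑γ-++ (x ∷ xs) ys = trans (cong (γ x ∙_) (∑γ-++ xs ys)) (sym (G.assoc (γ x) (∑γ xs) (∑γ ys)))

  ∈-⊛⁻ : ∀ A B {g} → g ∈ A ⊛ B → ∃[ a ] ∃[ b ] a ∈ A × b ∈ B × g ≡ a ∙ b
  ∈-⊛⁻ A B g∈ with a , b , a∈ , b∈ , g≡ ← ∈-cartesianProductWith⁻ _∙_ A B g∈ = a , b , a∈ , b∈ , g≡

  ∈-f↑ : ∀ ξ n r {g} → g ∈ f ξ n ↑ r → ∃[ xs ] length xs ≡ r × All (Class ξ n) xs × g ≡ ∑γ xs
  ∈-f↑ ξ n zero    (here refl) = [] , refl , [] , refl
  ∈-f↑ ξ n (suc r) g∈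
    with a , b , a∈ , b∈ , g≡ ← ∈-⊛⁻ (f ξ n) (f ξ n ↑ r) g∈
    with x , x∈ , refl ← ∈-f {ξ = ξ} {n} a∈
    with xs , refl , xs∈ , refl ← ∈-f↑ ξ n r b∈ = x ∷ xs , refl , x∈ ∷ xs∈ , g≡

  -- The translates by W do not spoil the congruences of degree at most k for the variables in the class
  -- of ξ modulo p^c, in the coordinate (x − ξ)/p^c and modulo p^N.
  record Valid (k N : ℕ) (W : Measure) (ξ : ℤ) (c : ℕ) : Set where
    constructor mkValid
    field
      congruent : ∀ {w w'} xs ys → w ∈ W → w' ∈ W → length xs ≡ △ k → length ys ≡ △ k →
        All (Class ξ c) xs → All (Class ξ c) ys → ∑γ xs ∙ w ≡ ∑γ ys ∙ w' → Congruent k N ξ c xs ys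

  open Valid public

  Valid-subclass : ∀ {k N M W ξ c ζ a} → N + a * k ≤ M → Class ξ c ζ → Valid k M W ξ c → Valid k N W ζ (c + a)
  Valid-subclass {k} {N} {M} {W} {ξ} {c} {ζ} {a} N+ak≤M ζ∈ valid = mkValid λ xs ys w∈ w'∈ |xs| |ys| xs∈ ys∈ eq →
    coarsen {k} {N} {M} {ζ} {c} {a} {xs} {ys} N+ak≤M
      (recentre {k} {M} {ξ} {ζ} {c} {xs} {ys} (subst (P c ∣_) (l ζ ξ) (ℤ.∣m⇒∣-m (∣- ζ∈)))
        (congruent valid xs ys w∈ w'∈ |xs| |ys| (All-weaken xs∈) (All-weaken ys∈) eq))
    where
    l : ∀ ζ ξ → ℤ.- (ζ ℤ.- ξ) ≡ ξ ℤ.- ζ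
    l = ℤ.solve-∀
    All-weaken : ∀ {xs} → All (Class ζ (c + a)) xs → All (Class ξ c) xs
    All-weaken []         = []
    All-weaken (x∈ ∷ xs∈) = Class-trans {m = a} ζ∈ x∈ ∷ All-weaken xs∈

  -- Square-root cancellation among p^h subclasses would cost p^(h △(k)). `B` is the excess for q-th
  -- powers, so the decoupling constant is at most p^(B/q). The witness ζ plays the part of a
  -- maximum over subclasses, and the modulus p^(k h) is what h levels of `coarsen` consume.
  Dec : (k h q B : ℕ) → Set
  Dec k h q B = ∀ W ξ c → Valid k (k * h) W ξ c → ∃[ ζ ] Class ξ c ζ ×
    E (W ⊛ f ξ c ↑ △ k) ^ q ≤ p ^ (B + h * △ k * q) * E (W ⊛ f ζ (c + h) ↑ △ k) ^ q

  p^-≤-* : ∀ {e e'} x {y} → e ≤ e' → y ≤ p ^ e * x → y ≤ p ^ e' * x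
  p^-≤-* x e≤e' y≤ = ≤-trans y≤ (*-monoˡ-≤ x (^-monoʳ-≤ p e≤e'))

  p^-trans : ∀ {e e' x y z} → x ≤ p ^ e * y → y ≤ p ^ e' * z → x ≤ p ^ (e + e') * z
  p^-trans {e} {e'} {x} {y} {z} x≤ y≤ = begin
    x                       ≤⟨ x≤ ⟩
    p ^ e * y               ≤⟨ *-monoʳ-≤ (p ^ e) y≤ ⟩
    p ^ e * (p ^ e' * z)    ≡⟨ *-assoc (p ^ e) (p ^ e') z ⟨
    p ^ e * p ^ e' * z      ≡⟨ cong (_* z) (^-distribˡ-+-* p e e') ⟨
    p ^ (e + e') * z        ∎
    where open ≤-Reasoning

  p^-power : ∀ {e x y} q → x ≤ p ^ e * y → x ^ q ≤ p ^ (e * q) * y ^ q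
  p^-power {e} {x} {y} q x≤ = begin
    x ^ q                   ≤⟨ ^-monoˡ-≤ q x≤ ⟩
    (p ^ e * y) ^ q         ≡⟨ *-^-comm (p ^ e) y q ⟩
    (p ^ e) ^ q * y ^ q     ≡⟨ cong (_* y ^ q) (^-*-assoc p e q) ⟩
    p ^ (e * q) * y ^ q     ∎
    where open ≤-Reasoning

  subclass-distinct : ∀ h ξ c {i j} → i < j → j < p ^ h → ¬ (P (c + h) ∣ subclass ξ c j ℤ.- subclass ξ c i)
  subclass-distinct h ξ c {i} {j} i<j j<q P∣ = <⇒≱ (≤-<-trans (m∸n≤m j i) j<q) p^h≤j∸i
    where
    l : ∀ ξ P i j → (ξ ℤ.+ P ℤ.* j) ℤ.- (ξ ℤ.+ P ℤ.* i) ≡ P ℤ.* (j ℤ.- i)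
    l = ℤ.solve-∀
    ∣j-i∣≡ : ∣ + j ℤ.- + i ∣ ≡ j ∸ i
    ∣j-i∣≡ = cong ∣_∣ (trans (ℤ.m-n≡m⊖n j i) (ℤ.⊖-≥ (<⇒≤ i<j)))
    p^h≤j∸i : p ^ h ≤ j ∸ i
    p^h≤j∸i = subst₂ _≤_ (∣P∣ h) ∣j-i∣≡
      (ℕ.∣⇒≤ {{subst NonZero (sym ∣j-i∣≡) (>-nonZero (m<n⇒0<n∸m i<j))}}
        (ℤ.∣⇒∣ᵤ (P-∣-cancelˡ c h {+ j ℤ.- + i} (subst (P (c + h) ∣_) (l ξ (P c) (+ i) (+ j)) P∣))))

  -- A coincidence between the two products would, by the congruence of degree 1, make two variables
  -- congruent modulo p^(c + h), although they lie in different subclasses.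
  linear-orthogonality : ∀ h W ξ c → Valid 1 (1 * h) W ξ c → ∀ i j → i < j → j < p ^ h →
    ⟨ W ⊛ f (subclass ξ c i) (c + h) , W ⊛ f (subclass ξ c j) (c + h) ⟩ ≡ 0
  linear-orthogonality h W ξ c valid i j i<j j<q = ⟨⟩≡0 λ {a} {b} a∈ b∈ a≡b → absurd a∈ b∈ a≡b
    where
    ξᵢ = subclass ξ c i
    ξⱼ = subclass ξ c j
    absurd : ∀ {a b} → a ∈ W ⊛ f ξᵢ (c + h) → b ∈ W ⊛ f ξⱼ (c + h) → a ≢ b
    absurd a∈ b∈ a≡b
      with w , _ , w∈ , g∈ , refl ← ∈-⊛⁻ W (f ξᵢ (c + h)) a∈
      with w' , _ , w'∈ , g'∈ , refl ← ∈-⊛⁻ W (f ξⱼ (c + h)) b∈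
      with x , x∈ , refl ← ∈-f {ξ = ξᵢ} {c + h} g∈
      with y , y∈ , refl ← ∈-f {ξ = ξⱼ} {c + h} g'∈ = subclass-distinct h ξ c i<j j<q P∣j-i
      where
      eq : ∑γ (x ∷ []) ∙ w ≡ ∑γ (y ∷ []) ∙ w'
      eq = trans (cong (_∙ w) (G.identityʳ (γ x))) (trans (G.comm (γ x) w) (trans a≡b
             (trans (G.comm w' (γ y)) (cong (_∙ w') (sym (G.identityʳ (γ y)))))))
      x-y : P (c + h) ∣ ∑^-∑^ ξ (x ∷ []) (y ∷ []) 1
      x-y = P-∣-weaken (≤-reflexive (l h c)) (congruent valid (x ∷ []) (y ∷ []) w∈ w'∈ refl refl
              (Class-trans {m = h} (subclass-∈ ξ c i) x∈ ∷ []) (Class-trans {m = h} (subclass-∈ ξ c j) y∈ ∷ []) eq 1 ≤-refl)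
        where
        l : ∀ h c → c + h ≡ 1 * h + c * 1
        l = solve-∀
      P∣j-i : P (c + h) ∣ subclass ξ c j ℤ.- subclass ξ c i
      P∣j-i = subst (P (c + h) ∣_) (l x y ξ ξᵢ ξⱼ) (ℤ.∣m∣n⇒∣m+n (ℤ.∣m∣n⇒∣m-n (∣- x∈) (∣- y∈)) (ℤ.∣m⇒∣-m x-y))
        where
        l : ∀ x y ξ ξᵢ ξⱼ →
          (x ℤ.- ξᵢ) ℤ.- (y ℤ.- ξⱼ) ℤ.+ ℤ.- ((x ℤ.- ξ) ℤ.* 1ℤ ℤ.+ 0ℤ ℤ.- ((y ℤ.- ξ) ℤ.* 1ℤ ℤ.+ 0ℤ)) ≡ ξⱼ ℤ.- ξᵢ
        l = ℤ.solve-∀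

  -- In degree 1 orthogonality gives the inequality without excess; `h + 0` has the shape `h + C`
  -- required for the induction on the degree.
  Dec-1 : ∀ d h → Dec 1 h d (h + 0)
  Dec-1 d h W ξ c valid =
    let i , i≤q , max = argmax (λ i → E (W ⊛ f (subclass ξ c i) (c + h))) (p ^ h)
        Eᵢ = E (W ⊛ f (subclass ξ c i) (c + h) ↑ 1)
    in subclass ξ c i , subclass-∈ ξ c i , p^-≤-* (Eᵢ ^ d) (m≤n+m _ (h + 0)) (p^-power {h * 1} d (begin
      E (W ⊛ f ξ c ↑ 1)                                       ≡⟨ E-cong (⊛-congˡ W (𝕄.*-identityʳ (f ξ c))) ⟩
      E (W ⊛ f ξ c)                                           ≤⟨ E-mono (≼-trans (⊛-mono (≼-refl {W}) (f-covering ξ c h)) (≈⇒≼ (⊛-⨁ W (λ i → f (subclass ξ c i) (c + h)) (p ^ h)))) ⟩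
      E (⨁ (λ i → W ⊛ f (subclass ξ c i) (c + h)) (p ^ h))    ≤⟨ E-⨁-orthogonal _ (p ^ h) (λ j j<q → max j (<⇒≤ j<q)) (linear-orthogonality h W ξ c valid) ⟩
      p ^ h * E (W ⊛ f (subclass ξ c i) (c + h))              ≡⟨ cong₂ (λ e x → p ^ e * x) (sym (*-identityʳ h)) (E-cong (⊛-congˡ W (𝕄.sym (𝕄.*-identityʳ _)))) ⟩
      p ^ (h * 1) * Eᵢ                                        ∎))
    where open ≤-Reasoning

  -- For ξ and η in one class modulo p^c this says that (ξ - η)/p^c is prime to p.
  Separated : ℕ → ℤ → ℤ → Set
  Separated c ξ η = ¬ (P (suc c) ∣ ξ ℤ.- η)

  Separated-sym : ∀ {c ξ η} → Separated c ξ η → Separated c η ξ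
  Separated-sym {c} {ξ} {η} sep P∣ = sep (subst (P (suc c) ∣_) (l ξ η) (ℤ.∣m⇒∣-m P∣))
    where
    l : ∀ ξ η → ℤ.- (η ℤ.- ξ) ≡ ξ ℤ.- η
    l = ℤ.solve-∀

  Separated-subclass : ∀ {c a ξ ζ η} → 1 ≤ a → Class ξ (c + a) ζ → Separated c ξ η → Separated c ζ η
  Separated-subclass {c} {a} {ξ} {ζ} {η} 1≤a ζ∈ sep P∣ = sep (subst (P (suc c) ∣_) (l ζ η ξ)
    (ℤ.∣m∣n⇒∣m-n P∣ (P-∣-weaken (≤-trans (≤-reflexive (+-comm 1 c)) (+-monoʳ-≤ c 1≤a)) (∣- ζ∈))))
    where
    l : ∀ ζ η ξ → (ζ ℤ.- η) ℤ.- (ζ ℤ.- ξ) ≡ ξ ℤ.- η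
    l = ℤ.solve-∀

  Valid-project : ∀ {l D W ξ₀ c₀ N ξ η c b h} → l + D < p → Valid (l + D) N W ξ₀ c₀ →
    Class ξ₀ c₀ ξ → Class ξ₀ c₀ η → Separated c₀ ξ η →
    suc D * b ≤ N → l * (c + h) ≤ suc D * b → l * h ≤ c →
    Valid l (l * h) (W ⊛ f η (c₀ + b) ↑ (△ D + l * D)) ξ (c₀ + c)
  Valid-project {l} {D} {W} {ξ₀} {c₀} {N} {ξ} {η} {c} {b} {h} k<p valid ξ∈ η∈ sep [1+D]b≤N l[c+h]≤ lh≤c = mkValid proof
    where
    v = △ D + l * D
    ξ-η∣ : P c₀ ∣ ξ ℤ.- η
    ξ-η∣ = subst (P c₀ ∣_) (e ξ η ξ₀) (ℤ.∣m∣n⇒∣m-n (∣- ξ∈) (∣- η∈))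
      where
      e : ∀ ξ η ξ₀ → (ξ ℤ.- ξ₀) ℤ.- (η ℤ.- ξ₀) ≡ ξ ℤ.- η
      e = ℤ.solve-∀
    τ = quotient ξ-η∣
    ξ-η≡ : ξ ℤ.- η ≡ P c₀ ℤ.* τ
    ξ-η≡ = trans (ℤ._∣_.equality ξ-η∣) (ℤ.*-comm τ (P c₀))
    p∤τ : ¬ (+ p ∣ τ)
    p∤τ p∣τ = sep (subst₂ _∣_ (sym (P-suc c₀)) (sym (ℤ._∣_.equality ξ-η∣)) (ℤ.*-monoˡ-∣ (P c₀) p∣τ))
    ξ₀-η∣ : P c₀ ∣ ξ₀ ℤ.- η
    ξ₀-η∣ = subst (P c₀ ∣_) (e η ξ₀) (ℤ.∣m⇒∣-m (∣- η∈))
      where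
      e : ∀ η ξ₀ → ℤ.- (η ℤ.- ξ₀) ≡ ξ₀ ℤ.- η
      e = ℤ.solve-∀
    weaken : ∀ {ζ xs} a → Class ξ₀ c₀ ζ → All (Class ζ (c₀ + a)) xs → All (Class ξ₀ c₀) xs
    weaken a ζ∈ []         = []
    weaken a ζ∈ (x∈ ∷ xs∈) = Class-trans {m = a} ζ∈ x∈ ∷ weaken a ζ∈ xs∈
    lengths : ∀ {xs us} → length xs ≡ △ l → length us ≡ v → length (xs ++ us) ≡ △ (l + D)
    lengths {xs} |xs| |us| = trans (List.length-++ xs) (trans (cong₂ _+_ |xs| |us|) (sym (△-+ l D)))
    merge : ∀ xs us w → ∑γ (xs ++ us) ∙ w ≡ ∑γ xs ∙ (w ∙ ∑γ us)
    merge xs us w = trans (cong (_∙ w) (∑γ-++ xs us)) (trans (G.assoc (∑γ xs) (∑γ us) w) (cong (∑γ xs ∙_) (G.comm (∑γ us) w)))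
    -- The modulus that `descend` reaches in the coordinate of level c₀. Going from there to level
    -- c₀ + c consumes `c * l` and leaves `l * h`.
    M = l * h + c * l
    proof : ∀ {w w'} xs ys → w ∈ W ⊛ f η (c₀ + b) ↑ v → w' ∈ W ⊛ f η (c₀ + b) ↑ v →
      length xs ≡ △ l → length ys ≡ △ l → All (Class ξ (c₀ + c)) xs → All (Class ξ (c₀ + c)) ys →
      ∑γ xs ∙ w ≡ ∑γ ys ∙ w' → Congruent l (l * h) ξ (c₀ + c) xs ys
    proof xs ys w∈ w'∈ |xs| |ys| xs∈ ys∈ eq
      with w , _ , w∈W , g∈ , refl ← ∈-⊛⁻ W (f η (c₀ + b) ↑ v) w∈
      with w' , _ , w'∈W , g'∈ , refl ← ∈-⊛⁻ W (f η (c₀ + b) ↑ v) w'∈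
      with us , |us| , us∈ , refl ← ∈-f↑ η (c₀ + b) v g∈
      with vs , |vs| , vs∈ , refl ← ∈-f↑ η (c₀ + b) v g'∈ =
      coarsen {l} {l * h} {M} {ξ} {c₀} {c} {xs} {ys} ≤-refl
        (descend {l} {D} {c₀} {c} {b} {N} {M} {ξ₀} {ξ} {η} {τ} {xs} {ys} {us} {vs} k<p
          (congruent valid (xs ++ us) (ys ++ vs) w∈W w'∈W (lengths {xs} |xs| |us|) (lengths {ys} |ys| |vs|)
            (++⁺ (weaken c ξ∈ xs∈) (weaken b η∈ us∈)) (++⁺ (weaken c ξ∈ ys∈) (weaken b η∈ vs∈))
            (trans (merge xs us w) (trans eq (sym (merge ys vs w')))))
          ξ₀-η∣ ξ-η≡ p∤τ xs∈ ys∈ us∈ vs∈ (trans |xs| (sym |ys|)) [1+D]b≤N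
          (≤-trans (≤-reflexive (e₁ l c h)) l[c+h]≤)
          (≤-trans (+-monoˡ-≤ (c * l) lh≤c) (≤-reflexive (sym (*-suc c l)))))
      where
      e₁ : ∀ l c h → l * h + c * l ≡ l * (c + h)
      e₁ = solve-∀

  -- Refinement of one class while the variables near the other are frozen.

  record Drop (W : Measure) (r q : ℕ) (ξ : ℤ) (c a e : ℕ) : Set where
    constructor mkDrop
    field
      ζ    : ℤ
      ζ∈   : Class ξ c ζ
      E≤   : E (W ⊛ f ξ c ↑ r) ^ q ≤ p ^ e * E (W ⊛ f ζ (c + a) ↑ r) ^ q

  Drop-trans : ∀ {W r q ξ c a a' e e'} → Drop W r q ξ c a e →
    (∀ {ζ} → Class ξ c ζ → Drop W r q ζ (c + a) a' e') → Drop W r q ξ c (a + a') (e + e')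
  Drop-trans {W} {r} {q} {ξ} {c} {a} {a'} {e} {e'} (mkDrop ζ ζ∈ ≤₁) next
    with mkDrop ζ' ζ'∈ ≤₂ ← next ζ∈ = mkDrop ζ' (Class-trans {m = a} ζ∈ ζ'∈)
      (subst (λ n → E (W ⊛ f ξ c ↑ r) ^ q ≤ p ^ (e + e') * E (W ⊛ f ζ' n ↑ r) ^ q) (+-assoc c a a')
        (p^-trans {e} {e'} ≤₁ ≤₂))

  Drop-weaken : ∀ {W r q ξ c a e e'} → e ≤ e' → Drop W r q ξ c a e → Drop W r q ξ c a e'
  Drop-weaken {W} {r} {q} {c = c} {a} e≤e' (mkDrop ζ ζ∈ E≤) = mkDrop ζ ζ∈ (p^-≤-* _ e≤e' E≤)

  Drop-trivial : ∀ {W r q ξ c} a → Drop W r q ξ c a (2 * (a * r) * q)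
  Drop-trivial {W} {r} {q} {ξ} {c} a = let ζ , ζ∈ , E≤ = trivial-decoupling W ξ c a r in mkDrop ζ ζ∈ (p^-power {2 * (a * r)} q E≤)

  -- Pays for the two ends of a refinement that are treated trivially: the first l (C + 1) levels
  -- and a remainder of fewer than C + 1 levels.
  refinement-constant : (l q C : ℕ) → ℕ
  refinement-constant l q C = (l * suc C + suc C) * △ l * q

  module _ (l D q C : ℕ) (k<p : l + D < p) (dec : ∀ h → Dec l h q (h + C)) where

    private
      -- With steps of C + 1 levels the excess h + C of a step is at most 2 h. Thus the constant C
      -- is absorbed however many steps follow.
      h = suc C
      cost₀ = refinement-constant l q C

    module _ {W ξ₀ c₀ N η b} (valid : Valid (l + D) N W ξ₀ c₀) (η∈ : Class ξ₀ c₀ η) ([1+D]b≤N : suc D * b ≤ N) where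

      private
        W' = W ⊛ f η (c₀ + b) ↑ (△ D + l * D)

        step : ∀ {ξ c} → 1 ≤ c → l * h ≤ c → l * (c + h) ≤ suc D * b → Class ξ₀ c₀ ξ → Separated c₀ ξ η →
          Drop W' (△ l) q ξ (c₀ + c) h (2 * h + h * △ l * q)
        step {ξ} {c} 1≤c lh≤c l[c+h]≤ ξ∈ sep = Drop-weaken {W'} {△ l} {q}
          (+-monoˡ-≤ (h * △ l * q) (≤-trans (+-monoʳ-≤ h (n≤1+n C)) (≤-reflexive (cong (λ n → h + n) (sym (+-identityʳ h))))))
          (dec-drop (dec h W' ξ (c₀ + c) (Valid-project k<p valid ξ∈ η∈ sep [1+D]b≤N l[c+h]≤ lh≤c)))
          where
          dec-drop : ∀ {W r q ξ c a e} → ∃[ ζ ] Class ξ c ζ × E (W ⊛ f ξ c ↑ r) ^ q ≤ p ^ e * E (W ⊛ f ζ (c + a) ↑ r) ^ q → Drop W r q ξ c a e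
          dec-drop (ζ , ζ∈ , E≤) = mkDrop ζ ζ∈ E≤

        level : ∀ n c → c₀ + c + n ≡ c₀ + (c + n)
        level n c = +-assoc c₀ c n

        steps : ∀ n {ξ c} → 1 ≤ c → l * h ≤ c → l * (c + n * h) ≤ suc D * b → Class ξ₀ c₀ ξ → Separated c₀ ξ η →
          Drop W' (△ l) q ξ (c₀ + c) (n * h) (2 * (n * h) + n * h * △ l * q)
        steps zero    {ξ} {c} _ _ _ _ _ = mkDrop ξ (Class-refl ξ (c₀ + c))
          (≤-reflexive (trans (cong (λ n → E (W' ⊛ f ξ n ↑ △ l) ^ q) (sym (+-identityʳ (c₀ + c)))) (sym (+-identityʳ _))))
        steps (suc n) {ξ} {c} 1≤c lh≤c l[c+nh]≤ ξ∈ sep = Drop-weaken {W'} {△ l} {q} (≤-reflexive (lemma n h (△ l) q))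
          (Drop-trans {W'} {△ l} {q} {ξ} {c₀ + c} {h} {n * h}
            (step 1≤c lh≤c (≤-trans (*-monoʳ-≤ l (+-monoʳ-≤ c (m≤m+n h (n * h)))) l[c+nh]≤) ξ∈ sep)
            λ {ζ} ζ∈ → subst (λ m → Drop W' (△ l) q ζ m (n * h) (2 * (n * h) + n * h * △ l * q)) (sym (level h c))
              (steps n {ζ} {c + h} (≤-trans 1≤c (m≤m+n c h)) (≤-trans lh≤c (m≤m+n c h))
                (≤-trans (≤-reflexive (cong (l *_) (+-assoc c h (n * h)))) l[c+nh]≤)
                (Class-trans {m = c} ξ∈ ζ∈) (Separated-subclass {ξ = ξ} 1≤c ζ∈ sep)))
          where
          lemma : ∀ n h u q → 2 * h + h * u * q + (2 * (n * h) + n * h * u * q) ≡ 2 * (suc n * h) + suc n * h * u * q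
          lemma = solve-∀

      -- A step of h levels from level c requires l h ≤ c, so steps of a fixed length are repeated.
      -- The first l h levels are descended trivially to satisfy this condition, and so is the
      -- remainder of the division by h.
      refine′ : ∀ {ξ} a j → 1 ≤ a → l * (a + j) ≤ suc D * b → Class ξ₀ c₀ ξ → Separated c₀ ξ η →
        Drop W' (△ l) q ξ (c₀ + a) j (2 * (a + j) + cost₀ + j * △ l * q)
      refine′ {ξ} a j 1≤a l[a+j]≤ ξ∈ sep with j ≤? l * h
      ... | yes j≤lh = Drop-weaken {W'} {△ l} {q} (begin
          2 * (j * △ l) * q                                       ≡⟨ lemma j (△ l) q ⟩
          j * △ l * q + j * △ l * q                               ≤⟨ +-monoˡ-≤ (j * △ l * q) (≤-trans (*-monoˡ-≤ q (*-monoˡ-≤ (△ l) (≤-trans j≤lh (m≤m+n (l * h) h)))) (m≤n+m _ (2 * (a + j)))) ⟩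
          2 * (a + j) + cost₀ + j * △ l * q         ∎)
          (Drop-trivial j)
        where
        open ≤-Reasoning
        lemma : ∀ j u q → 2 * (j * u) * q ≡ j * u * q + j * u * q
        lemma = solve-∀
      ... | no j≰lh with j' , refl ← m≤n⇒∃[o]m+o≡n (<⇒≤ (≰⇒> j≰lh)) =
        subst (λ m → Drop W' (△ l) q ξ (c₀ + a) m (2 * (a + m) + cost₀ + m * △ l * q)) (sym j≡)
        (Drop-weaken {W'} {△ l} {q} cost
          (Drop-trans {W'} {△ l} {q} {ξ} {c₀ + a} {l * h} (Drop-trivial (l * h)) λ {ζ} ζ∈ →
            subst (λ m → Drop W' (△ l) q ζ m (n * h + r) (2 * (n * h) + n * h * △ l * q + 2 * (r * △ l) * q)) (sym (level (l * h) a))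
              (Drop-trans {W'} {△ l} {q} {ζ} {c₀ + (a + l * h)} {n * h}
                (steps n {ζ} {a + l * h} (≤-trans 1≤a (m≤m+n a (l * h))) (m≤n+m (l * h) a)
                  (≤-trans (*-monoʳ-≤ l (≤-trans (≤-reflexive (+-assoc a (l * h) (n * h))) (+-monoʳ-≤ a (+-monoʳ-≤ (l * h) (≤-trans (m≤m+n (n * h) r) (≤-reflexive (sym j'≡))))))) l[a+j]≤)
                  (Class-trans {m = a} ξ∈ ζ∈) (Separated-subclass {ξ = ξ} 1≤a ζ∈ sep))
                λ _ → Drop-trivial r)))
        where
        open ≤-Reasoning
        n = j' / h
        r = j' % h
        j'≡ : j' ≡ n * h + r
        j'≡ = trans (m≡m%n+[m/n]*n j' h) (+-comm r (n * h))
        j≡ : l * h + j' ≡ l * h + (n * h + r)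
        j≡ = cong (λ n → l * h + n) j'≡
        lemma₁ : ∀ lh nh r u q → 2 * (lh * u) * q + (2 * nh + nh * u * q + 2 * (r * u) * q) ≡
          2 * nh + (lh * u * q + r * u * q) + (lh + (nh + r)) * u * q
        lemma₁ = solve-∀
        cost : 2 * (l * h * △ l) * q + (2 * (n * h) + n * h * △ l * q + 2 * (r * △ l) * q) ≤
          2 * (a + (l * h + (n * h + r))) + cost₀ + (l * h + (n * h + r)) * △ l * q
        cost = begin
          2 * (l * h * △ l) * q + (2 * (n * h) + n * h * △ l * q + 2 * (r * △ l) * q)
            ≡⟨ lemma₁ (l * h) (n * h) r (△ l) q ⟩
          2 * (n * h) + (l * h * △ l * q + r * △ l * q) + (l * h + (n * h + r)) * △ l * q
            ≤⟨ +-monoˡ-≤ _ (+-mono-≤ (*-monoʳ-≤ 2 (≤-trans (m≤m+n (n * h) r) (≤-trans (m≤n+m _ (l * h)) (m≤n+m _ a))))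
                 (≤-trans (≤-reflexive (sym (*-distribʳ-+ q (l * h * △ l) (r * △ l))))
                   (*-monoˡ-≤ q (≤-trans (≤-reflexive (sym (*-distribʳ-+ (△ l) (l * h) r))) (*-monoˡ-≤ (△ l) (+-monoʳ-≤ (l * h) (<⇒≤ (m%n<n j' h)))))))) ⟩
          2 * (a + (l * h + (n * h + r))) + cost₀ + (l * h + (n * h + r)) * △ l * q ∎

  p^-cancel : ∀ e {x y} → p ^ e * x ≤ p ^ e * y → x ≤ y
  p^-cancel e = *-cancelˡ-≤ (p ^ e) {{p^-nonZero e}}

  p^-+-* : ∀ a b x → p ^ (a + b) * x ≡ p ^ a * (p ^ b * x)
  p^-+-* a b x = trans (cong (_* x) (^-distribˡ-+-* p a b)) (*-assoc (p ^ a) (p ^ b) x)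

  -- Negative exponents are avoided by carrying a power of p on both sides; only the differences of
  -- the exponents matter.
  p^-shift : ∀ {A B A' B' x z} → p ^ A * x ≤ p ^ B * z → A' + B ≤ A + B' → p ^ A' * x ≤ p ^ B' * z
  p^-shift {A} {B} {A'} {B'} {x} {z} x≤ A'+B≤A+B' = p^-cancel A (begin
    p ^ A * (p ^ A' * x)     ≡⟨ p^-+-* A A' x ⟨
    p ^ (A + A') * x         ≡⟨ cong (λ e → p ^ e * x) (+-comm A A') ⟩
    p ^ (A' + A) * x         ≡⟨ p^-+-* A' A x ⟩
    p ^ A' * (p ^ A * x)     ≤⟨ *-monoʳ-≤ (p ^ A') x≤ ⟩
    p ^ A' * (p ^ B * z)     ≡⟨ p^-+-* A' B z ⟨
    p ^ (A' + B) * z         ≤⟨ *-monoˡ-≤ z (^-monoʳ-≤ p A'+B≤A+B') ⟩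
    p ^ (A + B') * z         ≡⟨ p^-+-* A B' z ⟩
    p ^ A * (p ^ B' * z)     ∎)
    where open ≤-Reasoning

  -- One round of the recursion in terms of exponents: Hölder's inequality weighs the bound on x₂
  -- once and the bound on x₃ n times.
  p^-root : ∀ {A₁ B₁ A₂ B₂ A₃ B₃ x₁ x₂ x₃ z} n → x₁ ^ suc n ≤ x₂ * x₃ ^ n →
    p ^ A₂ * x₂ ≤ p ^ B₂ * z → p ^ A₃ * x₃ ≤ p ^ B₃ * z →
    suc n * A₁ + (B₂ + B₃ * n) ≤ A₂ + A₃ * n + suc n * B₁ →
    p ^ A₁ * x₁ ≤ p ^ B₁ * z
  p^-root {A₁} {B₁} {A₂} {B₂} {A₃} {B₃} {x₁} {x₂} {x₃} {z} n x₁≤ x₂≤ x₃≤ exponents =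
    ^-cancelʳ-≤ n (begin
      (p ^ A₁ * x₁) ^ suc n                ≡⟨ power A₁ x₁ ⟩
      p ^ (suc n * A₁) * x₁ ^ suc n        ≤⟨ p^-shift {A₂ + A₃ * n} {B₂ + B₃ * n} {suc n * A₁} {suc n * B₁} product exponents ⟩
      p ^ (suc n * B₁) * z ^ suc n         ≡⟨ power B₁ z ⟨
      (p ^ B₁ * z) ^ suc n                 ∎)
    where
    open ≤-Reasoning
    power : ∀ e x → (p ^ e * x) ^ suc n ≡ p ^ (suc n * e) * x ^ suc n
    power e x = trans (*-^-comm (p ^ e) x (suc n)) (cong (_* x ^ suc n) (trans (^-*-assoc p e (suc n)) (cong (p ^_) (*-comm e (suc n)))))
    gather : ∀ a b x y → p ^ a * x * (p ^ b * y) ^ n ≡ p ^ (a + b * n) * (x * y ^ n)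
    gather a b x y = begin-equality
      p ^ a * x * (p ^ b * y) ^ n             ≡⟨ cong (p ^ a * x *_) (trans (*-^-comm (p ^ b) y n) (cong (_* y ^ n) (^-*-assoc p b n))) ⟩
      p ^ a * x * (p ^ (b * n) * y ^ n)       ≡⟨ [m*n]*[o*p]≡[m*o]*[n*p] (p ^ a) x (p ^ (b * n)) (y ^ n) ⟩
      p ^ a * p ^ (b * n) * (x * y ^ n)       ≡⟨ cong (_* (x * y ^ n)) (^-distribˡ-+-* p a (b * n)) ⟨
      p ^ (a + b * n) * (x * y ^ n)           ∎
    product : p ^ (A₂ + A₃ * n) * x₁ ^ suc n ≤ p ^ (B₂ + B₃ * n) * z ^ suc n
    product = begin
      p ^ (A₂ + A₃ * n) * x₁ ^ suc n          ≤⟨ *-monoʳ-≤ (p ^ (A₂ + A₃ * n)) x₁≤ ⟩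
      p ^ (A₂ + A₃ * n) * (x₂ * x₃ ^ n)       ≡⟨ gather A₂ A₃ x₂ x₃ ⟨
      p ^ A₂ * x₂ * (p ^ A₃ * x₃) ^ n         ≤⟨ *-mono-≤ x₂≤ (^-monoˡ-≤ n x₃≤) ⟩
      p ^ B₂ * z * (p ^ B₃ * z) ^ n           ≡⟨ gather B₂ B₃ z z ⟩
      p ^ (B₂ + B₃ * n) * z ^ suc n           ∎

  -- Mixed moments of two classes and Hölder's inequality between them.

  module Mixed (W : Measure) (c₀ q : ℕ) where

    mixed : (l D : ℕ) (ξ : ℤ) (a : ℕ) (η : ℤ) (b : ℕ) → ℕ
    mixed l D ξ a η b = E (W ⊛ (f ξ (c₀ + a) ↑ △ l ⊛ f η (c₀ + b) ↑ (△ D + l * D)))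

    -- The exponent of p that square-root cancellation loses between level c₀ and the levels a and b
    -- below it.
    weight : (l D a b : ℕ) → ℕ
    weight l D a b = a * △ l + b * (△ D + l * D)

    -- The mixed moment divided by its expected size, up to the normalisation by ζ ↦ E(W f_ζ^△(k)).
    X : (l D : ℕ) (ξ : ℤ) (a : ℕ) (η : ℤ) (b : ℕ) → ℕ
    X l D ξ a η b = (p ^ weight l D a b * mixed l D ξ a η b) ^ q

    -- All three moments contain `W'`, with `△ l` factors near ξ and `△ D` near η. The other factors
    -- come in blocks of length l + 1: one block near ξ and D near η on the left, D + 1 equal blocks
    -- in each moment on the right.
    mixed-hölder : ∀ l D ξ a η b →
      mixed (suc l) D ξ a η b ^ suc D ≤ mixed D (suc l) η b ξ a * mixed l (suc D) ξ a η b ^ D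
    mixed-hölder l D ξ a η b = begin
      mixed (suc l) D ξ a η b ^ suc D                              ≡⟨ cong (_^ suc D) (E-cong eq₁) ⟩
      E (W' ⊛ (A ↑ 1 ⊛ B ↑ D)) ^ suc D                             ≤⟨ interpolation W' A B 1 D ⟩
      E (W' ⊛ A ↑ suc D) ^ 1 * E (W' ⊛ B ↑ suc D) ^ D              ≡⟨ cong₂ (λ x y → x * y ^ D) (*-identityʳ (E (W' ⊛ A ↑ suc D))) (E-cong (𝕄.sym eq₃)) ⟩
      E (W' ⊛ A ↑ suc D) * mixed l (suc D) ξ a η b ^ D             ≡⟨ cong (_* mixed l (suc D) ξ a η b ^ D) (E-cong (𝕄.sym eq₂)) ⟩
      mixed D (suc l) η b ξ a * mixed l (suc D) ξ a η b ^ D        ∎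
      where
      open ≤-Reasoning
      F = f ξ (c₀ + a)
      G' = f η (c₀ + b)
      A = F ↑ suc l
      B = G' ↑ suc l
      W' = W ⊛ (F ↑ △ l ⊛ G' ↑ △ D)
      ↑-split : ∀ H m n {r} → r ≡ m + suc l * n → H ↑ r ≈ H ↑ m ⊛ (H ↑ suc l) ↑ n
      ↑-split H m n refl = 𝕄.trans (↑-homo-⊛ H m (suc l * n)) (⊛-congˡ (H ↑ m) (𝕄.sym (↑-assocʳ H (suc l) n)))
      eq₁ : W ⊛ (F ↑ △ (suc l) ⊛ G' ↑ (△ D + suc l * D)) ≈ W' ⊛ (A ↑ 1 ⊛ B ↑ D)
      eq₁ = 𝕄.trans (⊛-congˡ W (𝕄.*-cong (↑-split F (△ l) 1 (e l (△ l))) (↑-split G' (△ D) D refl)))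
        (prove 5 (var 0F :∙ ((var 1F :∙ var 3F) :∙ (var 2F :∙ var 4F))) ((var 0F :∙ (var 1F :∙ var 2F)) :∙ (var 3F :∙ var 4F))
          (W ∷ F ↑ △ l ∷ G' ↑ △ D ∷ A ↑ 1 ∷ B ↑ D ∷ []))
        where
        e : ∀ l x → suc (l + x) ≡ x + suc l * 1
        e = solve-∀
      eq₂ : W ⊛ (G' ↑ △ D ⊛ F ↑ (△ (suc l) + D * suc l)) ≈ W' ⊛ A ↑ suc D
      eq₂ = 𝕄.trans (⊛-congˡ W (⊛-congˡ (G' ↑ △ D) (↑-split F (△ l) (suc D) (e l (△ l) D))))
        (prove 4 (var 0F :∙ (var 2F :∙ (var 1F :∙ var 3F))) ((var 0F :∙ (var 1F :∙ var 2F)) :∙ var 3F)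
          (W ∷ F ↑ △ l ∷ G' ↑ △ D ∷ A ↑ suc D ∷ []))
        where
        e : ∀ l x D → suc (l + x) + D * suc l ≡ x + suc l * suc D
        e = solve-∀
      eq₃ : W ⊛ (F ↑ △ l ⊛ G' ↑ (△ (suc D) + l * suc D)) ≈ W' ⊛ B ↑ suc D
      eq₃ = 𝕄.trans (⊛-congˡ W (⊛-congˡ (F ↑ △ l) (↑-split G' (△ D) (suc D) (e l (△ D) D))))
        (prove 4 (var 0F :∙ (var 1F :∙ (var 2F :∙ var 3F))) ((var 0F :∙ (var 1F :∙ var 2F)) :∙ var 3F)
          (W ∷ F ↑ △ l ∷ G' ↑ △ D ∷ B ↑ suc D ∷ []))
        where
        e : ∀ l x D → suc (D + x) + l * suc D ≡ x + suc l * suc D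
        e = solve-∀

    -- The weights satisfy the same linear relation as the blocks, so the normalisation leaves
    -- Hölder's inequality unchanged.
    X-hölder : ∀ l D ξ a η b → X (suc l) D ξ a η b ^ suc D ≤ X D (suc l) η b ξ a * X l (suc D) ξ a η b ^ D
    X-hölder l D ξ a η b = begin
      (n₁ ^ q) ^ suc D                     ≡⟨ pow-swap n₁ q (suc D) ⟩
      (n₁ ^ suc D) ^ q                     ≤⟨ ^-monoˡ-≤ q inner ⟩
      (n₂ * n₃ ^ D) ^ q                    ≡⟨ trans (*-^-comm n₂ (n₃ ^ D) q) (cong (n₂ ^ q *_) (pow-swap n₃ D q)) ⟩
      n₂ ^ q * (n₃ ^ q) ^ D                ∎
      where
      open ≤-Reasoning
      e₁ = weight (suc l) D a b
      e₂ = weight D (suc l) b a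
      e₃ = weight l (suc D) a b
      m₁ = mixed (suc l) D ξ a η b
      m₂ = mixed D (suc l) η b ξ a
      m₃ = mixed l (suc D) ξ a η b
      n₁ = p ^ e₁ * m₁
      n₂ = p ^ e₂ * m₂
      n₃ = p ^ e₃ * m₃
      weights : ∀ a b l D x y → (a * (suc l + x) + b * (y + suc l * D)) * suc D ≡
        b * y + a * ((suc l + x) + D * suc l) + (a * x + b * ((suc D + y) + l * suc D)) * D
      weights = solve-∀
      inner : n₁ ^ suc D ≤ n₂ * n₃ ^ D
      inner = begin
        n₁ ^ suc D                                     ≡⟨ trans (*-^-comm (p ^ e₁) m₁ (suc D)) (cong (_* m₁ ^ suc D) (^-*-assoc p e₁ (suc D))) ⟩
        p ^ (e₁ * suc D) * m₁ ^ suc D                  ≤⟨ *-monoʳ-≤ (p ^ (e₁ * suc D)) (mixed-hölder l D ξ a η b) ⟩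
        p ^ (e₁ * suc D) * (m₂ * m₃ ^ D)               ≡⟨ cong (λ e → p ^ e * (m₂ * m₃ ^ D)) (weights a b l D (△ l) (△ D)) ⟩
        p ^ (e₂ + e₃ * D) * (m₂ * m₃ ^ D)              ≡⟨ cong (_* (m₂ * m₃ ^ D)) (trans (^-distribˡ-+-* p e₂ (e₃ * D)) (cong (p ^ e₂ *_) (sym (^-*-assoc p e₃ D)))) ⟩
        p ^ e₂ * (p ^ e₃) ^ D * (m₂ * m₃ ^ D)          ≡⟨ [m*n]*[o*p]≡[m*o]*[n*p] (p ^ e₂) ((p ^ e₃) ^ D) m₂ (m₃ ^ D) ⟩
        p ^ e₂ * m₂ * ((p ^ e₃) ^ D * m₃ ^ D)          ≡⟨ cong (n₂ *_) (*-^-comm (p ^ e₃) m₃ D) ⟨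
        n₂ * n₃ ^ D                                    ∎

    -- The sharp loss of the refinement is exactly the increase of the weight; only the excess
    -- survives.
    X-refine : ∀ {l D ξ₀ N η ξ} b a j C (k<p : l + D < p) (dec : ∀ h → Dec l h q (h + C)) →
      Valid (l + D) N W ξ₀ c₀ → Class ξ₀ c₀ ξ → Class ξ₀ c₀ η → Separated c₀ ξ η →
      1 ≤ a → l * (a + j) ≤ suc D * b → suc D * b ≤ N →
      ∃[ ξ' ] Class ξ (c₀ + a) ξ' ×
        X l D ξ a η b ≤ p ^ (2 * (a + j) + refinement-constant l q C) * X l D ξ' (a + j) η b
    X-refine {l} {D} {ξ₀} {N} {η} {ξ} b a j C k<p dec valid ξ∈ η∈ sep 1≤a l[a+j]≤ [1+D]b≤N
      with mkDrop ξ' ξ'∈ E≤ ← refine′ l D q C k<p dec valid η∈ [1+D]b≤N {ξ} a j 1≤a l[a+j]≤ ξ∈ sep = ξ' , ξ'∈ , (begin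
        (p ^ w * mixed l D ξ a η b) ^ q                        ≡⟨ trans (*-^-comm (p ^ w) _ q) (cong₂ _*_ (^-*-assoc p w q) (cong (_^ q) (E-cong swap))) ⟩
        p ^ (w * q) * E (W' ⊛ f ξ (c₀ + a) ↑ △ l) ^ q          ≤⟨ *-monoʳ-≤ (p ^ (w * q)) E≤ ⟩
        p ^ (w * q) * (p ^ (cost + j * △ l * q) * E (W' ⊛ f ξ' (c₀ + a + j) ↑ △ l) ^ q)
                                                               ≡⟨ p^-+-* (w * q) (cost + j * △ l * q) _ ⟨
        p ^ (w * q + (cost + j * △ l * q)) * E (W' ⊛ f ξ' (c₀ + a + j) ↑ △ l) ^ q
                                                               ≡⟨ cong₂ (λ e n → p ^ e * E (W' ⊛ f ξ' n ↑ △ l) ^ q) (exps a b j (△ l) (△ D + l * D) q cost) (+-assoc c₀ a j) ⟩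
        p ^ (cost + w' * q) * E (W' ⊛ f ξ' (c₀ + (a + j)) ↑ △ l) ^ q
                                                               ≡⟨ p^-+-* cost (w' * q) _ ⟩
        p ^ cost * (p ^ (w' * q) * E (W' ⊛ f ξ' (c₀ + (a + j)) ↑ △ l) ^ q)
                                                               ≡⟨ cong (p ^ cost *_) (trans (*-^-comm (p ^ w') _ q) (cong₂ _*_ (^-*-assoc p w' q) (cong (_^ q) (E-cong swap)))) ⟨
        p ^ cost * X l D ξ' (a + j) η b                        ∎)
      where
      open ≤-Reasoning
      w = weight l D a b
      w' = weight l D (a + j) b
      W' = W ⊛ f η (c₀ + b) ↑ (△ D + l * D)
      cost = 2 * (a + j) + refinement-constant l q C
      exps : ∀ a b j x v q cost → (a * x + b * v) * q + (cost + j * x * q) ≡ cost + ((a + j) * x + b * v) * q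
      exps = solve-∀
      swap : ∀ {A B} → W ⊛ (A ⊛ B) ≈ W ⊛ B ⊛ A
      swap {A} {B} = prove 3 (var 0F :∙ (var 1F :∙ var 2F)) ((var 0F :∙ var 2F) :∙ var 1F) (W ∷ A ∷ B ∷ [])

  -- Iteration of the recursion for mixed moments.

  open Mixed using (X; mixed; weight; X-hölder)

  -- The conclusion of `X-refine`, detached from the lower-degree inequality that yields it.
  Refinable : (k q C l D : ℕ) → Set
  Refinable k q C l D = ∀ {W ξ₀ c₀ h η ξ} b a j → Valid k (k * h) W ξ₀ c₀ →
    Class ξ₀ c₀ ξ → Class ξ₀ c₀ η → Separated c₀ ξ η →
    1 ≤ a → l * (a + j) ≤ suc D * b → suc D * b ≤ k * h →
    ∃[ ξ' ] Class ξ (c₀ + a) ξ' × X W c₀ q l D ξ a η b ≤ p ^ (2 * (a + j) + C) * X W c₀ q l D ξ' (a + j) η b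

  -- A decoupling bound D(h) ≤ p^((e h + C)/q), in the normalisation Z = p^(h △(k) q) · max E(W f_ζ^△(k))^q
  -- with ζ of level h.
  Normalised : (k q e C : ℕ) (W : Measure) (ξ₀ : ℤ) (c₀ h Z : ℕ) → Set
  Normalised k q e C W ξ₀ c₀ h Z = ∀ ξ a h' → Class ξ₀ c₀ ξ → a + h' ≡ h →
    (p ^ (a * △ k) * E (W ⊛ f ξ (c₀ + a) ↑ △ k)) ^ q ≤ p ^ (e * h' + C) * Z

  module Claim
    (k q R e C C' : ℕ) (1≤k : 1 ≤ k) (8≤R : 8 ≤ R) (e-large : R * (k ^ 4 * k) ≤ e)
    (refinable : ∀ l D → suc l + suc D ≡ k → Refinable k q C' (suc l) (suc D))
    where

    private
      K = k ^ 4
      instance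
        k-nonZero : NonZero k
        k-nonZero = >-nonZero 1≤k

    module _ {W ξ₀ c₀ h Z} (valid : Valid k (k * h) W ξ₀ c₀) (bound : Normalised k q e C W ξ₀ c₀ h Z) where

      -- Hölder's inequality between the two pure moments, both estimated by `bound`. Nothing is
      -- gained yet.
      base : ∀ l D {ξ η} a b → l + D ≡ k → Class ξ₀ c₀ ξ → Class ξ₀ c₀ η → a ≤ h → b ≤ h →
             X W c₀ q l D ξ a η b ≤ p ^ (e * h + C) * Z
      base l D {ξ} {η} a b refl ξ∈ η∈ a≤h b≤h = root (△ (l + D)) 1≤△ (begin
        X W c₀ q l D ξ a η b ^ △ (l + D)                        ≡⟨ pow-swap (p ^ w * m) q (△ (l + D)) ⟩
        ((p ^ w * m) ^ △ (l + D)) ^ q                           ≤⟨ ^-monoˡ-≤ q inner ⟩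
        (F ^ △ l * G' ^ v) ^ q                                  ≡⟨ trans (*-^-comm (F ^ △ l) (G' ^ v) q) (cong₂ _*_ (pow-swap F (△ l) q) (pow-swap G' v q)) ⟩
        (F ^ q) ^ △ l * (G' ^ q) ^ v                            ≤⟨ *-mono-≤ (^-monoˡ-≤ (△ l) (level ξ∈ a≤h)) (^-monoˡ-≤ v (level η∈ b≤h)) ⟩
        T ^ △ l * T ^ v                                         ≡⟨ ^-distribˡ-+-* T (△ l) v ⟨
        T ^ (△ l + v)                                           ≡⟨ cong (T ^_) (△-+ l D) ⟨
        T ^ △ (l + D)                                           ∎)
        where
        open ≤-Reasoning
        v = △ D + l * D
        w = weight W c₀ q l D a b
        m = mixed W c₀ q l D ξ a η b
        T = p ^ (e * h + C) * Z
        F = p ^ (a * △ (l + D)) * E (W ⊛ f ξ (c₀ + a) ↑ △ (l + D))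
        G' = p ^ (b * △ (l + D)) * E (W ⊛ f η (c₀ + b) ↑ △ (l + D))
        1≤△ : 1 ≤ △ (l + D)
        1≤△ with suc k' ← l + D = s≤s z≤n
        root : ∀ n {x y} → 1 ≤ n → x ^ n ≤ y ^ n → x ≤ y
        root (suc n) _ = ^-cancelʳ-≤ n
        level : ∀ {ζ c} → Class ξ₀ c₀ ζ → c ≤ h → (p ^ (c * △ (l + D)) * E (W ⊛ f ζ (c₀ + c) ↑ △ (l + D))) ^ q ≤ T
        level {ζ} {c} ζ∈ c≤h = p^-≤-* Z (+-monoˡ-≤ C (*-monoʳ-≤ e (m∸n≤m h c))) (bound ζ c (h ∸ c) ζ∈ (m+[n∸m]≡n c≤h))
        inner : (p ^ w * m) ^ △ (l + D) ≤ F ^ △ l * G' ^ v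
        inner = begin
          (p ^ w * m) ^ △ (l + D)                               ≡⟨ trans (*-^-comm (p ^ w) m (△ (l + D))) (cong (_* m ^ △ (l + D)) (^-*-assoc p w (△ (l + D)))) ⟩
          p ^ (w * △ (l + D)) * m ^ △ (l + D)                   ≤⟨ *-monoʳ-≤ (p ^ (w * △ (l + D))) interpolated ⟩
          p ^ (w * △ (l + D)) * (Ef ^ △ l * Eg ^ v)             ≡⟨ cong (λ n → p ^ n * (Ef ^ △ l * Eg ^ v)) (exps a b (△ l) v (△ (l + D))) ⟩
          p ^ (a * △ (l + D) * △ l + b * △ (l + D) * v) * (Ef ^ △ l * Eg ^ v)
                                                                ≡⟨ cong (_* (Ef ^ △ l * Eg ^ v)) (trans (^-distribˡ-+-* p (a * △ (l + D) * △ l) _) (cong₂ _*_ (sym (^-*-assoc p (a * △ (l + D)) (△ l))) (sym (^-*-assoc p (b * △ (l + D)) v)))) ⟩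
          (p ^ (a * △ (l + D))) ^ △ l * (p ^ (b * △ (l + D))) ^ v * (Ef ^ △ l * Eg ^ v)
                                                                ≡⟨ [m*n]*[o*p]≡[m*o]*[n*p] ((p ^ (a * △ (l + D))) ^ △ l) ((p ^ (b * △ (l + D))) ^ v) (Ef ^ △ l) (Eg ^ v) ⟩
          (p ^ (a * △ (l + D))) ^ △ l * Ef ^ △ l * ((p ^ (b * △ (l + D))) ^ v * Eg ^ v)
                                                                ≡⟨ cong₂ _*_ (*-^-comm (p ^ (a * △ (l + D))) Ef (△ l)) (*-^-comm (p ^ (b * △ (l + D))) Eg v) ⟨
          F ^ △ l * G' ^ v                                      ∎
          where
          Ef = E (W ⊛ f ξ (c₀ + a) ↑ △ (l + D))
          Eg = E (W ⊛ f η (c₀ + b) ↑ △ (l + D))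
          exps : ∀ a b x v n → (a * x + b * v) * n ≡ a * n * x + b * n * v
          exps = solve-∀
          interpolated : m ^ △ (l + D) ≤ Ef ^ △ l * Eg ^ v
          interpolated = subst (λ n → m ^ n ≤ E (W ⊛ f ξ (c₀ + a) ↑ n) ^ △ l * E (W ⊛ f η (c₀ + b) ↑ n) ^ v) (sym (△-+ l D))
            (interpolation W (f ξ (c₀ + a)) (f η (c₀ + b)) (△ l) v)

    k≤K : ∀ {x y z w} → x ≤ k → y ≤ k → z ≤ k → w ≤ k → x * (y * (z * w)) ≤ K
    k≤K x≤k y≤k z≤k w≤k = ≤-trans (*-mono-≤ x≤k (*-mono-≤ y≤k (*-mono-≤ z≤k w≤k))) (≤-reflexive (lemma k))
      where
      lemma : ∀ k → k * (k * (k * k)) ≡ k * (k * (k * (k * 1)))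
      lemma = solve-∀

    -- The recursion passes from t to (m + 1) t / m. One factor k! of t makes this integral and
    -- leaves (k!)^n for the remaining rounds; the bound t' ≤ 2 t controls the growth.
    next-scale : ∀ n m {t τ} → 1 ≤ m → m ≤ k → t ≡ (k !) ^ suc n * τ →
      ∃[ t' ] ∃[ τ' ] m * t' ≡ suc m * t × t' ≡ (k !) ^ n * τ' × t ≤ t' × t' ≤ 2 * t
    next-scale n m@(suc m') {t} {τ} _ m≤k refl with ℕ.∣-trans (ℕ.m∣m*n {m} (m' !)) (ℕ.m≤n⇒m!∣n! m≤k)
    ... | ℕ.divides c k!≡ = t' , suc m * c * τ , mt' , e₂ m c ((k !) ^ n) τ ,
      *-cancelˡ-≤ m (≤-trans (m≤n+m (m * t) t) (≤-reflexive (sym mt'))) ,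
      *-cancelˡ-≤ m (≤-trans (≤-reflexive mt') (≤-trans (+-monoˡ-≤ (m * t) (m≤m+n t (m' * t))) (≤-reflexive (e₃ m t))))
      where
      t' = suc m * (c * (k !) ^ n * τ)
      e₁ : ∀ m c x τ → m * (suc m * (c * x * τ)) ≡ suc m * (c * m * x * τ)
      e₁ = solve-∀
      e₂ : ∀ m c x τ → suc m * (c * x * τ) ≡ x * (suc m * c * τ)
      e₂ = solve-∀
      e₃ : ∀ m t → m * t + m * t ≡ m * (2 * t)
      e₃ = solve-∀
      mt' : m * t' ≡ suc m * t
      mt' = trans (e₁ m c ((k !) ^ n) τ) (cong (λ x → suc m * (x * (k !) ^ n * τ)) (sym k!≡))

    private
      -- The linear relation behind the induction: the gains l(k−l) form a fixed vector of the recursion, and the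
      -- correction k⁴(k−1−l) makes the inequality strict.
      gain-identity : ∀ R n K l D t H c c' →
        let L = suc l ; Δ = suc D in
        suc Δ * (R * ((suc n * (L * Δ) + K * D) * (L * t)))
          + ((c' + (H + (c + n * c') + R * (K * (Δ * L) * (suc Δ * t))))
            + (c' + (H + (c + n * c') + R * (K * (l * suc Δ) * (L * t)))) * Δ)
          + R * t * (K * (l * suc Δ + L))
        ≡ R * ((n * (Δ * L) + K * l) * (suc Δ * t)) + R * ((n * (l * suc Δ) + K * Δ) * (L * t)) * Δ
          + suc Δ * (H + (c + suc n * c') + R * (K * (L * Δ) * (L * t)))
          + R * t * (suc Δ * (L * (L * Δ)))
      gain-identity = solve-∀

      -- For L = 1 the second moment in Hölder's inequality has degree 0. In place of a recursive
      -- gain it brings the saving `R * (K * suc Δ * t)` extracted from `bound`.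
      gain-identity-1 : ∀ R n K D t H c c' →
        let Δ = suc D in
        suc Δ * (R * ((suc n * (1 * Δ) + K * D) * (1 * t)))
          + ((c' + (H + (c + n * c') + R * (K * (Δ * 1) * (suc Δ * t)))) + (H + c) * Δ)
          + R * t * (K * suc Δ) + (n * c' + c') * Δ
        ≡ R * ((n * (Δ * 1) + K * 0) * (suc Δ * t)) + R * (K * suc Δ * t) * Δ
          + suc Δ * (H + (c + suc n * c') + R * (K * (1 * Δ) * (1 * t)))
          + R * t * (suc Δ * (1 * (1 * Δ)))
      gain-identity-1 = solve-∀

      -- `K * g` is the slack created by the correction and `G` the price of raising n by one. What
      -- is left between them, at least one `K`, covers the refinement errors.
      absorb : ∀ {lhs rhs err R t K g G} → lhs + R * t * (K * g) ≤ rhs + R * t * G →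
               err ≤ R * t * K → G + K ≤ K * g → lhs + err ≤ rhs
      absorb {lhs} {rhs} {err} {R} {t} {K} {g} {G} identity err≤ G+K≤Kg = +-cancelʳ-≤ (R * t * G) (lhs + err) rhs (begin
        lhs + err + R * t * G              ≤⟨ +-monoˡ-≤ (R * t * G) (+-monoʳ-≤ lhs err≤) ⟩
        lhs + R * t * K + R * t * G        ≡⟨ lemma lhs (R * t) K G ⟩
        lhs + R * t * (G + K)              ≤⟨ +-monoʳ-≤ lhs (*-monoʳ-≤ (R * t) G+K≤Kg) ⟩
        lhs + R * t * (K * g)              ≤⟨ identity ⟩
        rhs + R * t * G                    ∎)
        where
        open ≤-Reasoning
        lemma : ∀ a r K G → a + r * K + r * G ≡ a + r * (G + K)
        lemma = solve-∀

    module _ {W ξ₀ c₀ h Z} (valid : Valid k (k * h) W ξ₀ c₀) (bound : Normalised k q e C W ξ₀ c₀ h Z) where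

      private
        Y = X W c₀ q

        refine-then : ∀ {A B} l D {ξ η} a a' b → suc l + suc D ≡ k → Class ξ₀ c₀ ξ → Class ξ₀ c₀ η → Separated c₀ ξ η →
          1 ≤ a → a ≤ a' → suc l * a' ≤ suc (suc D) * b → suc (suc D) * b ≤ k * h →
          (∀ {ξ'} → Class ξ₀ c₀ ξ' → Separated c₀ ξ' η → p ^ A * Y (suc l) (suc D) ξ' a' η b ≤ p ^ B * Z) →
          p ^ A * Y (suc l) (suc D) ξ a η b ≤ p ^ (2 * a' + C' + B) * Z
        refine-then {A} {B} l D {ξ} {η} a a' b l+D≡k ξ∈ η∈ sep 1≤a a≤a' la'≤ Db≤ next
          with j , refl ← m≤n⇒∃[o]m+o≡n a≤a'
          with ξ' , ξ'∈ , Y≤ ← refinable l D l+D≡k b a j valid ξ∈ η∈ sep 1≤a la'≤ Db≤ = begin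
            p ^ A * Y (suc l) (suc D) ξ a η b                       ≤⟨ *-monoʳ-≤ (p ^ A) Y≤ ⟩
            p ^ A * (p ^ c * Y (suc l) (suc D) ξ' (a + j) η b)      ≡⟨ lemma (p ^ A) (p ^ c) _ ⟩
            p ^ c * (p ^ A * Y (suc l) (suc D) ξ' (a + j) η b)      ≤⟨ *-monoʳ-≤ (p ^ c) (next (Class-trans {m = a} ξ∈ ξ'∈) (Separated-subclass {ξ = ξ} 1≤a ξ'∈ sep)) ⟩
            p ^ c * (p ^ B * Z)                                     ≡⟨ p^-+-* c B Z ⟨
            p ^ (c + B) * Z                                         ∎
          where
          open ≤-Reasoning
          c = 2 * (a + j) + C'
          lemma : ∀ x y z → x * (y * z) ≡ y * (x * z)
          lemma = solve-∀

      -- Write L = `suc l`, Δ = `suc D`. At a = (Δ + 1) t and b = L t the class of ξ is as deep as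
      -- refinement permits, L a = (Δ + 1) b. The term R k⁴ L Δ b on the right is itself fixed by
      -- the recursion and pays for the correction at n = 0; the net gain is positive once n exceeds
      -- k⁴.
      claim : ∀ n l D {t τ ξ η} → suc l + suc D ≡ k → t ≡ (k !) ^ n * τ → 1 ≤ t → k * (2 ^ n * t) ≤ h →
        Class ξ₀ c₀ ξ → Class ξ₀ c₀ η → Separated c₀ ξ η →
        p ^ (R * ((n * (suc l * suc D) + K * D) * (suc l * t))) * Y (suc l) (suc D) ξ (suc (suc D) * t) η (suc l * t) ≤
        p ^ (e * h + (C + n * C') + R * (K * (suc l * suc D) * (suc l * t))) * Z
      claim zero l D {t} {τ} {ξ} {η} l+D≡k t≡ 1≤t kt≤h ξ∈ η∈ sep = p^-shift {0} {e * h + C} {R * (K * D * (suc l * t))} {e * h + (C + 0) + R * (K * (suc l * suc D) * (suc l * t))}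
        (≤-trans (≤-reflexive (+-identityʳ _)) (base valid bound (suc l) (suc D) (suc (suc D) * t) (suc l * t) l+D≡k ξ∈ η∈
          (≤-trans (*-monoˡ-≤ t 2+D≤k) kt≤h') (≤-trans (*-monoˡ-≤ t 1+l≤k) kt≤h')))
        (≤-trans (≤-reflexive (trans (+-comm (R * (K * D * (suc l * t))) _) (cong (λ x → e * h + x + R * (K * D * (suc l * t))) (sym (+-identityʳ C)))))
          (+-monoʳ-≤ (e * h + (C + 0)) (*-monoʳ-≤ R (*-monoˡ-≤ (suc l * t) (*-monoʳ-≤ K (≤-trans (n≤1+n D) (m≤n*m (suc D) (suc l))))))))
        where
        kt≤h' : k * t ≤ h
        kt≤h' = ≤-trans (≤-reflexive (cong (k *_) (sym (+-identityʳ t)))) kt≤h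
        1+l≤k : suc l ≤ k
        1+l≤k = ≤-trans (m≤m+n (suc l) (suc D)) (≤-reflexive l+D≡k)
        2+D≤k : suc (suc D) ≤ k
        2+D≤k = ≤-trans (s≤s (m≤n+m (suc D) l)) (≤-reflexive l+D≡k)
      claim (suc n) l D {t} {τ} {ξ} {η} l+D≡k t≡ 1≤t kt≤h ξ∈ η∈ sep
        with t' , τ' , Δt'≡ , t'≡ , t≤t' , t'≤2t ← next-scale n (suc D) {t} {τ} (s≤s z≤n) (≤-trans (m≤n+m (suc D) (suc l)) (≤-reflexive l+D≡k)) t≡ = go l l+D≡k
        where
        Δ = suc D
        open ≤-Reasoning
        D+l≡k : ∀ {l} → suc l + suc D ≡ k → suc D + suc l ≡ k
        D+l≡k {l} l+D≡k = trans (+-comm (suc D) (suc l)) l+D≡k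
        kt≤h' : k * t ≤ h
        kt≤h' = ≤-trans (*-monoʳ-≤ k (m≤n*m t (2 ^ suc n) {{m^n≢0 2 (suc n)}})) kt≤h
        fits : ∀ {t'} → t' ≤ 2 * t → k * (2 ^ n * t') ≤ h
        fits {t'} t'≤2t = ≤-trans (*-monoʳ-≤ k (≤-trans (*-monoʳ-≤ (2 ^ n) t'≤2t) (≤-reflexive (lemma (2 ^ n) t)))) kt≤h
          where
          lemma : ∀ x t → x * (2 * t) ≡ 2 * x * t
          lemma = solve-∀
        2+D≤k : ∀ l → suc l + suc D ≡ k → suc (suc D) ≤ k
        2+D≤k l l+D≡k = ≤-trans (s≤s (m≤n+m (suc D) l)) (≤-reflexive l+D≡k)
        2+l≤k : ∀ {l} → suc l + suc D ≡ k → suc (suc l) ≤ k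
        2+l≤k {l} l+D≡k = ≤-trans (s≤s (m≤m+n (suc l) D)) (≤-reflexive (trans (cong suc (sym (+-suc l D))) l+D≡k))
        1≤K : 1 ≤ K
        1≤K = 1≤⇒1≤^ 1≤k 4

        -- The exchanged moment is put into the form of the claim: η is refined from L t to (L + 1)
        -- t', where Δ t' = (Δ + 1) t, which is again the deepest level permitted.
        swapped : ∀ l → suc l + suc D ≡ k →
          p ^ (R * ((n * (Δ * suc l) + K * l) * (suc Δ * t))) * Y Δ (suc l) η (suc l * t) ξ (suc Δ * t) ≤
          p ^ (2 * (suc (suc l) * t') + C' + (e * h + (C + n * C') + R * (K * (Δ * suc l) * (suc Δ * t)))) * Z
        swapped l l+D≡k = refine-then {R * ((n * (Δ * suc l) + K * l) * (suc Δ * t))} {e * h + (C + n * C') + R * (K * (Δ * suc l) * (suc Δ * t))} D l (suc l * t) (suc (suc l) * t') (suc Δ * t) (D+l≡k l+D≡k) η∈ ξ∈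
          (Separated-sym {ξ = ξ} sep) (≤-trans 1≤t (m≤n*m t (suc l))) (*-mono-≤ (n≤1+n (suc l)) t≤t')
          (≤-reflexive (trans (lemma Δ (suc (suc l)) t') (cong (suc (suc l) *_) Δt'≡)))
          (*-mono-≤ (2+l≤k l+D≡k) (≤-trans (*-monoˡ-≤ t (2+D≤k l l+D≡k)) kt≤h'))
          λ {ξ'} ξ'∈ sep' → subst (λ b → p ^ (R * ((n * (Δ * suc l) + K * l) * b)) * Y Δ (suc l) ξ' (suc (suc l) * t') ξ b ≤
              p ^ (e * h + (C + n * C') + R * (K * (Δ * suc l) * b)) * Z) Δt'≡
            (claim n D l {t'} {τ'} (D+l≡k l+D≡k) t'≡ (≤-trans 1≤t t≤t') (fits t'≤2t) ξ'∈ ξ∈ sep')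
          where
          lemma : ∀ x y z → x * (y * z) ≡ y * (x * z)
          lemma = solve-∀

        go : ∀ l → suc l + suc D ≡ k →
          p ^ (R * ((suc n * (suc l * Δ) + K * D) * (suc l * t))) * Y (suc l) Δ ξ (suc Δ * t) η (suc l * t) ≤
          p ^ (e * h + (C + suc n * C') + R * (K * (suc l * Δ) * (suc l * t))) * Z
        go zero 1+Δ≡k = p^-root {A₁} {B₁} {A₂} {2 * (2 * t') + C' + B₂} {A₃} {B₃} {Y 1 Δ ξ (suc Δ * t) η (1 * t)} {Y Δ 1 η (1 * t) ξ (suc Δ * t)} {Y 0 (suc Δ) ξ (suc Δ * t) η (1 * t)} {Z} Δ (X-hölder W c₀ q 0 Δ ξ (suc Δ * t) η (1 * t)) (swapped 0 1+Δ≡k) last (begin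
            suc Δ * A₁ + ((2 * (2 * t') + C' + B₂) + B₃ * Δ)       ≡⟨ lemma₁ (suc Δ * A₁) (2 * (2 * t')) C' B₂ (B₃ * Δ) ⟩
            (suc Δ * A₁ + ((C' + B₂) + B₃ * Δ)) + 2 * (2 * t')     ≤⟨ absorb {suc Δ * A₁ + ((C' + B₂) + B₃ * Δ)} {A₂ + A₃ * Δ + suc Δ * B₁} {2 * (2 * t')} {R} {t} {K} {suc Δ} {suc Δ * (1 * (1 * Δ))} identity err≤ G+K≤ ⟩
            A₂ + A₃ * Δ + suc Δ * B₁                               ∎)
          where
          A₁ = R * ((suc n * (1 * Δ) + K * D) * (1 * t))
          B₁ = e * h + (C + suc n * C') + R * (K * (1 * Δ) * (1 * t))
          A₂ = R * ((n * (Δ * 1) + K * 0) * (suc Δ * t))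
          B₂ = e * h + (C + n * C') + R * (K * (Δ * 1) * (suc Δ * t))
          A₃ = R * (K * suc Δ * t)
          B₃ = e * h + C
          lemma₁ : ∀ a x c b y → a + ((x + c + b) + y) ≡ (a + ((c + b) + y)) + x
          lemma₁ = solve-∀
          t≤h : t ≤ h
          t≤h = ≤-trans (m≤n*m t k) kt≤h'
          -- In degree 0 only the moment near η is left, and `bound` starts it at level t. The
          -- saving e t ≥ R k⁵ t is the source of every gain.
          last : p ^ A₃ * Y 0 (suc Δ) ξ (suc Δ * t) η (1 * t) ≤ p ^ B₃ * Z
          last = p^-shift {0} {e * (h ∸ t) + C} {A₃} {B₃}
            (≤-trans (≤-reflexive (trans (+-identityʳ _) (cong (_^ q) (cong₂ _*_ (cong (p ^_) weight≡) (E-cong measure≡)))))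
              (bound η t (h ∸ t) η∈ (m+[n∸m]≡n t≤h)))
            (begin
              R * (K * suc Δ * t) + (e * (h ∸ t) + C)    ≡⟨ cong (_+ (e * (h ∸ t) + C)) (trans (sym (*-assoc R (K * suc Δ) t)) (cong (λ x → R * (K * x) * t) 1+Δ≡k)) ⟩
              R * (K * k) * t + (e * (h ∸ t) + C)        ≤⟨ +-monoˡ-≤ _ (*-monoˡ-≤ t e-large) ⟩
              e * t + (e * (h ∸ t) + C)                  ≡⟨ trans (sym (+-assoc (e * t) _ C)) (cong (_+ C) (trans (sym (*-distribˡ-+ e t (h ∸ t))) (cong (e *_) (m+[n∸m]≡n t≤h)))) ⟩
              e * h + C                                  ∎)
            where
            weight≡ : suc Δ * t * 0 + 1 * t * (△ (suc Δ) + 0) ≡ t * △ k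
            weight≡ = trans (lemma (suc Δ) t (△ (suc Δ))) (cong (λ x → t * △ x) 1+Δ≡k)
              where
              lemma : ∀ x t v → x * t * 0 + 1 * t * (v + 0) ≡ t * v
              lemma = solve-∀
            measure≡ : W ⊛ (f ξ (c₀ + suc Δ * t) ↑ 0 ⊛ f η (c₀ + 1 * t) ↑ (△ (suc Δ) + 0)) ≈ W ⊛ f η (c₀ + t) ↑ △ k
            measure≡ = 𝕄.trans (⊛-congˡ W (𝕄.*-identityˡ (f η (c₀ + 1 * t) ↑ (△ (suc Δ) + 0))))
              (𝕄.reflexive (cong₂ (λ m r → W ⊛ f η (c₀ + m) ↑ r) (*-identityˡ t) (trans (+-identityʳ (△ (suc Δ))) (cong △ 1+Δ≡k))))
          identity : suc Δ * A₁ + ((C' + B₂) + B₃ * Δ) + R * t * (K * suc Δ) ≤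
                     A₂ + A₃ * Δ + suc Δ * B₁ + R * t * (suc Δ * (1 * (1 * Δ)))
          identity = ≤-trans (m≤m+n _ ((n * C' + C') * Δ)) (≤-reflexive (gain-identity-1 R n K D t (e * h) C C'))
          err≤ : 2 * (2 * t') ≤ R * t * K
          err≤ = begin
            2 * (2 * t')            ≤⟨ *-monoʳ-≤ 2 (*-monoʳ-≤ 2 t'≤2t) ⟩
            2 * (2 * (2 * t))       ≡⟨ lemma t ⟩
            8 * t * 1               ≤⟨ *-mono-≤ (*-monoˡ-≤ t 8≤R) 1≤K ⟩
            R * t * K               ∎
            where
            lemma : ∀ t → 2 * (2 * (2 * t)) ≡ 8 * t * 1
            lemma = solve-∀
          G+K≤ : suc Δ * (1 * (1 * Δ)) + K ≤ K * suc Δ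
          G+K≤ = begin
            suc Δ * (1 * (1 * Δ)) + K     ≤⟨ +-monoˡ-≤ K (k≤K (2+D≤k 0 1+Δ≡k) 1≤k 1≤k (≤-trans (n≤1+n Δ) (2+D≤k 0 1+Δ≡k))) ⟩
            K + K                         ≤⟨ +-monoʳ-≤ K (m≤m*n K Δ) ⟩
            K + K * Δ                     ≡⟨ *-suc K Δ ⟨
            K * suc Δ                     ∎
        go (suc l) l+D≡k
          with t'' , τ'' , lt''≡ , t''≡ , t≤t'' , t''≤2t ← next-scale n (suc l) {t} {τ} (s≤s z≤n) (≤-trans (n≤1+n (suc l)) (≤-trans (n≤1+n _) (2+l≤k l+D≡k))) t≡ =
          p^-root {A₁} {B₁} {A₂} {r₁ + C' + B₂} {A₃} {r₂ + C' + B₃} {Y L Δ ξ (suc Δ * t) η (L * t)} {Y Δ L η (L * t) ξ (suc Δ * t)} {Y (suc l) (suc Δ) ξ (suc Δ * t) η (L * t)} {Z} Δ (X-hölder W c₀ q (suc l) Δ ξ (suc Δ * t) η (suc (suc l) * t)) (swapped (suc l) l+D≡k) last (begin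
            suc Δ * A₁ + ((r₁ + C' + B₂) + (r₂ + C' + B₃) * Δ)                 ≡⟨ lemma₁ (suc Δ * A₁) r₁ C' B₂ r₂ B₃ Δ ⟩
            (suc Δ * A₁ + ((C' + B₂) + (C' + B₃) * Δ)) + (r₁ + r₂ * Δ)         ≤⟨ absorb {suc Δ * A₁ + ((C' + B₂) + (C' + B₃) * Δ)} {A₂ + A₃ * Δ + suc Δ * B₁} {r₁ + r₂ * Δ} {R} {t} {K} {suc l * suc Δ + L} {suc Δ * (L * (L * Δ))} identity err≤ G+K≤ ⟩
            A₂ + A₃ * Δ + suc Δ * B₁                                           ∎)
          where
          L = suc (suc l)
          A₁ = R * ((suc n * (L * Δ) + K * D) * (L * t))
          B₁ = e * h + (C + suc n * C') + R * (K * (L * Δ) * (L * t))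
          A₂ = R * ((n * (Δ * L) + K * suc l) * (suc Δ * t))
          B₂ = e * h + (C + n * C') + R * (K * (Δ * L) * (suc Δ * t))
          A₃ = R * ((n * (suc l * suc Δ) + K * Δ) * (L * t))
          B₃ = e * h + (C + n * C') + R * (K * (suc l * suc Δ) * (L * t))
          r₁ = 2 * (suc L * t')
          r₂ = 2 * (suc (suc Δ) * t'')
          lemma₁ : ∀ a r c b r' b' d → a + ((r + c + b) + (r' + c + b') * d) ≡ (a + ((c + b) + (c + b') * d)) + (r + r' * d)
          lemma₁ = solve-∀
          l+Δ≡k : suc l + suc Δ ≡ k
          l+Δ≡k = trans (cong suc (+-suc l Δ)) l+D≡k
          3+D≤k : suc (suc Δ) ≤ k
          3+D≤k = ≤-trans (s≤s (m≤n+m (suc Δ) l)) (≤-reflexive l+Δ≡k)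
          -- The moment of degree L - 1 reaches the form of the claim by refining ξ from (Δ + 1) t
          -- to (Δ + 2) t'', where (L - 1) t'' = L t.
          last : p ^ A₃ * Y (suc l) (suc Δ) ξ (suc Δ * t) η (L * t) ≤ p ^ (r₂ + C' + B₃) * Z
          last = refine-then {A₃} {B₃} l Δ (suc Δ * t) (suc (suc Δ) * t'') (L * t) l+Δ≡k ξ∈ η∈ sep
            (≤-trans 1≤t (m≤n*m t (suc Δ))) (*-mono-≤ (n≤1+n (suc Δ)) t≤t'')
            (≤-reflexive (trans (lemma (suc l) (suc (suc Δ)) t'') (cong (suc (suc Δ) *_) lt''≡)))
            (*-mono-≤ 3+D≤k (≤-trans (*-monoˡ-≤ t (≤-trans (n≤1+n L) (2+l≤k l+D≡k))) kt≤h'))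
            λ {ξ'} ξ'∈ sep' → subst (λ b → p ^ (R * ((n * (suc l * suc Δ) + K * Δ) * b)) * Y (suc l) (suc Δ) ξ' (suc (suc Δ) * t'') η b ≤
                p ^ (e * h + (C + n * C') + R * (K * (suc l * suc Δ) * b)) * Z) lt''≡
              (claim n l Δ {t''} {τ''} l+Δ≡k t''≡ (≤-trans 1≤t t≤t'') (fits t''≤2t) ξ'∈ η∈ sep')
            where
            lemma : ∀ x y z → x * (y * z) ≡ y * (x * z)
            lemma = solve-∀
          identity : suc Δ * A₁ + ((C' + B₂) + (C' + B₃) * Δ) + R * t * (K * (suc l * suc Δ + L)) ≤
                     A₂ + A₃ * Δ + suc Δ * B₁ + R * t * (suc Δ * (L * (L * Δ)))
          identity = ≤-reflexive (gain-identity R n K (suc l) D t (e * h) C C')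
          L≤k : L ≤ k
          L≤k = ≤-trans (n≤1+n L) (2+l≤k l+D≡k)
          Δ≤k : Δ ≤ k
          Δ≤k = ≤-trans (n≤1+n Δ) (2+D≤k (suc l) l+D≡k)
          err≤ : r₁ + r₂ * Δ ≤ R * t * K
          err≤ = begin
            2 * (suc L * t') + 2 * (suc (suc Δ) * t'') * Δ       ≤⟨ +-mono-≤ (*-monoʳ-≤ 2 (*-mono-≤ (2+l≤k l+D≡k) t'≤2t)) (*-mono-≤ (*-monoʳ-≤ 2 (*-mono-≤ 3+D≤k t''≤2t)) Δ≤k) ⟩
            2 * (k * (2 * t)) + 2 * (k * (2 * t)) * k            ≡⟨ lemma₂ k t ⟩
            4 * t * (1 * (1 * (1 * k))) + 4 * t * (1 * (1 * (k * k)))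
                                                                 ≤⟨ +-mono-≤ (*-monoʳ-≤ (4 * t) (k≤K 1≤k 1≤k 1≤k ≤-refl)) (*-monoʳ-≤ (4 * t) (k≤K 1≤k 1≤k ≤-refl ≤-refl)) ⟩
            4 * t * K + 4 * t * K                                ≡⟨ lemma₃ t K ⟩
            8 * t * K                                            ≤⟨ *-monoˡ-≤ K (*-monoˡ-≤ t 8≤R) ⟩
            R * t * K                                            ∎
            where
            lemma₂ : ∀ k t → 2 * (k * (2 * t)) + 2 * (k * (2 * t)) * k ≡ 4 * t * (1 * (1 * (1 * k))) + 4 * t * (1 * (1 * (k * k)))
            lemma₂ = solve-∀
            lemma₃ : ∀ t K → 4 * t * K + 4 * t * K ≡ 8 * t * K
            lemma₃ = solve-∀
          G+K≤ : suc Δ * (L * (L * Δ)) + K ≤ K * (suc l * suc Δ + L)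
          G+K≤ = begin
            suc Δ * (L * (L * Δ)) + K           ≤⟨ +-monoˡ-≤ K (k≤K (2+D≤k (suc l) l+D≡k) L≤k L≤k Δ≤k) ⟩
            K + K                               ≡⟨ lemma₂ K ⟩
            K * 2                               ≤⟨ *-monoʳ-≤ K (≤-trans (s≤s (s≤s z≤n)) (m≤n+m L (suc l * suc Δ))) ⟩
            K * (suc l * suc Δ + L)             ∎
            where
            lemma₂ : ∀ K → K + K ≡ K * 2
            lemma₂ = solve-∀

  -- Elementary operations on decoupling bounds.

  Dec-trivial : ∀ k h q {B} → h * △ k * q ≤ B → Dec k h q B
  Dec-trivial k h q {B} hUq≤B W ξ c _ = let ζ , ζ∈ , E≤ = trivial-decoupling W ξ c h (△ k) in
    ζ , ζ∈ , p^-≤-* _ (≤-trans (≤-reflexive (lemma (h * △ k) q)) (+-monoˡ-≤ (h * △ k * q) hUq≤B)) (p^-power {2 * (h * △ k)} q E≤)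
    where
    lemma : ∀ x q → 2 * x * q ≡ x * q + x * q
    lemma = solve-∀

  Dec-weaken : ∀ {k h q B B'} → B ≤ B' → Dec k h q B → Dec k h q B'
  Dec-weaken {k} {h} {q} B≤B' dec W ξ c valid = let ζ , ζ∈ , E≤ = dec W ξ c valid in
    ζ , ζ∈ , p^-≤-* _ (+-monoˡ-≤ (h * △ k * q) B≤B') E≤

  Dec-root : ∀ {k h q} T {B B'} → 1 ≤ T → B ≤ B' * T → Dec k h (T * q) B → Dec k h q B'
  Dec-root {k} {h} {q} (suc T) {B} {B'} _ B≤B'T dec W ξ c valid with ζ , ζ∈ , E≤ ← dec W ξ c valid =
    ζ , ζ∈ , ^-cancelʳ-≤ T (begin
      (x ^ q) ^ suc T                                              ≡⟨ trans (^-*-assoc x q (suc T)) (cong (x ^_) (*-comm q (suc T))) ⟩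
      x ^ (suc T * q)                                              ≤⟨ E≤ ⟩
      p ^ (B + h * △ k * (suc T * q)) * y ^ (suc T * q)            ≤⟨ *-monoˡ-≤ _ (^-monoʳ-≤ p (≤-trans (+-monoˡ-≤ _ B≤B'T) (≤-reflexive (lemma B' (suc T) (h * △ k) q)))) ⟩
      p ^ ((B' + h * △ k * q) * suc T) * y ^ (suc T * q)           ≡⟨ cong₂ _*_ (^-*-assoc p (B' + h * △ k * q) (suc T)) (trans (^-*-assoc y q (suc T)) (cong (y ^_) (*-comm q (suc T)))) ⟨
      (p ^ (B' + h * △ k * q)) ^ suc T * (y ^ q) ^ suc T           ≡⟨ *-^-comm (p ^ (B' + h * △ k * q)) (y ^ q) (suc T) ⟨
      (p ^ (B' + h * △ k * q) * y ^ q) ^ suc T                     ∎)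
    where
    open ≤-Reasoning
    x = E (W ⊛ f ξ c ↑ △ k)
    y = E (W ⊛ f ζ (c + h) ↑ △ k)
    lemma : ∀ B T x q → B * T + x * (T * q) ≡ (B + x * q) * T
    lemma = solve-∀

  -- The maximum over the listed representatives bounds every ζ, since ζ shares its subclass with
  -- one of them.
  largest-subclass : ∀ W r ξ c h → ∃[ ζ* ] Class ξ c ζ* ×
    (∀ {ζ} → Class ξ c ζ → E (W ⊛ f ζ (c + h) ↑ r) ≤ E (W ⊛ f ζ* (c + h) ↑ r))
  largest-subclass W r ξ c h with i , _ , max ← argmax (λ i → E (W ⊛ f (subclass ξ c i) (c + h) ↑ r)) (p ^ h) =
    subclass ξ c i , subclass-∈ ξ c i , below
    where
    ↑-mono : ∀ {A B} n → A ≼ B → A ↑ n ≼ B ↑ n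
    ↑-mono zero    A≼B = ≼-refl
    ↑-mono (suc n) A≼B = ⊛-mono A≼B (↑-mono n A≼B)
    below : ∀ {ζ} → Class ξ c ζ → E (W ⊛ f ζ (c + h) ↑ r) ≤ E (W ⊛ f (subclass ξ c i) (c + h) ↑ r)
    below {ζ} ζ∈ = let j , j<q , ζ∈j = covering-index {ξ} {c} {ζ} h ζ∈ in ≤-trans
      (E-mono (⊛-mono (≼-refl {W}) (↑-mono r (f-mono {ζ} {c + h} {subclass ξ c j} {c + h} λ x x∈ → same ζ∈j x∈)))) (max j (<⇒≤ j<q))
      where
      same : ∀ {n ξ ζ x} → Class ξ n ζ → Class ζ n x → Class ξ n x
      same {n} ζ∈ x∈ = Class-trans {m = 0} ζ∈ (subst (λ m → Class _ m _) (sym (+-identityʳ n)) x∈)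

  private
    k*h+a*k≡k*[a+h] : ∀ k a h → k * h + a * k ≡ k * (a + h)
    k*h+a*k≡k*[a+h] = solve-∀

  -- The inequality at scale h' below a class of level c₀ + a ends at level c₀ + h, whatever a is.
  -- Multiplied by the sharp factor of the first a levels it is therefore compared with one and the
  -- same maximum.
  Normalised-Dec : ∀ k q e C {W ξ₀ c₀ h} ζ* → (∀ h → Dec k h q (e * h + C)) → Valid k (k * h) W ξ₀ c₀ →
    (∀ {ζ} → Class ξ₀ c₀ ζ → E (W ⊛ f ζ (c₀ + h) ↑ △ k) ≤ E (W ⊛ f ζ* (c₀ + h) ↑ △ k)) →
    Normalised k q e C W ξ₀ c₀ h (p ^ (h * △ k * q) * E (W ⊛ f ζ* (c₀ + h) ↑ △ k) ^ q)
  Normalised-Dec k q e C {W} {ξ₀} {c₀} ζ* dec valid max ξ a h' ξ∈ refl =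
    conclude (dec h' W ξ (c₀ + a) (Valid-subclass {a = a} (≤-reflexive (k*h+a*k≡k*[a+h] k a h')) ξ∈ valid))
    where
    open ≤-Reasoning
    x = E (W ⊛ f ξ (c₀ + a) ↑ △ k)
    y : ℤ → ℕ
    y ζ = E (W ⊛ f ζ (c₀ + a + h') ↑ △ k)
    z = E (W ⊛ f ζ* (c₀ + (a + h')) ↑ △ k)
    y≤z : ∀ {ζ} → Class ξ (c₀ + a) ζ → y ζ ≤ z
    y≤z {ζ} ζ∈ = ≤-trans (≤-reflexive (cong (λ n → E (W ⊛ f ζ n ↑ △ k)) (+-assoc c₀ a h'))) (max (Class-trans {m = a} ξ∈ ζ∈))
    l₂ : ∀ a h' x q b → a * x * q + (b + h' * x * q) ≡ b + (a + h') * x * q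
    l₂ = solve-∀
    conclude : ∃[ ζ ] Class ξ (c₀ + a) ζ × x ^ q ≤ p ^ (e * h' + C + h' * △ k * q) * y ζ ^ q →
      (p ^ (a * △ k) * x) ^ q ≤ p ^ (e * h' + C) * (p ^ ((a + h') * △ k * q) * z ^ q)
    conclude (ζ , ζ∈ , E≤) = begin
      (p ^ (a * △ k) * x) ^ q                                              ≡⟨ trans (*-^-comm (p ^ (a * △ k)) x q) (cong (_* x ^ q) (^-*-assoc p (a * △ k) q)) ⟩
      p ^ (a * △ k * q) * x ^ q                                            ≤⟨ *-monoʳ-≤ (p ^ (a * △ k * q)) E≤ ⟩
      p ^ (a * △ k * q) * (p ^ (e * h' + C + h' * △ k * q) * y ζ ^ q)        ≤⟨ *-monoʳ-≤ (p ^ (a * △ k * q)) (*-monoʳ-≤ (p ^ (e * h' + C + h' * △ k * q)) (^-monoˡ-≤ q (y≤z ζ∈))) ⟩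
      p ^ (a * △ k * q) * (p ^ (e * h' + C + h' * △ k * q) * z ^ q)        ≡⟨ p^-+-* (a * △ k * q) _ _ ⟨
      p ^ (a * △ k * q + (e * h' + C + h' * △ k * q)) * z ^ q              ≡⟨ cong (λ n → p ^ n * z ^ q) (l₂ a h' (△ k) q (e * h' + C)) ⟩
      p ^ (e * h' + C + (a + h') * △ k * q) * z ^ q                        ≡⟨ p^-+-* (e * h' + C) _ _ ⟩
      p ^ (e * h' + C) * (p ^ ((a + h') * △ k * q) * z ^ q)                ∎

  private
    chain : ∀ W A A' B B' r x y s w → E (W ⊛ B ⊛ A) ≤ p ^ x * E (W ⊛ B ⊛ A') → E (W ⊛ A' ⊛ B) ≤ p ^ y * E (W ⊛ A' ⊛ B') →
      r + x + y ≡ s + w → p ^ r * E (W ⊛ (A ⊛ B)) ≤ p ^ s * (p ^ w * E (W ⊛ (A' ⊛ B')))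
    chain W A A' B B' r x y s w E≤₁ E≤₂ exps = begin
      p ^ r * E (W ⊛ (A ⊛ B))                  ≡⟨ cong (p ^ r *_) (E-cong swap) ⟩
      p ^ r * E (W ⊛ B ⊛ A)                    ≤⟨ *-monoʳ-≤ (p ^ r) E≤₁ ⟩
      p ^ r * (p ^ x * E (W ⊛ B ⊛ A'))         ≡⟨ p^-+-* r x _ ⟨
      p ^ (r + x) * E (W ⊛ B ⊛ A')             ≡⟨ cong (p ^ (r + x) *_) (E-cong swap₂) ⟩
      p ^ (r + x) * E (W ⊛ A' ⊛ B)             ≤⟨ *-monoʳ-≤ (p ^ (r + x)) E≤₂ ⟩
      p ^ (r + x) * (p ^ y * E (W ⊛ A' ⊛ B'))  ≡⟨ p^-+-* (r + x) y _ ⟨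
      p ^ (r + x + y) * E (W ⊛ A' ⊛ B')        ≡⟨ cong₂ (λ n z → p ^ n * z) exps (E-cong (𝕄.*-assoc W A' B')) ⟩
      p ^ (s + w) * E (W ⊛ (A' ⊛ B'))          ≡⟨ p^-+-* s w _ ⟩
      p ^ s * (p ^ w * E (W ⊛ (A' ⊛ B')))      ∎
      where
      open ≤-Reasoning
      swap : W ⊛ (A ⊛ B) ≈ W ⊛ B ⊛ A
      swap = prove 3 (var 0F :∙ (var 1F :∙ var 2F)) ((var 0F :∙ var 2F) :∙ var 1F) (W ∷ A ∷ B ∷ [])
      swap₂ : W ⊛ B ⊛ A' ≈ W ⊛ A' ⊛ B
      swap₂ = prove 3 ((var 0F :∙ var 2F) :∙ var 1F) ((var 0F :∙ var 1F) :∙ var 2F) (W ∷ A' ∷ B ∷ [])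

    descend-by : ∀ W ξ c a r → ∃[ ξ' ] Class ξ (c + 1) ξ' ×
      E (W ⊛ f ξ (c + 1) ↑ r) ≤ p ^ (2 * (a * r)) * E (W ⊛ f ξ' (c + suc a) ↑ r)
    descend-by W ξ c a r = let ξ' , ξ'∈ , E≤ = trivial-decoupling W ξ (c + 1) a r in ξ' , ξ'∈ ,
      subst (λ m → E (W ⊛ f ξ (c + 1) ↑ r) ≤ p ^ (2 * (a * r)) * E (W ⊛ f ξ' m ↑ r)) (+-assoc c 1 a) E≤

  -- Moves both classes from the first level to those where the recursion starts. Half of the
  -- trivial loss is absorbed by the weight, the other half is the factor on the right.
  mixed-trivial : ∀ W c q l D ξ η i j → ∃[ ξ' ] ∃[ η' ] Class ξ (c + 1) ξ' × Class η (c + 1) η' ×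
    (p ^ (△ l + (△ D + l * D)) * mixed W c q l D ξ 1 η 1) ^ q ≤
    p ^ ((j * △ l + i * (△ D + l * D)) * q) * X W c q l D ξ' (suc j) η' (suc i)
  mixed-trivial W c q l D ξ η i j =
    let ξ' , ξ'∈ , E≤₁ = descend-by (W ⊛ f η (c + 1) ↑ (△ D + l * D)) ξ c j (△ l)
        η' , η'∈ , E≤₂ = descend-by (W ⊛ f ξ' (c + suc j) ↑ △ l) η c i (△ D + l * D)
    in ξ' , η' , ξ'∈ , η'∈ , (begin
      (p ^ (△ l + v) * mixed W c q l D ξ 1 η 1) ^ q                  ≤⟨ ^-monoˡ-≤ q (chain W _ _ _ _ (△ l + v) (2 * (j * △ l)) (2 * (i * v)) S w E≤₁ E≤₂ (exps i j (△ l) v)) ⟩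
      (p ^ S * (p ^ w * mixed W c q l D ξ' (suc j) η' (suc i))) ^ q  ≡⟨ trans (*-^-comm (p ^ S) _ q) (cong (_* X W c q l D ξ' (suc j) η' (suc i)) (^-*-assoc p S q)) ⟩
      p ^ (S * q) * X W c q l D ξ' (suc j) η' (suc i)                ∎)
    where
    open ≤-Reasoning
    v = △ D + l * D
    S = j * △ l + i * v
    w = weight W c q l D (suc j) (suc i)
    exps : ∀ i j a v → a + v + 2 * (j * a) + 2 * (i * v) ≡ (j * a + i * v) + (suc j * a + suc i * v)
    exps = solve-∀

  -- Lowering the decoupling exponent by one.

  module Step
    (k k₂ d C' n R : ℕ) (2+k₂≡k : suc (suc k₂) ≡ k) (n≡ : n ≡ suc (k ^ 4 + d * (k + suc (△ (suc k₂) + 1 * suc k₂))))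
    (R≡ : R ≡ (k !) ^ n * (k * 2 ^ n) * 8) (8≤R : 8 ≤ R) (k<p : k < p) (8≤p : 8 ≤ p)
    where

    private
      D = suc k₂
      K = k ^ 4
      v = △ D + 1 * D
      -- Chosen so that the excess of the trivial passage to scale t is at most L t q.
      L = k + suc v
      N = k₂ + △ D
      κ = 3 + 3 * suc N + 2 * N
      q = R * d

      1≤k : 1 ≤ k
      1≤k = ≤-trans (s≤s z≤n) (≤-reflexive 2+k₂≡k)

      instance
        k-nonZero : NonZero k
        k-nonZero = >-nonZero 1≤k
        k!ⁿ-nonZero : NonZero ((k !) ^ n)
        k!ⁿ-nonZero = m^n≢0 (k !) n {{k !≢0}}
        2ⁿ-nonZero : NonZero (2 ^ n)
        2ⁿ-nonZero = m^n≢0 2 n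
        R-nonZero : NonZero R
        R-nonZero = >-nonZero (≤-trans (s≤s z≤n) 8≤R)

    scale : ℕ
    scale = R * (K * k)

    module _ (refinable : ∀ l D → suc l + suc D ≡ k → Refinable k q C' (suc l) (suc D)) (1≤d : 1 ≤ d) (e C : ℕ)
             (e-large : scale ≤ suc e) (dec : ∀ h → Dec k h q (suc e * h + C)) where

      -- The summands pay for the broad constant p^κ, the n rounds of the recursion, the remainder
      -- of h modulo `R`, and all scales below `R`.
      C* : ℕ
      C* = κ * q + (C + n * C') + R + R * △ k * q

      private
        instance
          q-nonZero : NonZero q
          q-nonZero = m*n≢0 R d {{R-nonZero}} {{>-nonZero 1≤d}}

        broad-at : ∀ {W ξ₀ c h Z ξ η} τ i j → suc i ≡ (k !) ^ n * τ → suc j ≡ suc D * ((k !) ^ n * τ) →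
          k * (2 ^ n * ((k !) ^ n * τ)) ≤ h → h ≤ R + R * ((k !) ^ n * τ) →
          Valid k (k * h) W ξ₀ c → Normalised k q (suc e) C W ξ₀ c h Z →
          Class ξ₀ c ξ → Class ξ₀ c η → Separated c ξ η →
          p ^ h * (p ^ (1 + v) * mixed W c q 1 D ξ 1 η 1) ^ q ≤ p ^ (suc e * h + (C + n * C') + R) * Z
        broad-at {W} {ξ₀} {c} {h} {Z} {ξ} {η} τ i j 1+i≡t 1+j≡kt fits h≤ valid bound ξ∈ η∈ sep
          = let ξ' , η' , ξ'∈ , η'∈ , mixed≤ = mixed-trivial W c q 1 D ξ η i j in p^-shift {A} {S * q + B} {h} {suc e * h + (C + n * C') + R} (begin
            p ^ A * (p ^ (1 + v) * mixed W c q 1 D ξ 1 η 1) ^ q                    ≤⟨ *-monoʳ-≤ (p ^ A) mixed≤ ⟩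
            p ^ A * (p ^ (S * q) * X W c q 1 D ξ' (suc j) η' (suc i))              ≡⟨ lemma (p ^ A) (p ^ (S * q)) _ ⟩
            p ^ (S * q) * (p ^ A * X W c q 1 D ξ' (suc j) η' (suc i))              ≡⟨ cong₂ (λ a b → p ^ (S * q) * (p ^ A * X W c q 1 D ξ' a η' b)) 1+j≡kt (trans 1+i≡t (sym (*-identityˡ t))) ⟩
            p ^ (S * q) * (p ^ A * X W c q 1 D ξ' (suc D * t) η' (1 * t))              ≤⟨ *-monoʳ-≤ (p ^ (S * q)) (Claim.claim k q R (suc e) C C' 1≤k 8≤R e-large refinable valid bound n 0 k₂ {t} {τ} 2+k₂≡k refl (≤-trans (s≤s z≤n) (≤-reflexive 1+i≡t)) fits (Class-trans {m = 1} ξ∈ ξ'∈) (Class-trans {m = 1} η∈ η'∈)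
                (Separated-subclass {a = 1} {ξ = ξ} ≤-refl ξ'∈ (Separated-sym {ξ = η'} (Separated-subclass {a = 1} {ξ = η} ≤-refl η'∈ (Separated-sym {ξ = ξ} sep))))) ⟩
            p ^ (S * q) * (p ^ B * Z)                                              ≡⟨ p^-+-* (S * q) B Z ⟨
            p ^ (S * q + B) * Z                                                    ∎) exponents
          where
          open ≤-Reasoning
          t = (k !) ^ n * τ
          S = j * 1 + i * v
          A = R * ((n * (1 * D) + K * k₂) * (1 * t))
          B = suc e * h + (C + n * C') + R * (K * (1 * D) * (1 * t))
          lemma : ∀ x y z → x * (y * z) ≡ y * (x * z)
          lemma = solve-∀
          S≤Lt : S ≤ L * t
          S≤Lt = begin
            j * 1 + i * v         ≤⟨ +-mono-≤ (≤-trans (≤-trans (≤-reflexive (*-identityʳ j)) (n≤1+n j)) (≤-reflexive (trans 1+j≡kt (cong (_* t) 2+k₂≡k)))) (*-mono-≤ (≤-trans (n≤1+n i) (≤-reflexive 1+i≡t)) (n≤1+n v)) ⟩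
            k * t + t * suc v     ≡⟨ cong (λ x → k * t + x) (*-comm t (suc v)) ⟩
            k * t + suc v * t     ≡⟨ *-distribʳ-+ t k (suc v) ⟨
            L * t                 ∎
          -- This determines n: of the rounds, k⁴ offset the last term of `B`, d L pay for the
          -- trivial passage, and one more yields R t, which together with `R` covers h.
          identity : ∀ R K d L k₂ t b →
            R + R * t + (L * t * (R * d) + (b + R * (K * (1 * suc k₂) * (1 * t)))) + R * t * (k₂ + d * L * k₂ + K * k₂)
            ≡ R * ((suc (K + d * L) * (1 * suc k₂) + K * k₂) * (1 * t)) + (b + R)
          identity = solve-∀
          n-large : R * ((suc (K + d * L) * (1 * D) + K * k₂) * (1 * t)) ≡ A
          n-large = cong (λ n → R * ((n * (1 * D) + K * k₂) * (1 * t))) (sym n≡)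
          exponents : h + (S * q + B) ≤ A + (suc e * h + (C + n * C') + R)
          exponents = begin
            h + (S * q + B)                               ≤⟨ +-mono-≤ h≤ (+-monoˡ-≤ B (*-monoˡ-≤ q S≤Lt)) ⟩
            R + R * t + (L * t * q + B)                   ≤⟨ m≤m+n _ (R * t * (k₂ + d * L * k₂ + K * k₂)) ⟩
            R + R * t + (L * t * q + B) + R * t * (k₂ + d * L * k₂ + K * k₂)
                                                          ≡⟨ trans (identity R K d L k₂ t (suc e * h + (C + n * C'))) (cong (_+ (suc e * h + (C + n * C') + R)) n-large) ⟩
            A + (suc e * h + (C + n * C') + R)            ∎

        broad : ∀ {W ξ₀ c h Z ξ η} → R ≤ h → Valid k (k * h) W ξ₀ c → Normalised k q (suc e) C W ξ₀ c h Z →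
          Class ξ₀ c ξ → Class ξ₀ c η → Separated c ξ η →
          p ^ h * (p ^ (1 + v) * mixed W c q 1 D ξ 1 η 1) ^ q ≤ p ^ (suc e * h + (C + n * C') + R) * Z
        broad {h = h} R≤h = broad-at τ (t ∸ 1) (suc D * t ∸ 1) (m+[n∸m]≡n 1≤t) (m+[n∸m]≡n (≤-trans 1≤t (m≤n*m t (suc D)))) fits h≤
          where
          open ≤-Reasoning
          -- The factor (k!)^n in t serves n applications of `next-scale`. Dividing by `R` keeps k
          -- 2^n t below h, so that n doublings fit; the factor 8 in `R` is for the refinement
          -- errors.
          τ = h / R
          t = (k !) ^ n * τ
          1≤t : 1 ≤ t
          1≤t = *-mono-≤ (>-nonZero⁻¹ ((k !) ^ n)) (m≥n⇒m/n>0 R≤h)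
          fits : k * (2 ^ n * t) ≤ h
          fits = begin
            k * (2 ^ n * t)                               ≤⟨ m≤n*m (k * (2 ^ n * t)) 8 ⟩
            8 * (k * (2 ^ n * ((k !) ^ n * τ)))           ≡⟨ trans (lemma k (2 ^ n) ((k !) ^ n) τ) (cong (τ *_) (sym R≡)) ⟩
            τ * R                                         ≤⟨ m/n*n≤m h R ⟩
            h                                             ∎
            where
            lemma : ∀ k x y τ → 8 * (k * (x * (y * τ))) ≡ τ * (y * (k * x) * 8)
            lemma = solve-∀
          h≤ : h ≤ R + R * t
          h≤ = begin
            h                     ≡⟨ m≡m%n+[m/n]*n h R ⟩
            h % R + τ * R         ≤⟨ +-mono-≤ (<⇒≤ (m%n<n h R)) (≤-trans (≤-reflexive (*-comm τ R)) (*-monoʳ-≤ R (m≤n*m τ ((k !) ^ n)))) ⟩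
            R + R * t             ∎

        v≡1+N : v ≡ suc N
        v≡1+N = lemma (△ D) k₂
          where
          lemma : ∀ x k → x + (suc k + 0) ≡ suc (k + x)
          lemma = solve-∀

        uk≡2+N : △ k ≡ suc (suc N)
        uk≡2+N = cong △ (sym 2+k₂≡k)

        -- The narrow case recurs at every level, so its price must be the sharp p^(△ k) without a
        -- further constant. Only p² of it is spent on the classes; 8 ≤ p lets the remaining p^N
        -- absorb the powers of 2.
        narrow-numeric : ∀ V → 2 * (p ^ 1 * p ^ 1 * (2 ^ suc N * V)) ≤ p ^ △ k * V
        narrow-numeric V = begin
          2 * (p ^ 1 * p ^ 1 * (2 ^ suc N * V))            ≡⟨ lemma (p ^ 1) (2 ^ (k₂ + (k₂ + △ k₂))) V (cong (2 ^_) (+-suc k₂ (k₂ + △ k₂))) ⟩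
          p ^ 1 * p ^ 1 * (8 * 2 ^ (k₂ + (k₂ + △ k₂))) * V ≤⟨ *-monoˡ-≤ V (*-monoʳ-≤ (p ^ 1 * p ^ 1) (*-mono-≤ 8≤p (^-monoˡ-≤ (k₂ + (k₂ + △ k₂)) (≤-trans (s≤s (s≤s z≤n)) 8≤p)))) ⟩
          p ^ 1 * p ^ 1 * p ^ suc (k₂ + (k₂ + △ k₂)) * V   ≡⟨ cong (_* V) (trans (cong (λ n → p ^ 1 * p ^ 1 * p ^ n) (sym (+-suc k₂ (k₂ + △ k₂)))) (trans (cong (_* p ^ N) (sym (^-distribˡ-+-* p 1 1))) (sym (^-distribˡ-+-* p 2 N)))) ⟩
          p ^ (2 + N) * V                                  ≡⟨ cong (λ n → p ^ n * V) uk≡2+N ⟨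
          p ^ △ k * V                                      ∎
          where
          open ≤-Reasoning
          l : ∀ P x V → 2 * (P * P * (2 * (2 * x) * V)) ≡ P * P * (8 * x) * V
          l = solve-∀
          lemma : ∀ P x V {y} → y ≡ 2 * x → 2 * (P * P * (2 * y * V)) ≡ P * P * (8 * x) * V
          lemma P x V refl = l P x V

        -- The broad case ends the induction on the scale, so that a fixed power p^κ is affordable.
        broad-numeric : ∀ β → 2 * (p ^ 1 * p ^ 1 * ((4 * (p ^ 1 * p ^ 1)) ^ suc N * ((p ^ 1 * p ^ 1) ^ N * β))) ≤ p ^ κ * β
        broad-numeric β = begin
          2 * (p ^ 1 * p ^ 1 * ((4 * (p ^ 1 * p ^ 1)) ^ suc N * ((p ^ 1 * p ^ 1) ^ N * β)))
            ≡⟨ cong (λ x → 2 * (x * ((4 * x) ^ suc N * (x ^ N * β)))) (^-distribˡ-+-* p 1 1) ⟨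
          2 * (p ^ 2 * ((4 * p ^ 2) ^ suc N * ((p ^ 2) ^ N * β)))
            ≤⟨ *-mono-≤ (≤-trans (s≤s (s≤s z≤n)) 8≤p) (*-monoʳ-≤ (p ^ 2) (*-monoˡ-≤ ((p ^ 2) ^ N * β) (^-monoˡ-≤ (suc N) (*-monoˡ-≤ (p ^ 2) (≤-trans (s≤s (s≤s (s≤s (s≤s z≤n)))) 8≤p))))) ⟩
          p * (p ^ 2 * ((p ^ 3) ^ suc N * ((p ^ 2) ^ N * β)))
            ≡⟨ *-assoc p (p ^ 2) _ ⟨
          p ^ 3 * ((p ^ 3) ^ suc N * ((p ^ 2) ^ N * β))
            ≡⟨ cong₂ (λ x y → p ^ 3 * (x * (y * β))) (^-*-assoc p 3 (suc N)) (^-*-assoc p 2 N) ⟩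
          p ^ 3 * (p ^ (3 * suc N) * (p ^ (2 * N) * β))
            ≡⟨ cong (p ^ 3 *_) (p^-+-* (3 * suc N) (2 * N) β) ⟨
          p ^ 3 * (p ^ (3 * suc N + 2 * N) * β)
            ≡⟨ p^-+-* 3 (3 * suc N + 2 * N) β ⟨
          p ^ (3 + (3 * suc N + 2 * N)) * β
            ≡⟨ cong (λ n → p ^ n * β) (sym (+-assoc 3 (3 * suc N) (2 * N))) ⟩
          p ^ κ * β ∎
          where open ≤-Reasoning

      private
        module Advance (h₁ : ℕ) (R≤h : R ≤ suc h₁) (IH : Dec k h₁ q (e * h₁ + C*))
                       (W : Measure) (ξ : ℤ) (c : ℕ) (valid : Valid k (k * suc h₁) W ξ c) where

          h = suc h₁
          F = f ξ c
          n' = p ^ 1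

          G : ℕ → Measure
          G i = f (subclass ξ c i) (c + 1)

          -- Zero on the diagonal, so that a maximum over all pairs is one over distinct classes.
          pair : ℕ → ℕ → ℕ
          pair i j with i ≟ j
          ... | yes _ = 0
          ... | no  _ = E (W ⊛ (G i ⊛ G j ↑ suc N))

          pair-≢ : ∀ {i j} → i ≢ j → pair i j ≡ E (W ⊛ (G i ⊛ G j ↑ suc N))
          pair-≢ {i} {j} i≢j with i ≟ j
          ... | yes i≡j = contradiction i≡j i≢j
          ... | no  _   = refl

          goal : ℤ → Set
          goal ζ = Class ξ c ζ × E (W ⊛ F ↑ △ k) ^ q ≤ p ^ (e * h + C* + h * △ k * q) * E (W ⊛ f ζ (c + h) ↑ △ k) ^ q

          -- One level at the sharp price; the remaining levels are left to the induction on the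
          -- scale.
          narrow-case : ∀ i → E (W ⊛ F ↑ △ k) ≤ p ^ △ k * E (W ⊛ G i ↑ △ k) → ∃[ ζ ] goal ζ
          narrow-case i E≤ = conclude
            (IH W (subclass ξ c i) (c + 1) (Valid-subclass {a = 1} (≤-reflexive (k*h+a*k≡k*[a+h] k 1 h₁)) (subclass-∈ ξ c i) valid))
            where
            x = E (W ⊛ F ↑ △ k)
            y = E (W ⊛ G i ↑ △ k)
            z : ℤ → ℕ → ℕ
            z ζ m = E (W ⊛ f ζ m ↑ △ k)
            exponents : △ k * q + (e * h₁ + C* + h₁ * △ k * q) ≤ e * h + C* + h * △ k * q
            exponents = begin
              △ k * q + (e * h₁ + C* + h₁ * △ k * q)     ≡⟨ lemma (△ k) q (e * h₁ + C*) h₁ ⟩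
              e * h₁ + C* + h * △ k * q                  ≤⟨ +-monoˡ-≤ (h * △ k * q) (+-monoˡ-≤ C* (*-monoʳ-≤ e (n≤1+n h₁))) ⟩
              e * h + C* + h * △ k * q                   ∎
              where
              open ≤-Reasoning
              lemma : ∀ x q b h → x * q + (b + h * x * q) ≡ b + suc h * x * q
              lemma = solve-∀
            conclude : ∃[ ζ ] Class (subclass ξ c i) (c + 1) ζ × y ^ q ≤ p ^ (e * h₁ + C* + h₁ * △ k * q) * z ζ (c + 1 + h₁) ^ q →
              ∃[ ζ ] goal ζ
            conclude (ζ , ζ∈ , y≤) = ζ , Class-trans {m = 1} (subclass-∈ ξ c i) ζ∈ ,
              subst (λ m → x ^ q ≤ p ^ (e * h + C* + h * △ k * q) * z ζ m ^ q) (+-assoc c 1 h₁)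
                (p^-≤-* (z ζ (c + 1 + h₁) ^ q) exponents
                  (p^-trans {△ k * q} {e * h₁ + C* + h₁ * △ k * q} (p^-power {△ k} q E≤) y≤))

          subclasses-separated : ∀ {i j} → i < p ^ 1 → j < p ^ 1 → i ≢ j → Separated c (subclass ξ c i) (subclass ξ c j)
          subclasses-separated {i} {j} i<p j<p i≢j P∣ with <-cmp i j
          ... | tri< i<j _ _ = Separated-sym {c} {subclass ξ c j} {subclass ξ c i}
                (λ P∣' → subclass-distinct 1 ξ c i<j j<p (subst (λ n → P n ∣ subclass ξ c j ℤ.- subclass ξ c i) (+-comm 1 c) P∣')) P∣
          ... | tri≈ _ i≡j _ = i≢j i≡j
          ... | tri> _ _ j<i = subclass-distinct 1 ξ c j<i i<p (subst (λ n → P n ∣ subclass ξ c i ℤ.- subclass ξ c j) (+-comm 1 c) P∣)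

          -- All h levels are treated at once: the bound with exponent e + 1 enters the recursion,
          -- which returns the missing p^h.
          broad-case : ∀ i j → i < p ^ 1 → j < p ^ 1 → E (W ⊛ F ↑ △ k) ≤ p ^ κ * pair i j → ∃[ ζ ] goal ζ
          broad-case i j i<p j<p E≤ =
            let ζ* , ζ*∈ , max = largest-subclass W (△ k) ξ c h
            in ζ* , ζ*∈ , finish (Normalised-Dec k q (suc e) C ζ* dec valid max)
            where
            open ≤-Reasoning
            pair-bound : ∀ {Z} → Normalised k q (suc e) C W ξ c h Z → p ^ h * pair i j ^ q ≤ p ^ (suc e * h + (C + n * C') + R) * Z
            pair-bound {Z} bound with i ≟ j
            ... | yes _ = ≤-trans (≤-reflexive (trans (cong (p ^ h *_) (0^q q)) (*-zeroʳ (p ^ h)))) z≤n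
              where
              0^q : ∀ q .{{_ : NonZero q}} → 0 ^ q ≡ 0
              0^q (suc q) = refl
            ... | no i≢j = begin
              p ^ h * E (W ⊛ (G i ⊛ G j ↑ suc N)) ^ q           ≤⟨ *-monoʳ-≤ (p ^ h) (^-monoˡ-≤ q (≤-trans (≤-reflexive (E-cong (⊛-congˡ W mixed≈))) (m≤n*m _ (p ^ (1 + v)) {{p^-nonZero (1 + v)}}))) ⟩
              p ^ h * (p ^ (1 + v) * mixed W c q 1 D (subclass ξ c i) 1 (subclass ξ c j) 1) ^ q
                                                                ≤⟨ broad R≤h valid bound (subclass-∈ ξ c i) (subclass-∈ ξ c j) (subclasses-separated i<p j<p i≢j) ⟩
              p ^ (suc e * h + (C + n * C') + R) * Z            ∎
              where
              mixed≈ : G i ⊛ G j ↑ suc N ≈ G i ↑ 1 ⊛ G j ↑ v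
              mixed≈ = 𝕄.*-cong (𝕄.sym (𝕄.*-identityʳ (G i))) (𝕄.reflexive (cong (G j ↑_) (sym v≡1+N)))
            finish : ∀ {M} → Normalised k q (suc e) C W ξ c h (p ^ (h * △ k * q) * M) →
              E (W ⊛ F ↑ △ k) ^ q ≤ p ^ (e * h + C* + h * △ k * q) * M
            finish {M} bound = begin
              x ^ q                                                  ≡⟨ *-identityˡ (x ^ q) ⟨
              p ^ 0 * x ^ q                                          ≤⟨ p^-shift {h} {κ * q + (suc e * h + (C + n * C') + R)} {0} {e * h + C*} powered (≤-trans (≤-reflexive (lemma κ q e h (C + n * C') R)) (+-monoʳ-≤ h (+-monoʳ-≤ (e * h) (m≤m+n _ (R * △ k * q))))) ⟩
              p ^ (e * h + C*) * (p ^ (h * △ k * q) * M)             ≡⟨ p^-+-* (e * h + C*) (h * △ k * q) M ⟨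
              p ^ (e * h + C* + h * △ k * q) * M                     ∎
              where
              x = E (W ⊛ F ↑ △ k)
              lemma : ∀ κ q e h c R → κ * q + (suc e * h + c + R) ≡ h + (e * h + (κ * q + c + R))
              lemma = solve-∀
              powered : p ^ h * x ^ q ≤ p ^ (κ * q + (suc e * h + (C + n * C') + R)) * (p ^ (h * △ k * q) * M)
              powered = begin
                p ^ h * x ^ q                                        ≤⟨ *-monoʳ-≤ (p ^ h) (p^-power {κ} q E≤) ⟩
                p ^ h * (p ^ (κ * q) * pair i j ^ q)                 ≡⟨ l (p ^ h) (p ^ (κ * q)) (pair i j ^ q) ⟩
                p ^ (κ * q) * (p ^ h * pair i j ^ q)                 ≤⟨ *-monoʳ-≤ (p ^ (κ * q)) (pair-bound bound) ⟩
                p ^ (κ * q) * (p ^ (suc e * h + (C + n * C') + R) * (p ^ (h * △ k * q) * M))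
                                                                     ≡⟨ p^-+-* (κ * q) _ _ ⟨
                p ^ (κ * q + (suc e * h + (C + n * C') + R)) * (p ^ (h * △ k * q) * M) ∎
                where
                l : ∀ x y z → x * (y * z) ≡ y * (x * z)
                l = solve-∀

          <p⇒≤ : ∀ {i} → i < p ^ 1 → i ≤ p ^ 1 ∸ 1
          <p⇒≤ i<p = ∸-monoˡ-≤ 1 i<p

          ≤⇒<p : ∀ {i} → i ≤ p ^ 1 ∸ 1 → i < p ^ 1
          ≤⇒<p i≤ = ≤-trans (s≤s i≤) (≤-reflexive (m+[n∸m]≡n (1≤p^ 1)))

          result : ∃[ ζ ] goal ζ
          result =
            let i , i≤ , imax = argmax (λ i → E (W ⊛ G i ↑ suc (suc N))) (p ^ 1 ∸ 1)
                a , b , a≤ , b≤ , pmax = argmax₂ pair (p ^ 1 ∸ 1)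
            in split i a b (≤⇒<p a≤) (≤⇒<p b≤)
                 (BroadNarrow.broad-narrow W F G n' N {E (W ⊛ G i ↑ suc (suc N))} {pair a b} (1≤p^ 1)
                   (≤-trans (s≤s z≤n) (m≤n+m (△ D) k₂)) (f-covering ξ c 1) (λ j j<p → imax j (<p⇒≤ j<p))
                   λ i j i<p j<p i≢j → ≤-trans (≤-reflexive (sym (pair-≢ i≢j))) (pmax i j (<p⇒≤ i<p) (<p⇒≤ j<p)))
            where
            open ≤-Reasoning
            split : ∀ i a b → a < p ^ 1 → b < p ^ 1 →
              E (W ⊛ F ↑ suc (suc N)) ≤ n' * n' * (2 ^ suc N * E (W ⊛ G i ↑ suc (suc N)) + (4 * (n' * n')) ^ suc N * ((n' * n') ^ N * pair a b)) →
              ∃[ ζ ] goal ζ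
            split i a b a<p b<p E≤ = decide (≤-total X₂ X₁)
              where
              V = E (W ⊛ G i ↑ suc (suc N))
              X₁ = n' * n' * (2 ^ suc N * V)
              X₂ = n' * n' * ((4 * (n' * n')) ^ suc N * ((n' * n') ^ N * pair a b))
              E≤' : E (W ⊛ F ↑ △ k) ≤ X₁ + X₂
              E≤' = ≤-trans (≤-reflexive (cong (λ r → E (W ⊛ F ↑ r)) uk≡2+N)) (≤-trans E≤ (≤-reflexive (*-distribˡ-+ (n' * n') _ _)))
              decide : X₂ ≤ X₁ ⊎ X₁ ≤ X₂ → ∃[ ζ ] goal ζ
              decide (inj₁ X₂≤X₁) = narrow-case i (begin
                E (W ⊛ F ↑ △ k)             ≤⟨ E≤' ⟩
                X₁ + X₂                     ≤⟨ +-monoʳ-≤ X₁ (≤-trans X₂≤X₁ (≤-reflexive (sym (+-identityʳ X₁)))) ⟩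
                2 * X₁                      ≤⟨ narrow-numeric V ⟩
                p ^ △ k * V                 ≡⟨ cong (λ r → p ^ △ k * E (W ⊛ G i ↑ r)) (sym uk≡2+N) ⟩
                p ^ △ k * E (W ⊛ G i ↑ △ k) ∎)
              decide (inj₂ X₁≤X₂) = broad-case a b a<p b<p (begin
                E (W ⊛ F ↑ △ k)             ≤⟨ E≤' ⟩
                X₁ + X₂                     ≤⟨ +-monoˡ-≤ X₂ X₁≤X₂ ⟩
                X₂ + X₂                     ≡⟨ cong (λ x → X₂ + x) (sym (+-identityʳ X₂)) ⟩
                2 * X₂                      ≤⟨ broad-numeric (pair a b) ⟩
                p ^ κ * pair a b            ∎)

      -- Induction on the scale. A dominant single class passes to the scale h - 1, a dominant pair
      -- of classes gains p^h, and scales below `R` are covered by the constant.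
      gain : ∀ h → Dec k h q (e * h + C*)
      gain h with R ≤? h
      gain h       | no  R≰h = Dec-trivial k h q (≤-trans (≤-trans (*-monoˡ-≤ q (*-monoˡ-≤ (△ k) (<⇒≤ (≰⇒> R≰h)))) (m≤n+m _ (κ * q + (C + n * C') + R))) (m≤n+m C* (e * h)))
      gain zero    | yes R≤0 = contradiction (≤-trans 8≤R R≤0) λ ()
      gain (suc h) | yes R≤h = λ W ξ c valid → Advance.result h R≤h (gain h) W ξ c valid

-- Induction on the degree.

module Induction
  (p : ℕ) (p-prime : Prime p)
  {Γ : Set} (_≟Γ_ : DecidableEquality Γ) {_∙_ : Γ → Γ → Γ} {ε : Γ} {_⁻¹ : Γ → Γ}
  (isAbelianGroup : IsAbelianGroup _≡_ _∙_ ε _⁻¹)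
  (γ : ℤ → Γ)
  where

  open Naturals
  open import Data.List using ([])
  open import Data.Product using (_,_; ∃-syntax; proj₁; proj₂)
  open import Data.Sum using (inj₁; inj₂)
  open import Relation.Binary.PropositionalEquality
  import Relation.Nullary as Nullary
  open import Relation.Nullary using (yes; no; contradiction)
  private module D = Decoupling p p-prime _≟Γ_ isAbelianGroup γ

  -- The constant C must not depend on Ω.
  Good : ℕ → Set
  Good k = ∀ d → 1 ≤ d → ∃[ C ] ∀ Ω h → D.Dec Ω k h d (h + C)

  Refinable : (k q C l D : ℕ) → Set
  Refinable k q C l D = ∀ Ω → D.Refinable Ω k q C l D

  Refinable-weaken : ∀ {k q C C' l D} → C ≤ C' → Refinable k q C l D → Refinable k q C' l D
  Refinable-weaken C≤C' refinable Ω b a j valid ξ∈ η∈ sep 1≤a la≤ Db≤ =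
    let ξ' , ξ'∈ , X≤ = refinable Ω b a j valid ξ∈ η∈ sep 1≤a la≤ Db≤
    in ξ' , ξ'∈ , D.p^-≤-* Ω _ (+-monoʳ-≤ (2 * (a + j)) C≤C') X≤

  -- Only finitely many l occur, so their constants may be added.
  Refinable-uniform : ∀ k q → (∀ l D → suc l + suc D ≡ k → ∃[ C ] Refinable k q C (suc l) (suc D)) →
    ∃[ C ] (∀ l D → suc l + suc D ≡ k → Refinable k q C (suc l) (suc D))
  Refinable-uniform k q refinable =
    let C , bound = upto k in C , λ l D l+D≡k → bound l D (≤-trans (m≤m+n (suc l) (suc D)) (≤-reflexive l+D≡k)) l+D≡k
    where
    upto : ∀ m → ∃[ C ] (∀ l D → l < m → suc l + suc D ≡ k → Refinable k q C (suc l) (suc D))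
    upto zero    = 0 , λ l D ()
    upto (suc m) = extend (suc m + suc (k ∸ (2 + m)) ≟ k)
      where
      D≡ : ∀ D → suc m + suc D ≡ k → D ≡ k ∸ (2 + m)
      D≡ D m+D≡k = sym (trans (cong (_∸ (2 + m)) (trans (sym m+D≡k) (cong suc (+-suc m D)))) (m+n∸m≡n (2 + m) D))
      C₀ = proj₁ (upto m)
      bound₀ = proj₂ (upto m)
      extend : Nullary.Dec (suc m + suc (k ∸ (2 + m)) ≡ k) →
        ∃[ C ] (∀ l D → l < suc m → suc l + suc D ≡ k → Refinable k q C (suc l) (suc D))
      extend (no none) = C₀ , bound
        where
        bound : ∀ l D → l < suc m → suc l + suc D ≡ k → Refinable k q C₀ (suc l) (suc D)
        bound l D (s≤s l≤m) l+D≡k with m≤n⇒m<n∨m≡n l≤m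
        ... | inj₁ l<m  = bound₀ l D l<m l+D≡k
        ... | inj₂ refl = contradiction (subst (λ D → suc m + suc D ≡ k) (D≡ D l+D≡k) l+D≡k) none
      extend (yes m+D≡k) = C₀ + C₁ , bound
        where
        C₁ = proj₁ (refinable m (k ∸ (2 + m)) m+D≡k)
        bound : ∀ l D → l < suc m → suc l + suc D ≡ k → Refinable k q (C₀ + C₁) (suc l) (suc D)
        bound l D (s≤s l≤m) l+D≡k with m≤n⇒m<n∨m≡n l≤m
        ... | inj₁ l<m  = Refinable-weaken {k} {q} {C₀} {C₀ + C₁} {suc l} {suc D} (m≤m+n C₀ C₁) (bound₀ l D l<m l+D≡k)
        ... | inj₂ refl = Refinable-weaken {k} {q} {C₁} {C₀ + C₁} {suc m} {suc D} (m≤n+m C₁ C₀)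
          (subst (λ D → Refinable k q C₁ (suc m) (suc D)) (sym (D≡ D l+D≡k)) (proj₂ (refinable m (k ∸ (2 + m)) m+D≡k)))

  Good⇒Refinable : ∀ k q → 1 ≤ q → k < p → (∀ l → 1 ≤ l → l < k → Good l) →
    ∀ l D → suc l + suc D ≡ k → ∃[ C ] Refinable k q C (suc l) (suc D)
  Good⇒Refinable k q 1≤q k<p good l D refl =
    D.refinement-constant [] (suc l) q C ,
    λ Ω {W} {c₀ = c₀} {η = η} b a j valid ξ∈ η∈ sep 1≤a la≤ Db≤ →
      D.Mixed.X-refine Ω W c₀ q {suc l} {suc D} {η = η} b a j C k<p (proj₂ l-good Ω) valid ξ∈ η∈ sep 1≤a la≤ Db≤
    where
    l-good = good (suc l) (s≤s z≤n) (s≤s (m<m+n l (s≤s z≤n))) q 1≤q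
    C = proj₁ l-good

  Good-step : ∀ k₂ → suc (suc k₂) < p → 8 ≤ p → (∀ l → 1 ≤ l → l < suc (suc k₂) → Good l) → Good (suc (suc k₂))
  Good-step k₂ k<p 8≤p good d₀ 1≤d₀ = general (suc (suc k₂)) _ _ refl refl refl k<p good
    where
    general : ∀ k n R → suc (suc k₂) ≡ k →
      n ≡ suc (k ^ 4 + (k ^ 4 * k * d₀) * (k + suc (△ (suc k₂) + 1 * suc k₂))) → R ≡ (k !) ^ n * (k * 2 ^ n) * 8 →
      k < p → (∀ l → 1 ≤ l → l < k → Good l) → ∃[ C ] (∀ Ω h → D.Dec Ω k h d₀ (h + C))
    general k n R 2+k₂≡k n≡ R≡ k<p good = finish (lower (q * △ k) 0 λ Ω h → D.Dec-trivial Ω k h q (≤-reflexive (trans (lemma h (△ k) q) (sym (+-identityʳ _)))))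
      where
      -- The exponent e can be lowered down to T = R k⁵. As q = T d₀, the final loss is p^(h/d₀) up
      -- to a constant.
      d = k ^ 4 * k * d₀
      q = R * d
      T = R * (k ^ 4 * k)
      instance
        k-nonZero : NonZero k
        k-nonZero = >-nonZero (≤-trans (s≤s z≤n) (≤-reflexive 2+k₂≡k))
        k⁵-nonZero : NonZero (k ^ 4 * k)
        k⁵-nonZero = m*n≢0 (k ^ 4) k {{m^n≢0 k 4}}
        d-nonZero : NonZero d
        d-nonZero = m*n≢0 (k ^ 4 * k) d₀ {{k⁵-nonZero}} {{>-nonZero 1≤d₀}}
      8≤R : 8 ≤ R
      8≤R = ≤-trans (m≤n*m 8 ((k !) ^ n * (k * 2 ^ n)) {{m*n≢0 _ _ {{m^n≢0 (k !) n {{k !≢0}}}} {{m*n≢0 k (2 ^ n) {{k-nonZero}} {{m^n≢0 2 n}}}}}}) (≤-reflexive (sym R≡))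
      instance
        R-nonZero : NonZero R
        R-nonZero = >-nonZero (≤-trans (s≤s z≤n) 8≤R)
        q-nonZero : NonZero q
        q-nonZero = m*n≢0 R d
        T-nonZero : NonZero T
        T-nonZero = m*n≢0 R (k ^ 4 * k)
      C' = proj₁ (Refinable-uniform k q (Good⇒Refinable k q (>-nonZero⁻¹ q) k<p good))
      refinable = proj₂ (Refinable-uniform k q (Good⇒Refinable k q (>-nonZero⁻¹ q) k<p good))
      lemma : ∀ h x q → h * x * q ≡ q * x * h
      lemma = solve-∀
      -- Starting from the trivial exponent q △(k), each application of `gain` lowers e by one while
      -- only the constant grows.
      lower : ∀ e C → (∀ Ω h → D.Dec Ω k h q (e * h + C)) → ∃[ C ] (∀ Ω h → D.Dec Ω k h q (T * h + C))
      lower e C dec with e ≤? T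
      lower e       C dec | yes e≤T = C , λ Ω h → D.Dec-weaken Ω {k} {h} {q} (+-monoˡ-≤ C (*-monoˡ-≤ h e≤T)) (dec Ω h)
      lower zero    C dec | no e≰T = contradiction z≤n e≰T
      lower (suc e) C dec | no e≰T =
        lower e
          (D.Step.C* [] k k₂ d C' n R 2+k₂≡k n≡ R≡ 8≤R k<p 8≤p (λ l D eq → refinable l D eq []) (>-nonZero⁻¹ d) e C (<⇒≤ (≰⇒> e≰T)) (dec []))
          λ Ω → D.Step.gain Ω k k₂ d C' n R 2+k₂≡k n≡ R≡ 8≤R k<p 8≤p (λ l D eq → refinable l D eq Ω) (>-nonZero⁻¹ d) e C (<⇒≤ (≰⇒> e≰T)) (dec Ω)
      finish : ∃[ C ] (∀ Ω h → D.Dec Ω k h q (T * h + C)) → ∃[ C ] (∀ Ω h → D.Dec Ω k h d₀ (h + C))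
      finish (C , dec) = C , λ Ω h → D.Dec-root Ω {k} {h} {d₀} T {T * h + C} {h + C} (>-nonZero⁻¹ T)
        (≤-trans (+-monoʳ-≤ (T * h) (m≤m*n C T)) (≤-reflexive (lemma₂ T h C)))
        (subst (λ q → D.Dec Ω k h q (T * h + C)) (sym (*-assoc R (k ^ 4 * k) d₀)) (dec Ω h))
        where
        lemma₂ : ∀ T h C → T * h + C * T ≡ (h + C) * T
        lemma₂ = solve-∀

  all-Good : ∀ k → 8 ≤ p → 1 ≤ k → k < p → Good k
  all-Good k 8≤p = below (suc k) k ≤-refl
    where
    below : ∀ m k → k < m → 1 ≤ k → k < p → Good k
    below (suc m) (suc zero)     _         _ _   = λ d _ → 0 , λ Ω h → D.Dec-1 Ω d h
    below (suc m) (suc (suc k₂)) (s≤s k≤m) _ k<p = Good-step k₂ k<p 8≤p λ l 1≤l l<k →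
      below m l (≤-trans l<k k≤m) 1≤l (<-trans l<k k<p)

-- The moment curve over the integers and the number of solutions.

module Counting (k : ℕ) where

  open Naturals hiding (_≟_)
  open Sums
  open import Data.Fin using (Fin; toℕ)
  open import Data.Fin.Properties using (toℕ<n)
  import Data.Fin as Fin
  open import Data.Integer as ℤ using (+_; ∣_∣; 0ℤ; 1ℤ; -_)
  import Data.Integer.Properties as ℤ
  import Data.Nat.Divisibility as ℕ
  open import Data.Integer.Divisibility.Signed as ℤ using (_∣_)
  import Data.Integer.Tactic.RingSolver as ℤ
  open import Data.List as List using ([]; _∷_; length; filter; map; _++_; cartesianProductWith; applyUpTo)
  open import Data.List.Membership.Propositional using (_∈_)
  open import Data.List.Membership.Propositional.Properties
    using (∈-∃++; ∈-++⁺ˡ; ∈-++⁺ʳ; ∈-++⁻; ∈-filter⁻; ∈-applyUpTo⁻; ∈-cartesianProductWith⁺)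
  import Data.List.Properties as List
  open import Data.List.Relation.Unary.All as All using ([]; _∷_)
  open import Data.List.Relation.Unary.AllPairs using ([]; _∷_)
  open import Data.List.Relation.Unary.Any using (here; there)
  open import Data.List.Relation.Unary.Unique.Propositional using (Unique)
  open import Data.List.Relation.Unary.Unique.Propositional.Properties using (filter⁺; applyUpTo⁺₁)
  open import Data.Product using (_,_; _×_; proj₁; proj₂)
  open import Data.Sum using (inj₁; inj₂)
  open import Data.Vec as Vec using (Vec; []; _∷_; zipWith; replicate; tabulate; lookup)
  import Data.Vec.Properties as Vec
  import Data.Vec.Relation.Unary.All as VecAll
  open import Relation.Binary.PropositionalEquality
  open import Relation.Nullary using (contradiction)

  Γ : Set
  Γ = Vec ℤ k

  infixl 6 _∙_

  _∙_ : Γ → Γ → Γ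
  _∙_ = zipWith ℤ._+_

  ε : Γ
  ε = replicate k 0ℤ

  _⁻¹ : Γ → Γ
  _⁻¹ = Vec.map -_

  _≟Γ_ : DecidableEquality Γ
  _≟Γ_ = Vec.≡-dec ℤ._≟_

  Γ-isAbelianGroup : IsAbelianGroup _≡_ _∙_ ε _⁻¹
  Γ-isAbelianGroup = record
    { isGroup = record
      { isMonoid = record
        { isSemigroup = record
          { isMagma = record { isEquivalence = isEquivalence ; ∙-cong = cong₂ _∙_ }
          ; assoc = Vec.zipWith-assoc ℤ.+-assoc }
        ; identity = Vec.zipWith-identityˡ ℤ.+-identityˡ , Vec.zipWith-identityʳ ℤ.+-identityʳ }
      ; inverse = Vec.zipWith-inverseˡ ℤ.+-inverseˡ , Vec.zipWith-inverseʳ ℤ.+-inverseʳ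
      ; ⁻¹-cong = cong _⁻¹ }
    ; comm = Vec.zipWith-comm ℤ.+-comm }

  γ : ℤ → Γ
  γ x = tabulate λ i → x ℤ.^ suc (toℕ i)

  open Measures _≟Γ_ Γ-isAbelianGroup
  open Kronecker _≟Γ_

  Γ-≡ : ∀ {v w : Γ} → (∀ i → lookup v i ≡ lookup w i) → v ≡ w
  Γ-≡ {v} {w} v≡w = trans (sym (Vec.tabulate∘lookup v)) (trans (Vec.tabulate-cong v≡w) (Vec.tabulate∘lookup w))

  module _ {A : Set} where

    ∑-extract : ∀ (xs ys : List A) x φ → ∑ (xs ++ List.[ x ] ++ ys) φ ≡ φ x + ∑ (xs ++ ys) φ
    ∑-extract xs ys x φ = begin
      ∑ (xs ++ x ∷ ys) φ          ≡⟨ ∑-++ xs (x ∷ ys) φ ⟩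
      ∑ xs φ + (φ x + ∑ ys φ)     ≡⟨ lemma (∑ xs φ) (φ x) (∑ ys φ) ⟩
      φ x + (∑ xs φ + ∑ ys φ)     ≡⟨ cong (φ x ℕ+_) (∑-++ xs ys φ) ⟨
      φ x + ∑ (xs ++ ys) φ        ∎
      where
      open ≡-Reasoning
      _ℕ+_ = _+_
      lemma : ∀ a b c → a + (b + c) ≡ b + (a + c)
      lemma = solve-∀

    length≤∑ : ∀ {xs L : List A} {w} → Unique xs → (∀ {a} → a ∈ xs → a ∈ L × 1 ≤ w a) → length xs ≤ ∑ L w
    length≤∑ []           _   = z≤n
    length≤∑ {x ∷ xs} {L} {w} (x∉xs ∷ xs!) in-L with ∈-∃++ (proj₁ (in-L (here refl)))
    ... | ys , zs , refl = ≤-trans (+-mono-≤ (proj₂ (in-L (here refl))) (length≤∑ xs! rest)) (≤-reflexive (sym (∑-extract ys zs x w)))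
      where
      rest : ∀ {a} → a ∈ xs → a ∈ ys ++ zs × 1 ≤ w a
      rest {a} a∈ with ∈-++⁻ ys (proj₁ (in-L (there a∈)))
      ... | inj₁ a∈ys         = ∈-++⁺ˡ a∈ys , proj₂ (in-L (there a∈))
      ... | inj₂ (here refl)  = contradiction refl (All.lookup x∉xs a∈)
      ... | inj₂ (there a∈zs) = ∈-++⁺ʳ ys a∈zs , proj₂ (in-L (there a∈))

    length≤1 : ∀ {xs : List A} → Unique xs → (∀ {x y} → x ∈ xs → y ∈ xs → x ≡ y) → length xs ≤ 1
    length≤1 []              _     = z≤n
    length≤1 (_ ∷ [])        _     = s≤s z≤n
    length≤1 (x∉ ∷ (_ ∷ _)) all-equal = contradiction (all-equal (here refl) (there (here refl))) (All.lookup x∉ (here refl))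

  tuples : List ℤ → ∀ s → List (Vec ℤ s)
  tuples Ω zero    = List.[ [] ]
  tuples Ω (suc s) = cartesianProductWith _∷_ Ω (tuples Ω s)

  ∈-tuples : ∀ {Ω s} {v : Vec ℤ s} → VecAll.All (_∈ Ω) v → v ∈ tuples Ω s
  ∈-tuples VecAll.[]         = here refl
  ∈-tuples (x∈ VecAll.∷ v∈) = ∈-cartesianProductWith⁺ _∷_ x∈ (∈-tuples v∈)

  moments : ∀ {s} → Vec ℤ s → Γ
  moments []      = ε
  moments (x ∷ v) = γ x ∙ moments v

  lookup-moments : ∀ {s} (v : Vec ℤ s) i → lookup (moments v) i ≡ powerSum (suc (toℕ i)) v
  lookup-moments []      i = Vec.lookup-replicate i 0ℤ
  lookup-moments (x ∷ v) i = trans (Vec.lookup-zipWith ℤ._+_ i (γ x) (moments v))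
    (cong₂ ℤ._+_ (Vec.lookup∘tabulate _ i) (lookup-moments v i))

  ∑-tuples : ∀ Ω s φ → ∑ (map γ Ω ↑ s) φ ≡ ∑ (tuples Ω s) (λ v → φ (moments v))
  ∑-tuples Ω zero    φ = refl
  ∑-tuples Ω (suc s) φ = begin
    ∑ (map γ Ω ⊛ map γ Ω ↑ s) φ                                        ≡⟨ ∑-⊛ (map γ Ω) (map γ Ω ↑ s) φ ⟩
    ∑ (map γ Ω) (λ g → ∑ (map γ Ω ↑ s) (λ h → φ (g ∙ h)))              ≡⟨ ∑-map γ Ω _ ⟩
    ∑ Ω (λ x → ∑ (map γ Ω ↑ s) (λ h → φ (γ x ∙ h)))                    ≡⟨ ∑-cong Ω (λ x → ∑-tuples Ω s _) ⟩
    ∑ Ω (λ x → ∑ (tuples Ω s) (λ v → φ (γ x ∙ moments v)))             ≡⟨ ∑-cartesian _∷_ Ω (tuples Ω s) _ ⟨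
    ∑ (tuples Ω (suc s)) (λ v → φ (moments v))                         ∎
    where open ≡-Reasoning

  solutions≤E : ∀ Ω s (xs : List (Vec ℤ s × Vec ℤ s)) → Unique xs →
    (∀ {v w} → (v , w) ∈ xs → VecAll.All (_∈ Ω) v × VecAll.All (_∈ Ω) w × (∀ j → 1 ≤ j → j ≤ k → powerSum j v ≡ powerSum j w)) →
    length xs ≤ E (map γ Ω ↑ s)
  solutions≤E Ω s xs xs! solution = ≤-trans (length≤∑ xs! located) (≤-reflexive (sym counted))
    where
    pairs = cartesianProductWith _,_ (tuples Ω s) (tuples Ω s)
    located : ∀ {a} → a ∈ xs → a ∈ pairs × 1 ≤ δ (moments (proj₁ a)) (moments (proj₂ a))
    located {v , w} a∈ = let v∈ , w∈ , sums = solution a∈ in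
      ∈-cartesianProductWith⁺ _,_ (∈-tuples v∈) (∈-tuples w∈) ,
      ≤-reflexive (sym (δ-≡ {moments v} {moments w} (Γ-≡ λ i → trans (lookup-moments v i)
        (trans (sums (suc (toℕ i)) (s≤s z≤n) (toℕ<n i)) (sym (lookup-moments w i))))))
    counted : E (map γ Ω ↑ s) ≡ ∑ pairs (λ a → δ (moments (proj₁ a)) (moments (proj₂ a)))
    counted = begin
      E (map γ Ω ↑ s)                                                                    ≡⟨ ⟨⟩-∑ (map γ Ω ↑ s) (map γ Ω ↑ s) ⟩
      ∑ (map γ Ω ↑ s) (λ g → ∑ (map γ Ω ↑ s) (δ g))                                      ≡⟨ ∑-tuples Ω s _ ⟩
      ∑ (tuples Ω s) (λ v → ∑ (map γ Ω ↑ s) (δ (moments v)))                             ≡⟨ ∑-cong (tuples Ω s) (λ v → ∑-tuples Ω s _) ⟩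
      ∑ (tuples Ω s) (λ v → ∑ (tuples Ω s) (λ w → δ (moments v) (moments w)))            ≡⟨ ∑-cartesian _,_ (tuples Ω s) (tuples Ω s) _ ⟨
      ∑ pairs (λ a → δ (moments (proj₁ a)) (moments (proj₂ a)))                          ∎
      where open ≡-Reasoning

  interval : ℕ → List ℤ
  interval n = applyUpTo (λ i → + suc i) n

  module _ (p : ℕ) (p-prime : Prime p) (n : ℕ) where

    open PowerSums p p-prime
    open Decoupling p p-prime _≟Γ_ Γ-isAbelianGroup γ (interval n)

    f-whole : f 0ℤ 0 ≡ map γ (interval n)
    f-whole = cong (map γ) (List.filter-all (class? 0ℤ 0) (All.tabulate λ {x} _ → mkClass (subst (_∣ x ℤ.- 0ℤ) (sym P-0) (1∣ (x ℤ.- 0ℤ)))))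
      where
      1∣ : ∀ z → 1ℤ ∣ z
      1∣ z = ℤ.divides z (sym (ℤ.*-identityʳ z))

    length-f≤1 : ∀ ζ h → n ≤ p ^ h → length (f ζ h) ≤ 1
    length-f≤1 ζ h n≤p^h = ≤-trans (≤-reflexive (List.length-map γ (filter (class? ζ h) (interval n))))
      (length≤1 (filter⁺ (class? ζ h) (applyUpTo⁺₁ (λ i → + suc i) n λ i<j _ eq → <⇒≢ i<j (suc-injective (ℤ.+-injective eq)))) all-equal)
      where
      close : ∀ {i j} → i ≤ j → j < n → P h ∣ + suc j ℤ.- + suc i → i ≡ j
      close {i} {j} i≤j j<n P∣ with m≤n⇒m<n∨m≡n i≤j
      ... | inj₂ i≡j = i≡j
      ... | inj₁ i<j = contradiction (≤-trans n≤p^h (subst₂ _≤_ (∣P∣ h) ∣-∣≡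
            (ℕ.∣⇒≤ {{subst NonZero (sym ∣-∣≡) (>-nonZero (m<n⇒0<n∸m i<j))}} (ℤ.∣⇒∣ᵤ P∣)))) (<⇒≱ (≤-<-trans (m∸n≤m j i) j<n))
        where
        ∣-∣≡ : ∣ + suc j ℤ.- + suc i ∣ ≡ j ∸ i
        ∣-∣≡ = cong ∣_∣ (trans (ℤ.m-n≡m⊖n (suc j) (suc i)) (ℤ.⊖-≥ (s≤s i≤j)))
      difference : ∀ {x y} → Class ζ h x → Class ζ h y → P h ∣ x ℤ.- y
      difference {x} {y} x∈ y∈ = subst (P h ∣_) (lemma x y ζ) (ℤ.∣m∣n⇒∣m-n (∣- x∈) (∣- y∈))
        where
        lemma : ∀ x y ζ → (x ℤ.- ζ) ℤ.- (y ℤ.- ζ) ≡ x ℤ.- y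
        lemma = ℤ.solve-∀
      all-equal : ∀ {x y} → x ∈ filter (class? ζ h) (interval n) → y ∈ filter (class? ζ h) (interval n) → x ≡ y
      all-equal {x} {y} x∈ y∈ with ∈-filter⁻ (class? ζ h) {xs = interval n} x∈ | ∈-filter⁻ (class? ζ h) {xs = interval n} y∈
      ... | x∈I , x∈ζ | y∈I , y∈ζ with ∈-applyUpTo⁻ (λ i → + suc i) x∈I | ∈-applyUpTo⁻ (λ i → + suc i) y∈I
      ... | i , i<n , refl | j , j<n , refl with ≤-total i j
      ... | inj₁ i≤j = cong (λ i → + suc i) (close i≤j j<n (difference y∈ζ x∈ζ))
      ... | inj₂ j≤i = cong (λ i → + suc i) (sym (close j≤i i<n (difference x∈ζ y∈ζ)))

    lookup-∑γ : ∀ xs i → lookup (∑γ xs) i ≡ ∑^ 0ℤ xs (suc (toℕ i))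
    lookup-∑γ []       i = Vec.lookup-replicate i 0ℤ
    lookup-∑γ (x ∷ xs) i = trans (Vec.lookup-zipWith ℤ._+_ i (γ x) (∑γ xs))
      (cong₂ ℤ._+_ (trans (Vec.lookup∘tabulate _ i) (cong (ℤ._^ suc (toℕ i)) (sym (ℤ.+-identityʳ x)))) (lookup-∑γ xs i))

    -- For the unit measure equal moments are equal power sums in every degree up to k, hence
    -- congruences to any modulus.
    whole-Valid : ∀ N → Valid k N List.[ ε ] 0ℤ 0
    whole-Valid N = mkValid λ xs ys → λ { (here refl) (here refl) |xs| |ys| _ _ eq → congruence xs ys (trans |xs| (sym |ys|)) eq }
      where
      module G = IsAbelianGroup Γ-isAbelianGroup
      congruence : ∀ xs ys → length xs ≡ length ys → ∑γ xs ∙ ε ≡ ∑γ ys ∙ ε → Congruent k N 0ℤ 0 xs ys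
      congruence xs ys lengths eq j j≤k = subst (P (N + 0) ∣_) (sym (zero-difference j j≤k)) (P∣0 (N + 0))
        where
        ∑γ≡ : ∑γ xs ≡ ∑γ ys
        ∑γ≡ = trans (sym (G.identityʳ (∑γ xs))) (trans eq (G.identityʳ (∑γ ys)))
        zero-difference : ∀ j → j ≤ k → ∑^-∑^ 0ℤ xs ys j ≡ 0ℤ
        zero-difference zero    _   = ∑^-∑^-0 0ℤ xs ys lengths
        zero-difference (suc j) j<k = subst (λ j → ∑^-∑^ 0ℤ xs ys (suc j) ≡ 0ℤ) (toℕ-fromℕ< j<k)
          (trans (cong (ℤ._- ∑^ 0ℤ ys (suc (toℕ i))) (trans (sym (lookup-∑γ xs i)) (trans (cong (λ v → lookup v i) ∑γ≡) (lookup-∑γ ys i))))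
            (ℤ.+-inverseʳ (∑^ 0ℤ ys (suc (toℕ i)))))
          where
          open import Data.Fin.Properties using (toℕ-fromℕ<)
          i = Fin.fromℕ< j<k

    -- The r surplus variables are estimated trivially. At level h every class contains at most one
    -- integer of the interval, so the decoupled moment is at most 1.
    E-interval≤ : ∀ {q h B} r → n ≤ p ^ h → Dec k h q B →
         E (map γ (interval n) ↑ (r + △ k)) ^ q ≤ (n * n) ^ (r * q) * p ^ (B + h * △ k * q)
    E-interval≤ {q} {h} {B} r n≤p^h dec = begin
      E (A ↑ (r + △ k)) ^ q                                                 ≡⟨ cong (_^ q) (E-cong split) ⟩
      E (List.[ ε ] ⊛ A ↑ △ k ⊛ A ↑ r) ^ q                                  ≤⟨ ^-monoˡ-≤ q (E-⊛-↑-length (List.[ ε ] ⊛ A ↑ △ k) A r) ⟩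
      ((length A * length A) ^ r * E (List.[ ε ] ⊛ A ↑ △ k)) ^ q            ≡⟨ trans (*-^-comm ((length A * length A) ^ r) _ q) (cong₂ _*_ (^-*-assoc (length A * length A) r q) (cong (λ A → E (List.[ ε ] ⊛ A ↑ △ k) ^ q) (sym f-whole))) ⟩
      (length A * length A) ^ (r * q) * E (List.[ ε ] ⊛ f 0ℤ 0 ↑ △ k) ^ q   ≡⟨ cong (λ m → (m * m) ^ (r * q) * E (List.[ ε ] ⊛ f 0ℤ 0 ↑ △ k) ^ q) (trans (List.length-map γ (interval n)) (List.length-applyUpTo (λ i → + suc i) n)) ⟩
      (n * n) ^ (r * q) * E (List.[ ε ] ⊛ f 0ℤ 0 ↑ △ k) ^ q                 ≤⟨ *-monoʳ-≤ ((n * n) ^ (r * q)) decoupled ⟩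
      (n * n) ^ (r * q) * p ^ (B + h * △ k * q)                             ∎
      where
      open ≤-Reasoning
      A = map γ (interval n)
      split : A ↑ (r + △ k) ≈ List.[ ε ] ⊛ A ↑ △ k ⊛ A ↑ r
      split = 𝕄.trans (↑-homo-⊛ A r (△ k)) (𝕄.trans (𝕄.*-comm (A ↑ r) (A ↑ △ k)) (𝕄.sym (⊛-congʳ (A ↑ r) (𝕄.*-identityˡ (A ↑ △ k)))))
      small : ∀ ζ → E (List.[ ε ] ⊛ f ζ h ↑ △ k) ≤ 1
      small ζ = begin
        E (List.[ ε ] ⊛ f ζ h ↑ △ k)                                 ≤⟨ E-⊛-↑-length List.[ ε ] (f ζ h) (△ k) ⟩
        (length (f ζ h) * length (f ζ h)) ^ △ k * E List.[ ε ]       ≤⟨ *-mono-≤ (^-monoˡ-≤ (△ k) (*-mono-≤ (length-f≤1 ζ h n≤p^h) (length-f≤1 ζ h n≤p^h))) (≤-reflexive E-one) ⟩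
        1 ^ △ k * 1                                                  ≡⟨ trans (*-identityʳ (1 ^ △ k)) (^-zeroˡ (△ k)) ⟩
        1                                                            ∎
      decoupled : E (List.[ ε ] ⊛ f 0ℤ 0 ↑ △ k) ^ q ≤ p ^ (B + h * △ k * q)
      decoupled = let ζ , _ , E^q≤ = dec List.[ ε ] 0ℤ 0 (whole-Valid (k * h)) in begin
        E (List.[ ε ] ⊛ f 0ℤ 0 ↑ △ k) ^ q                            ≤⟨ E^q≤ ⟩
        p ^ (B + h * △ k * q) * E (List.[ ε ] ⊛ f ζ h ↑ △ k) ^ q     ≤⟨ *-monoʳ-≤ (p ^ (B + h * △ k * q)) (^-monoˡ-≤ q (small ζ)) ⟩
        p ^ (B + h * △ k * q) * 1 ^ q                                ≡⟨ trans (cong (p ^ (B + h * △ k * q) *_) (^-zeroˡ q)) (*-identityʳ _) ⟩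
        p ^ (B + h * △ k * q)                                        ∎

-- Vinogradov's mean value theorem for integral n.

module MeanValue where

  open Naturals hiding (_≟_)
  open import Data.Integer using (+_)
  open import Data.List as List using ([]; _∷_; length)
  open import Data.Nat.ListAction using (product)
  open import Data.List.Membership.Propositional using (_∈_)
  open import Data.List.Relation.Unary.All using (All; _∷_)
  open import Data.List.Relation.Unary.Unique.Propositional using (Unique)
  open import Data.Nat.Divisibility using (_∣_; ∣-trans; m∣m*n; m≤n⇒m!∣n!; ∣m+n∣m⇒∣n; ∣1⇒≡1)
  open import Data.Nat.Primality using (prime⇒nonZero; ¬prime[1])
  open import Data.Nat.Primality.Factorisation using (factorise; module PrimeFactorisation)
  open import Data.Product using (_,_; _×_; ∃-syntax; proj₁; proj₂)
  open import Data.Vec using (Vec)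
  open import Data.Vec.Relation.Unary.All as Vec using ()
  open import Relation.Binary.PropositionalEquality
  open import Relation.Nullary using (yes; no; contradiction)

  -- Euclid's argument with a prime factor of N! + 1.
  infinitely-many-primes : ∀ N → ∃[ p ] Prime p × N < p
  infinitely-many-primes N = first factors isFactorisation factorsPrime
    where
    open PrimeFactorisation (factorise (suc (N !)))
    first : ∀ ps → suc (N !) ≡ product ps → All Prime ps → ∃[ p ] Prime p × N < p
    first []       1+N!≡1 _ = contradiction (suc-injective 1+N!≡1) λ N!≡0 → <⇒≢ (>-nonZero⁻¹ (N !) {{N !≢0}}) (sym N!≡0)
    first (p ∷ ps) 1+N!≡ (p-prime ∷ _) = p , p-prime , ≰⇒> λ p≤N →
      ¬prime[1] (subst Prime (∣1⇒≡1 (∣m+n∣m⇒∣n (subst (p ∣_) (trans (sym 1+N!≡) (+-comm 1 (N !))) (m∣m*n (product ps))) (p∣N! p p-prime p≤N))) p-prime)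
      where
      p∣N! : ∀ p → Prime p → p ≤ N → p ∣ N !
      p∣N! zero    p-prime _   = contradiction (prime⇒nonZero p-prime) λ ()
      p∣N! (suc p) _       p≤N = ∣-trans (m∣m*n (p !)) (m≤n⇒m!∣n! p≤N)

  -- Replacing n by a power of p costs at most a factor p, which the constant of the mean value
  -- absorbs.
  nearest-power : ∀ p n → 2 ≤ p → 1 ≤ n → ∃[ h ] n ≤ p ^ h × p ^ h ≤ p * n
  nearest-power p (suc zero)    2≤p _ = 0 , ≤-refl , ≤-trans (≤-trans (s≤s z≤n) 2≤p) (≤-reflexive (sym (*-identityʳ p)))
  nearest-power p (suc n@(suc _)) 2≤p _ with nearest-power p n 2≤p (s≤s z≤n)
  ... | h , n≤p^h , p^h≤pn with suc n ≤? p ^ h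
  ...   | yes 1+n≤p^h = h , 1+n≤p^h , ≤-trans p^h≤pn (*-monoʳ-≤ p (n≤1+n n))
  ...   | no  1+n≰p^h = suc h , 1+n≤p^[1+h] , *-monoʳ-≤ p (≤-trans p^h≤n (n≤1+n n))
    where
    open ≤-Reasoning
    p^h≤n : p ^ h ≤ n
    p^h≤n = s≤s⁻¹ (≰⇒> 1+n≰p^h)
    1+n≤p^[1+h] : suc n ≤ p * p ^ h
    1+n≤p^[1+h] = begin
      1 + n              ≤⟨ +-monoˡ-≤ n (s≤s z≤n) ⟩
      n + n              ≡⟨ cong (λ m → n + m) (sym (+-identityʳ n)) ⟩
      2 * n              ≤⟨ *-mono-≤ 2≤p n≤p^h ⟩
      p * p ^ h          ∎

  IsIntegerSolution : (k n : ℕ) {s : ℕ} → Vec ℤ s × Vec ℤ s → Set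
  IsIntegerSolution k n (v , w) =
    Vec.All (_∈ Counting.interval k n) v × Vec.All (_∈ Counting.interval k n) w ×
    (∀ j → 1 ≤ j → j ≤ k → powerSum j v ≡ powerSum j w)

  -- For s = r + k(k+1)/2 the exponent 2s - k(k+1)/2 equals 2r + △(k); the summand 1 stands for ε =
  -- 1/q.
  MeanValueBound : (k q K : ℕ) → Set
  MeanValueBound k q K = ∀ r n (xs : List (Vec ℤ (r + △ k) × Vec ℤ (r + △ k))) →
    1 ≤ n → Unique xs → (∀ {a} → a ∈ xs → IsIntegerSolution k n a) →
    length xs ^ q ≤ K * n ^ ((2 * r + △ k) * q + 1)

  mean-value-via : ∀ p → Prime p → ∀ k q → 8 + k < p → 1 ≤ k → 1 ≤ q → ∃[ K ] 1 ≤ K × MeanValueBound k q K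
  mean-value-via p p-prime k q 8+k<p 1≤k 1≤q = p ^ K , 1≤⇒1≤^ (≤-trans (s≤s z≤n) 2≤p) K , λ r n xs 1≤n xs! solution →
      bound r n (length xs) 1≤n (solutions≤E (interval n) (r + △ k) xs xs! solution)
    where
    open Counting k
    open Measures _≟Γ_ Γ-isAbelianGroup
    open ≤-Reasoning
    2≤p : 2 ≤ p
    2≤p = ≤-trans (s≤s (s≤s z≤n)) (<⇒≤ 8+k<p)
    module D = Decoupling p p-prime _≟Γ_ Γ-isAbelianGroup γ
    good : ∃[ C ] (∀ Ω h → D.Dec Ω k h q (h + C))
    good = Induction.all-Good p p-prime _≟Γ_ Γ-isAbelianGroup γ k (≤-trans (m≤m+n 8 k) (<⇒≤ 8+k<p)) 1≤k (≤-<-trans (m≤n+m k 8) 8+k<p) q 1≤q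
    C = proj₁ good
    t = △ k
    -- p^C comes from decoupling, the rest from rounding n up to a power of p.
    K = C + (t * q + 1)
    bound : ∀ r n N → 1 ≤ n → N ≤ E (List.map γ (interval n) ↑ (r + △ k)) → N ^ q ≤ p ^ K * n ^ ((2 * r + t) * q + 1)
    bound r n N 1≤n N≤E =
      let h , n≤p^h , p^h≤pn = nearest-power p n 2≤p 1≤n in begin
      N ^ q                                                            ≤⟨ ^-monoˡ-≤ q N≤E ⟩
      E (List.map γ (interval n) ↑ (r + △ k)) ^ q                 ≤⟨ Counting.E-interval≤ k p p-prime n {q} {h} {h + C} r n≤p^h (proj₂ good (interval n) h) ⟩
      (n * n) ^ (r * q) * p ^ (h + C + h * t * q)                      ≡⟨ cong (λ e → (n * n) ^ (r * q) * p ^ e) (l₁ h C t q) ⟩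
      (n * n) ^ (r * q) * p ^ (C + h * (t * q + 1))                    ≡⟨ cong ((n * n) ^ (r * q) *_) (trans (^-distribˡ-+-* p C (h * (t * q + 1))) (cong (p ^ C *_) (sym (^-*-assoc p h (t * q + 1))))) ⟩
      (n * n) ^ (r * q) * (p ^ C * (p ^ h) ^ (t * q + 1))              ≤⟨ *-monoʳ-≤ ((n * n) ^ (r * q)) (*-monoʳ-≤ (p ^ C) (^-monoˡ-≤ (t * q + 1) p^h≤pn)) ⟩
      (n * n) ^ (r * q) * (p ^ C * (p * n) ^ (t * q + 1))              ≡⟨ cong₂ (λ x y → x * (p ^ C * y)) (trans (cong (_^ (r * q)) (cong (n *_) (sym (*-identityʳ n)))) (^-*-assoc n 2 (r * q))) (*-^-comm p n (t * q + 1)) ⟩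
      n ^ (2 * (r * q)) * (p ^ C * (p ^ (t * q + 1) * n ^ (t * q + 1)))  ≡⟨ l₂ (n ^ (2 * (r * q))) (p ^ C) (p ^ (t * q + 1)) (n ^ (t * q + 1)) ⟩
      p ^ C * p ^ (t * q + 1) * (n ^ (2 * (r * q)) * n ^ (t * q + 1))  ≡⟨ cong₂ _*_ (^-distribˡ-+-* p C (t * q + 1)) (^-distribˡ-+-* n (2 * (r * q)) (t * q + 1)) ⟨
      p ^ K * n ^ (2 * (r * q) + (t * q + 1))                          ≡⟨ cong (λ e → p ^ K * n ^ e) (l₃ r t q) ⟩
      p ^ K * n ^ ((2 * r + t) * q + 1)                                ∎
      where
      l₁ : ∀ h C t q → h + C + h * t * q ≡ C + h * (t * q + 1)
      l₁ = solve-∀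
      l₂ : ∀ a b c d → a * (b * (c * d)) ≡ b * c * (a * d)
      l₂ = solve-∀
      l₃ : ∀ r t q → 2 * (r * q) + (t * q + 1) ≡ (2 * r + t) * q + 1
      l₃ = solve-∀

  mean-value : ∀ k q → 1 ≤ k → 1 ≤ q → ∃[ K ] 1 ≤ K × MeanValueBound k q K
  mean-value k q 1≤k 1≤q = let p , p-prime , 8+k<p = infinitely-many-primes (8 + k) in
    mean-value-via p p-prime k q 8+k<p 1≤k 1≤q

open import Defs

-- Rational arithmetic and the comparison of parameters.

module Rationals where

  open import Algebra.Bundles using (CommutativeRing)
  open import Data.Integer as ℤ using (ℤ; +_; -[1+_])
  import Data.Integer.Properties as ℤ
  open import Data.Nat as ℕ using (ℕ; zero; suc; z≤n; s≤s)
  import Data.Nat.Properties as ℕ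
  open import Data.Product using (_,_; _×_; ∃-syntax)
  open import Data.Rational
  open import Data.Rational.Properties
  open import Data.Rational.Solver using (module +-*-Solver)
  open import Data.Rational.Unnormalised as ℚᵘ using (mkℚᵘ)
  import Data.Rational.Unnormalised.Properties as ℚᵘ
  open import Relation.Binary.PropositionalEquality hiding (J)
  open import Data.Sum using (inj₁; inj₂)
  open import Algebra.Properties.CommutativeSemiring.Exp (CommutativeRing.commutativeSemiring +-*-commutativeRing)
    using (^-homo-*; ^-assocʳ; ^-distrib-*)
  open +-*-Solver using (solve; _:=_; _:+_; _:*_; _:-_; :-_; con)

  module _ {i j : ℤ} {d e : ℕ} where

    private
      toᵘ : ∀ i d → toℚᵘ (i / suc d) ℚᵘ.≃ mkℚᵘ i d
      toᵘ i d = toℚᵘ-fromℚᵘ (mkℚᵘ i d)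

    /-mono-< : i ℤ.* + suc e ℤ.< j ℤ.* + suc d → i / suc d < j / suc e
    /-mono-< ie<jd = toℚᵘ-cancel-< (ℚᵘ.<-respˡ-≃ (ℚᵘ.≃-sym (toᵘ i d)) (ℚᵘ.<-respʳ-≃ (ℚᵘ.≃-sym (toᵘ j e)) (ℚᵘ.*<* ie<jd)))

    /-cancel-< : i / suc d < j / suc e → i ℤ.* + suc e ℤ.< j ℤ.* + suc d
    /-cancel-< i/d<j/e with ℚᵘ.*<* ie<jd ← ℚᵘ.<-respˡ-≃ (toᵘ i d) (ℚᵘ.<-respʳ-≃ (toᵘ j e) (toℚᵘ-mono-< i/d<j/e)) = ie<jd

    /-mono-≤ : i ℤ.* + suc e ℤ.≤ j ℤ.* + suc d → i / suc d ≤ j / suc e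
    /-mono-≤ ie≤jd = toℚᵘ-cancel-≤ (ℚᵘ.≤-respˡ-≃ (ℚᵘ.≃-sym (toᵘ i d)) (ℚᵘ.≤-respʳ-≃ (ℚᵘ.≃-sym (toᵘ j e)) (ℚᵘ.*≤* ie≤jd)))

    /-cancel-≤ : i / suc d ≤ j / suc e → i ℤ.* + suc e ℤ.≤ j ℤ.* + suc d
    /-cancel-≤ i/d≤j/e with ℚᵘ.*≤* ie≤jd ← ℚᵘ.≤-respˡ-≃ (toᵘ i d) (ℚᵘ.≤-respʳ-≃ (toᵘ j e) (toℚᵘ-mono-≤ i/d≤j/e)) = ie≤jd

  fromℕ-mono-≤ : ∀ {m n} → m ℕ.≤ n → fromℕ m ≤ fromℕ n
  fromℕ-mono-≤ {m} {n} m≤n = /-mono-≤ {+ m} {+ n} {0} {0} (ℤ.*-monoʳ-≤-nonNeg (+ 1) (ℤ.+≤+ m≤n))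

  fromℕ-cancel-≤ : ∀ {m n} → fromℕ m ≤ fromℕ n → m ℕ.≤ n
  fromℕ-cancel-≤ {m} {n} m≤n = ℤ.drop‿+≤+ (subst₂ ℤ._≤_ (ℤ.*-identityʳ (+ m)) (ℤ.*-identityʳ (+ n)) (/-cancel-≤ {+ m} {+ n} {0} {0} m≤n))

  private
    toℚᵘ-fromℕ : ∀ n → toℚᵘ (fromℕ n) ℚᵘ.≃ mkℚᵘ (+ n) 0
    toℚᵘ-fromℕ n = toℚᵘ-fromℚᵘ (mkℚᵘ (+ n) 0)

  fromℕ-+ : ∀ m n → fromℕ (m ℕ.+ n) ≡ fromℕ m + fromℕ n
  fromℕ-+ m n = toℚᵘ-injective (ℚᵘ.≃-trans (toℚᵘ-fromℕ (m ℕ.+ n)) (ℚᵘ.≃-trans (ℚᵘ.*≡* (cong (ℤ._* + 1)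
      (trans (ℤ.pos-+ m n) (sym (cong₂ ℤ._+_ (ℤ.*-identityʳ (+ m)) (ℤ.*-identityʳ (+ n)))))))
    (ℚᵘ.≃-sym (ℚᵘ.≃-trans (toℚᵘ-homo-+ (fromℕ m) (fromℕ n)) (ℚᵘ.+-cong (toℚᵘ-fromℕ m) (toℚᵘ-fromℕ n))))))

  fromℕ-* : ∀ m n → fromℕ (m ℕ.* n) ≡ fromℕ m * fromℕ n
  fromℕ-* m n = toℚᵘ-injective (ℚᵘ.≃-trans (toℚᵘ-fromℕ (m ℕ.* n)) (ℚᵘ.≃-trans (ℚᵘ.*≡* (cong (ℤ._* + 1) (ℤ.pos-* m n)))
    (ℚᵘ.≃-sym (ℚᵘ.≃-trans (toℚᵘ-homo-* (fromℕ m) (fromℕ n)) (ℚᵘ.*-cong (toℚᵘ-fromℕ m) (toℚᵘ-fromℕ n))))))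

  0≤fromℕ : ∀ n → 0ℚ ≤ fromℕ n
  0≤fromℕ n = fromℕ-mono-≤ {0} {n} z≤n

  fromℕ-^ : ∀ m n → fromℕ (m ℕ.^ n) ≡ fromℕ m ^ℚ n
  fromℕ-^ m zero    = refl
  fromℕ-^ m (suc n) = trans (fromℕ-* m (m ℕ.^ n)) (cong (fromℕ m *_) (fromℕ-^ m n))

  *-mono-≤ : ∀ {x y u v} → 0ℚ ≤ x → 0ℚ ≤ v → x ≤ y → u ≤ v → x * u ≤ y * v
  *-mono-≤ {x} {y} {u} {v} 0≤x 0≤v x≤y u≤v = ≤-trans
    (*-monoˡ-≤-nonNeg x {{nonNegative 0≤x}} u≤v) (*-monoʳ-≤-nonNeg v {{nonNegative 0≤v}} x≤y)

  0≤^ : ∀ {x} n → 0ℚ ≤ x → 0ℚ ≤ x ^ℚ n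
  0≤^ zero    0≤x = nonNegative⁻¹ 1ℚ
  0≤^ {x} (suc n) 0≤x = ≤-trans (≤-reflexive (sym (*-zeroʳ x))) (*-monoˡ-≤-nonNeg x {{nonNegative 0≤x}} (0≤^ n 0≤x))

  ^-monoˡ-≤ : ∀ {x y} n → 0ℚ ≤ x → x ≤ y → x ^ℚ n ≤ y ^ℚ n
  ^-monoˡ-≤ zero    0≤x x≤y = ≤-refl
  ^-monoˡ-≤ (suc n) 0≤x x≤y = *-mono-≤ 0≤x (0≤^ n (≤-trans 0≤x x≤y)) x≤y (^-monoˡ-≤ n 0≤x x≤y)

  ^-monoˡ-< : ∀ {x y} n → 0ℚ ≤ x → x < y → x ^ℚ suc n < y ^ℚ suc n
  ^-monoˡ-< {x} {y} zero 0≤x x<y = subst₂ _<_ (sym (*-identityʳ x)) (sym (*-identityʳ y)) x<y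
  ^-monoˡ-< {x} {y} (suc n) 0≤x x<y = ≤-<-trans
    (*-monoˡ-≤-nonNeg x {{nonNegative 0≤x}} (<⇒≤ xⁿ<yⁿ)) (*-monoˡ-<-pos (y ^ℚ suc n) {{positive (≤-<-trans (0≤^ (suc n) 0≤x) xⁿ<yⁿ)}} x<y)
    where xⁿ<yⁿ = ^-monoˡ-< n 0≤x x<y

  1≤^ : ∀ {x} n → 1ℚ ≤ x → 1ℚ ≤ x ^ℚ n
  1≤^ zero    1≤x = ≤-refl
  1≤^ (suc n) 1≤x = *-mono-≤ (nonNegative⁻¹ 1ℚ) (≤-trans (nonNegative⁻¹ 1ℚ) (1≤^ n 1≤x)) 1≤x (1≤^ n 1≤x)

  ^-monoʳ-≤ : ∀ {x m n} → 1ℚ ≤ x → m ℕ.≤ n → x ^ℚ m ≤ x ^ℚ n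
  ^-monoʳ-≤ {n = n} 1≤x z≤n = 1≤^ n 1≤x
  ^-monoʳ-≤ {x} {suc m} 1≤x (s≤s m≤n) = *-monoˡ-≤-nonNeg x {{nonNegative (≤-trans (nonNegative⁻¹ 1ℚ) 1≤x)}} (^-monoʳ-≤ 1≤x m≤n)

  -- One power of x absorbs K.
  root-bound : ∀ {x q a b d K n N m} Q → 1ℚ ≤ x → fromℕ K ≤ x → fromℕ n ≤ x → 0ℚ < q → x ^ℚ a < q ^ℚ suc d * x ^ℚ b →
    N ℕ.^ suc Q ℕ.≤ K ℕ.* n ℕ.^ m → suc m ℕ.* suc d ℕ.+ b ℕ.* suc Q ℕ.≤ a ℕ.* suc Q → fromℕ N ≤ q
  root-bound {x} {q} {a} {b} {d} {K} {n} {N} {m} Q 1≤x K≤x n≤x 0<q xᵃ< Nᵠ≤ exponents = ≮⇒≥ λ q<N → <-irrefl refl (begin-strict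
      x ^ℚ (a ℕ.* suc Q)                                    ≡⟨ ^-assocʳ x a (suc Q) ⟨
      (x ^ℚ a) ^ℚ suc Q                                     <⟨ ^-monoˡ-< Q (0≤^ a 0≤x) xᵃ< ⟩
      (q ^ℚ suc d * x ^ℚ b) ^ℚ suc Q                        ≤⟨ ^-monoˡ-≤ (suc Q) (0≤* (0≤^ (suc d) (<⇒≤ 0<q)) (0≤^ b 0≤x)) (*-monoʳ-≤-nonNeg (x ^ℚ b) {{nonNegative (0≤^ b 0≤x)}} (^-monoˡ-≤ (suc d) (<⇒≤ 0<q) (<⇒≤ q<N))) ⟩
      (fromℕ N ^ℚ suc d * x ^ℚ b) ^ℚ suc Q                  ≡⟨ ^-distrib-* (fromℕ N ^ℚ suc d) (x ^ℚ b) (suc Q) ⟩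
      (fromℕ N ^ℚ suc d) ^ℚ suc Q * (x ^ℚ b) ^ℚ suc Q       ≡⟨ cong₂ _*_ (trans (^-assocʳ (fromℕ N) (suc d) (suc Q)) (trans (cong (fromℕ N ^ℚ_) (ℕ.*-comm (suc d) (suc Q))) (sym (^-assocʳ (fromℕ N) (suc Q) (suc d))))) (^-assocʳ x b (suc Q)) ⟩
      (fromℕ N ^ℚ suc Q) ^ℚ suc d * x ^ℚ (b ℕ.* suc Q)      ≤⟨ *-monoʳ-≤-nonNeg _ {{nonNegative (0≤^ (b ℕ.* suc Q) 0≤x)}} (^-monoˡ-≤ (suc d) (0≤^ (suc Q) (0≤fromℕ N)) N≤) ⟩
      (x ^ℚ suc m) ^ℚ suc d * x ^ℚ (b ℕ.* suc Q)            ≡⟨ cong (_* x ^ℚ (b ℕ.* suc Q)) (^-assocʳ x (suc m) (suc d)) ⟩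
      x ^ℚ (suc m ℕ.* suc d) * x ^ℚ (b ℕ.* suc Q)           ≡⟨ ^-homo-* x (suc m ℕ.* suc d) (b ℕ.* suc Q) ⟨
      x ^ℚ (suc m ℕ.* suc d ℕ.+ b ℕ.* suc Q)                ≤⟨ ^-monoʳ-≤ 1≤x exponents ⟩
      x ^ℚ (a ℕ.* suc Q)                                    ∎)
    where
    open ≤-Reasoning
    0≤x : 0ℚ ≤ x
    0≤x = ≤-trans (nonNegative⁻¹ 1ℚ) 1≤x
    0≤* : ∀ {u v} → 0ℚ ≤ u → 0ℚ ≤ v → 0ℚ ≤ u * v
    0≤* {u} 0≤u 0≤v = ≤-trans (≤-reflexive (sym (*-zeroʳ u))) (*-monoˡ-≤-nonNeg u {{nonNegative 0≤u}} 0≤v)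
    N≤ : fromℕ N ^ℚ suc Q ≤ x ^ℚ suc m
    N≤ = begin
      fromℕ N ^ℚ suc Q              ≡⟨ fromℕ-^ N (suc Q) ⟨
      fromℕ (N ℕ.^ suc Q)           ≤⟨ fromℕ-mono-≤ Nᵠ≤ ⟩
      fromℕ (K ℕ.* n ℕ.^ m)         ≡⟨ trans (fromℕ-* K (n ℕ.^ m)) (cong (fromℕ K *_) (fromℕ-^ n m)) ⟩
      fromℕ K * fromℕ n ^ℚ m        ≤⟨ *-mono-≤ (0≤fromℕ K) (0≤^ m 0≤x) K≤x (^-monoˡ-≤ m (0≤fromℕ n) n≤x) ⟩
      x * x ^ℚ m                    ∎

  2△ : ∀ k → 2 ℕ.* Naturals.△ k ≡ k ℕ.* suc k
  2△ zero    = refl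
  2△ (suc k) = trans (ℕ.*-distribˡ-+ 2 (suc k) (Naturals.△ k))
    (trans (cong (λ t → 2 ℕ.* suc k ℕ.+ t) (2△ k)) (lemma k))
    where
    open import Data.Nat.Tactic.RingSolver using (solve-∀)
    lemma : ∀ k → 2 ℕ.* suc k ℕ.+ k ℕ.* suc k ≡ suc k ℕ.* suc (suc k)
    lemma = solve-∀

  fromℕ-△ : ∀ k → fromℕ (Naturals.△ k) ≡ ½ * fromℕ k * (fromℕ k + 1ℚ)
  fromℕ-△ k = begin
    T                                       ≡⟨ solve 1 (λ T → T := con ½ :* (con (fromℕ 2) :* T)) refl T ⟩
    ½ * (fromℕ 2 * T)                       ≡⟨ cong (½ *_) (trans (sym (fromℕ-* 2 (Naturals.△ k))) (cong fromℕ (2△ k))) ⟩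
    ½ * fromℕ (k ℕ.* suc k)                 ≡⟨ cong (½ *_) (trans (fromℕ-* k (suc k)) (cong (fromℕ k *_) (trans (fromℕ-+ 1 k) (+-comm 1ℚ (fromℕ k))))) ⟩
    ½ * (fromℕ k * (fromℕ k + 1ℚ))          ≡⟨ *-assoc ½ (fromℕ k) (fromℕ k + 1ℚ) ⟨
    ½ * fromℕ k * (fromℕ k + 1ℚ)            ∎
    where
    open ≡-Reasoning
    T = fromℕ (Naturals.△ k)

  module Parameters (r₁ d s : ℕ) where

    private
      r = suc r₁
      k = r ℕ.+ 2 ℕ.+ d
      t = Naturals.△ k
      R = fromℕ r
      D = fromℕ d

      fromℕ-k : fromℕ k ≡ R + fromℕ 2 + D
      fromℕ-k = trans (fromℕ-+ (r ℕ.+ 2) d) (cong (_+ D) (fromℕ-+ r 2))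

    -- For k = r + 2 + d the lower bound on s exceeds k(k+1)/2 by half of 2r + 3d + d².
    △≤s : fromℕ s ≥ fromℕ k * fromℕ k - R * fromℕ k + ½ * R * (R + fromℕ 3) - 1ℚ → t ℕ.≤ s
    △≤s s≥ = fromℕ-cancel-≤ (begin
      fromℕ t                                                                ≡⟨ trans (fromℕ-△ k) (cong (λ K → ½ * K * (K + 1ℚ)) fromℕ-k) ⟩
      ½ * (R + fromℕ 2 + D) * (R + fromℕ 2 + D + 1ℚ)                         ≡⟨ +-identityʳ _ ⟨
      ½ * (R + fromℕ 2 + D) * (R + fromℕ 2 + D + 1ℚ) + 0ℚ                    ≤⟨ +-monoʳ-≤ (½ * (R + fromℕ 2 + D) * (R + fromℕ 2 + D + 1ℚ)) slack≥0 ⟩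
      ½ * (R + fromℕ 2 + D) * (R + fromℕ 2 + D + 1ℚ) + ½ * fromℕ slack       ≡⟨ identity ⟩
      (R + fromℕ 2 + D) * (R + fromℕ 2 + D) - R * (R + fromℕ 2 + D) + ½ * R * (R + fromℕ 3) - 1ℚ
                                                                             ≡⟨ cong (λ K → K * K - R * K + ½ * R * (R + fromℕ 3) - 1ℚ) fromℕ-k ⟨
      fromℕ k * fromℕ k - R * fromℕ k + ½ * R * (R + fromℕ 3) - 1ℚ           ≤⟨ s≥ ⟩
      fromℕ s                                                                ∎)
      where
      open ≤-Reasoning
      slack = 2 ℕ.* r ℕ.+ (3 ℕ.* d ℕ.+ d ℕ.* d)
      slack≥0 : 0ℚ ≤ ½ * fromℕ slack
      slack≥0 = ≤-trans (≤-reflexive (sym (*-zeroʳ ½))) (*-monoˡ-≤-nonNeg ½ (0≤fromℕ slack))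
      fromℕ-slack : fromℕ slack ≡ fromℕ 2 * R + (fromℕ 3 * D + D * D)
      fromℕ-slack = trans (fromℕ-+ (2 ℕ.* r) (3 ℕ.* d ℕ.+ d ℕ.* d)) (cong₂ _+_ (fromℕ-* 2 r) (trans (fromℕ-+ (3 ℕ.* d) (d ℕ.* d)) (cong₂ _+_ (fromℕ-* 3 d) (fromℕ-* d d))))
      identity : ½ * (R + fromℕ 2 + D) * (R + fromℕ 2 + D + 1ℚ) + ½ * fromℕ slack ≡
        (R + fromℕ 2 + D) * (R + fromℕ 2 + D) - R * (R + fromℕ 2 + D) + ½ * R * (R + fromℕ 3) - 1ℚ
      identity = trans (cong (λ u → ½ * (R + fromℕ 2 + D) * (R + fromℕ 2 + D + 1ℚ) + ½ * u) fromℕ-slack)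
        (solve 2 (λ R D →
          con ½ :* (R :+ con (fromℕ 2) :+ D) :* (R :+ con (fromℕ 2) :+ D :+ con 1ℚ) :+ con ½ :* (con (fromℕ 2) :* R :+ (con (fromℕ 3) :* D :+ D :* D)) :=
          (R :+ con (fromℕ 2) :+ D) :* (R :+ con (fromℕ 2) :+ D) :- R :* (R :+ con (fromℕ 2) :+ D) :+ con ½ :* R :* (R :+ con (fromℕ 3)) :- con 1ℚ) refl R D)

    private
      -- With k = r + 2 + d, the factor 3k - 2r - 5 is r₁ + 2 + 3d, so the numerator of δ is a
      -- natural number.
      numerator : ℕ
      numerator = r ℕ.* r₁ ℕ.* (r₁ ℕ.+ 2 ℕ.+ 3 ℕ.* d)

      numerator≡ : + r ℤ.* (+ r ℤ.- + 1) ℤ.* (+ 3 ℤ.* + k ℤ.- + 2 ℤ.* + r ℤ.- + 5) ≡ + numerator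
      numerator≡ = begin
        + r ℤ.* (+ r ℤ.- + 1) ℤ.* (+ 3 ℤ.* + k ℤ.- + 2 ℤ.* + r ℤ.- + 5)
          ≡⟨ cong (λ K → + r ℤ.* (+ r ℤ.- + 1) ℤ.* (+ 3 ℤ.* K ℤ.- + 2 ℤ.* + r ℤ.- + 5)) (trans (ℤ.pos-+ (r ℕ.+ 2) d) (cong (ℤ._+ + d) (ℤ.pos-+ r 2))) ⟩
        + r ℤ.* (+ r ℤ.- + 1) ℤ.* (+ 3 ℤ.* (+ r ℤ.+ + 2 ℤ.+ + d) ℤ.- + 2 ℤ.* + r ℤ.- + 5)
          ≡⟨ lemma (+ r₁) (+ d) ⟩
        + r ℤ.* + r₁ ℤ.* (+ r₁ ℤ.+ + 2 ℤ.+ + 3 ℤ.* + d)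
          ≡⟨ cong₂ ℤ._*_ (sym (ℤ.pos-* r r₁)) (trans (cong₂ ℤ._+_ (sym (ℤ.pos-+ r₁ 2)) (sym (ℤ.pos-* 3 d))) (sym (ℤ.pos-+ (r₁ ℕ.+ 2) (3 ℕ.* d)))) ⟩
        + (r ℕ.* r₁) ℤ.* + (r₁ ℕ.+ 2 ℕ.+ 3 ℕ.* d)
          ≡⟨ sym (ℤ.pos-* (r ℕ.* r₁) (r₁ ℕ.+ 2 ℕ.+ 3 ℕ.* d)) ⟩
        + numerator ∎
        where
        open ≡-Reasoning
        open import Data.Integer.Tactic.RingSolver using (solve-∀)
        lemma : ∀ x d → (ℤ.1ℤ ℤ.+ x) ℤ.* ((ℤ.1ℤ ℤ.+ x) ℤ.- + 1) ℤ.* (+ 3 ℤ.* ((ℤ.1ℤ ℤ.+ x) ℤ.+ + 2 ℤ.+ d) ℤ.- + 2 ℤ.* (ℤ.1ℤ ℤ.+ x) ℤ.- + 5) ≡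
          (ℤ.1ℤ ℤ.+ x) ℤ.* x ℤ.* (x ℤ.+ + 2 ℤ.+ + 3 ℤ.* d)
        lemma = solve-∀

      δ≡ : δ s k r ≡ + numerator / (6 ℕ.* suc (s ℕ.∸ k))
      δ≡ = cong (λ i → i / (6 ℕ.* suc (s ℕ.∸ k))) numerator≡

    0≤δ : 0ℚ ≤ δ s k r
    0≤δ = subst (0ℚ ≤_) (sym δ≡) (/-mono-≤ {+ 0} {+ numerator} {0} (ℤ.*-monoʳ-≤-nonNeg (+ 1) (ℤ.+≤+ (z≤n {numerator}))))

    δ<r²/k : k ℕ.≤ s →
      fromℕ s ≥ (fromℕ k - ½ * R) * (fromℕ k - ½ * R) + (+ 1 / 4) * ((R + fromℕ 3) * (R + fromℕ 3)) →
      δ s k r < + (r ℕ.* r) / k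
    δ<r²/k k≤s s≥ = subst (_< + (r ℕ.* r) / k) (sym δ≡)
      (/-mono-< {+ numerator} {+ (r ℕ.* r)} (subst₂ ℤ._<_ (ℤ.pos-* numerator k) (ℤ.pos-* (r ℕ.* r) (6 ℕ.* suc e)) (ℤ.+<+ cross)))
      where
      e = s ℕ.∸ k
      -- Four times the lower bound on s, namely (2k - r)² + (r + 3)².
      M = (r ℕ.+ 4 ℕ.+ 2 ℕ.* d) ℕ.* (r ℕ.+ 4 ℕ.+ 2 ℕ.* d) ℕ.+ (r ℕ.+ 3) ℕ.* (r ℕ.+ 3)
      fromℕ-M : fromℕ M ≡ fromℕ 4 * ((fromℕ k - ½ * R) * (fromℕ k - ½ * R) + (+ 1 / 4) * ((R + fromℕ 3) * (R + fromℕ 3)))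
      fromℕ-M = begin
        fromℕ M
          ≡⟨ trans (fromℕ-+ ((r ℕ.+ 4 ℕ.+ 2 ℕ.* d) ℕ.* (r ℕ.+ 4 ℕ.+ 2 ℕ.* d)) ((r ℕ.+ 3) ℕ.* (r ℕ.+ 3))) (cong₂ _+_ (fromℕ-* (r ℕ.+ 4 ℕ.+ 2 ℕ.* d) (r ℕ.+ 4 ℕ.+ 2 ℕ.* d)) (fromℕ-* (r ℕ.+ 3) (r ℕ.+ 3))) ⟩
        fromℕ (r ℕ.+ 4 ℕ.+ 2 ℕ.* d) * fromℕ (r ℕ.+ 4 ℕ.+ 2 ℕ.* d) + fromℕ (r ℕ.+ 3) * fromℕ (r ℕ.+ 3)
          ≡⟨ cong₂ (λ x y → x * x + y * y) (trans (fromℕ-+ (r ℕ.+ 4) (2 ℕ.* d)) (cong₂ _+_ (fromℕ-+ r 4) (fromℕ-* 2 d))) (fromℕ-+ r 3) ⟩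
        (R + fromℕ 4 + fromℕ 2 * D) * (R + fromℕ 4 + fromℕ 2 * D) + (R + fromℕ 3) * (R + fromℕ 3)
          ≡⟨ solve 2 (λ R D →
               (R :+ con (fromℕ 4) :+ con (fromℕ 2) :* D) :* (R :+ con (fromℕ 4) :+ con (fromℕ 2) :* D) :+ (R :+ con (fromℕ 3)) :* (R :+ con (fromℕ 3)) :=
               con (fromℕ 4) :* ((R :+ con (fromℕ 2) :+ D :- con ½ :* R) :* (R :+ con (fromℕ 2) :+ D :- con ½ :* R)
                 :+ con (+ 1 / 4) :* ((R :+ con (fromℕ 3)) :* (R :+ con (fromℕ 3))))) refl R D ⟩
        fromℕ 4 * ((R + fromℕ 2 + D - ½ * R) * (R + fromℕ 2 + D - ½ * R) + (+ 1 / 4) * ((R + fromℕ 3) * (R + fromℕ 3)))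
          ≡⟨ cong (λ K → fromℕ 4 * ((K - ½ * R) * (K - ½ * R) + (+ 1 / 4) * ((R + fromℕ 3) * (R + fromℕ 3)))) fromℕ-k ⟨
        fromℕ 4 * ((fromℕ k - ½ * R) * (fromℕ k - ½ * R) + (+ 1 / 4) * ((R + fromℕ 3) * (R + fromℕ 3))) ∎
        where open ≡-Reasoning
      M≤4s : M ℕ.≤ 4 ℕ.* (k ℕ.+ e)
      M≤4s = fromℕ-cancel-≤ (≤-trans (≤-reflexive fromℕ-M) (≤-trans (*-monoˡ-≤-nonNeg (fromℕ 4) s≥)
        (≤-reflexive (trans (sym (fromℕ-* 4 s)) (cong (λ n → fromℕ (4 ℕ.* n)) (sym (ℕ.m+[n∸m]≡n k≤s)))))))
      open ℕ.≤-Reasoning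
      open import Data.Nat.Tactic.RingSolver using (solve-∀)
      -- The last bracket has only positive coefficients, and its constant 4 makes the inequality
      -- strict.
      lemma : ∀ x d → 3 ℕ.* suc x ℕ.* ((suc x ℕ.+ 4 ℕ.+ 2 ℕ.* d) ℕ.* (suc x ℕ.+ 4 ℕ.+ 2 ℕ.* d) ℕ.+ (suc x ℕ.+ 3) ℕ.* (suc x ℕ.+ 3) ℕ.+ 4)
        ≡ 2 ℕ.* (x ℕ.* (x ℕ.+ 2 ℕ.+ 3 ℕ.* d) ℕ.* (suc x ℕ.+ 2 ℕ.+ d)) ℕ.+ 3 ℕ.* suc x ℕ.* (4 ℕ.* (suc x ℕ.+ 2 ℕ.+ d))
          ℕ.+ (4 ℕ.+ (4 ℕ.* (suc x ℕ.* (suc x ℕ.* suc x)) ℕ.+ 26 ℕ.* (suc x ℕ.* suc x) ℕ.+ 65 ℕ.* suc x ℕ.+ 6 ℕ.* (suc x ℕ.* (d ℕ.* d))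
            ℕ.+ 4 ℕ.* (suc x ℕ.* (suc x ℕ.* d)) ℕ.+ 30 ℕ.* (suc x ℕ.* d) ℕ.+ 14 ℕ.* d ℕ.+ 6 ℕ.* (d ℕ.* d)))
      lemma = solve-∀
      half : 2 ℕ.* (r₁ ℕ.* (r₁ ℕ.+ 2 ℕ.+ 3 ℕ.* d) ℕ.* k) ℕ.+ 3 ℕ.* r ℕ.* (4 ℕ.* k) ℕ.< 12 ℕ.* r ℕ.* suc e ℕ.+ 3 ℕ.* r ℕ.* (4 ℕ.* k)
      half = begin-strict
        2 ℕ.* (r₁ ℕ.* (r₁ ℕ.+ 2 ℕ.+ 3 ℕ.* d) ℕ.* k) ℕ.+ 3 ℕ.* r ℕ.* (4 ℕ.* k)   <⟨ ℕ.m<m+n _ (s≤s z≤n) ⟩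
        _                                                                       ≡⟨ lemma r₁ d ⟨
        3 ℕ.* r ℕ.* (M ℕ.+ 4)                                                   ≤⟨ ℕ.*-monoʳ-≤ (3 ℕ.* r) (ℕ.+-monoˡ-≤ 4 M≤4s) ⟩
        3 ℕ.* r ℕ.* (4 ℕ.* (k ℕ.+ e) ℕ.+ 4)                                     ≡⟨ lemma₂ r k e ⟩
        12 ℕ.* r ℕ.* suc e ℕ.+ 3 ℕ.* r ℕ.* (4 ℕ.* k)                            ∎
        where
        lemma₂ : ∀ r k e → 3 ℕ.* r ℕ.* (4 ℕ.* (k ℕ.+ e) ℕ.+ 4) ≡ 12 ℕ.* r ℕ.* suc e ℕ.+ 3 ℕ.* r ℕ.* (4 ℕ.* k)
        lemma₂ = solve-∀
      cross : numerator ℕ.* k ℕ.< r ℕ.* r ℕ.* (6 ℕ.* suc e)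
      cross = ℕ.*-cancelˡ-< 2 _ _ (begin-strict
        2 ℕ.* (r ℕ.* r₁ ℕ.* (r₁ ℕ.+ 2 ℕ.+ 3 ℕ.* d) ℕ.* k)              ≡⟨ l₁ r r₁ (r₁ ℕ.+ 2 ℕ.+ 3 ℕ.* d) k ⟩
        r ℕ.* (2 ℕ.* (r₁ ℕ.* (r₁ ℕ.+ 2 ℕ.+ 3 ℕ.* d) ℕ.* k))            <⟨ ℕ.*-monoʳ-< r (ℕ.+-cancelʳ-< _ _ _ half) ⟩
        r ℕ.* (12 ℕ.* r ℕ.* suc e)                                     ≡⟨ l₂ r (suc e) ⟩
        2 ℕ.* (r ℕ.* r ℕ.* (6 ℕ.* suc e))                              ∎)
        where
        l₁ : ∀ r x y k → 2 ℕ.* (r ℕ.* x ℕ.* y ℕ.* k) ≡ r ℕ.* (2 ℕ.* (x ℕ.* y ℕ.* k))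
        l₁ = solve-∀
        l₂ : ∀ r e → r ℕ.* (12 ℕ.* r ℕ.* e) ≡ 2 ℕ.* (r ℕ.* r ℕ.* (6 ℕ.* e))
        l₂ = solve-∀

    -- The left side is 2s - k(k+1)/2 and δ ≥ 0.
    exponent≥ : ∀ r₀ → s ≡ r₀ ℕ.+ t → fromℕ (2 ℕ.* r₀ ℕ.+ t) ≤ exponent s k r
    exponent≥ r₀ refl = begin
      fromℕ (2 ℕ.* r₀ ℕ.+ t)                                            ≡⟨ trans (fromℕ-+ (2 ℕ.* r₀) t) (cong (_+ fromℕ t) (fromℕ-* 2 r₀)) ⟩
      fromℕ 2 * fromℕ r₀ + fromℕ t                                      ≡⟨ solve 2 (λ R T → con (fromℕ 2) :* R :+ T := con (fromℕ 2) :* (R :+ T) :- T :+ con 0ℚ) refl (fromℕ r₀) (fromℕ t) ⟩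
      fromℕ 2 * (fromℕ r₀ + fromℕ t) - fromℕ t + 0ℚ                     ≤⟨ +-monoʳ-≤ (fromℕ 2 * (fromℕ r₀ + fromℕ t) - fromℕ t) 0≤δ ⟩
      fromℕ 2 * (fromℕ r₀ + fromℕ t) - fromℕ t + δ s k r                ≡⟨ cong₂ (λ x y → fromℕ 2 * x - y + δ s k r) (sym (fromℕ-+ r₀ t)) (fromℕ-△ k) ⟩
      exponent s k r                                                    ∎
      where open ≤-Reasoning

  floor-ℕ : ∀ x → 0ℚ ≤ x → ∃[ n ] fromℕ n ≤ x × (∀ m → fromℕ m ≤ x → m ℕ.≤ n)
  floor-ℕ (mkℚ -[1+ m ] d c) (*≤* ())
  floor-ℕ x@(mkℚ (+ m) d c) _ = m DivMod./ suc d ,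
    subst (fromℕ (m DivMod./ suc d) ≤_) (↥p/↧p≡p x) (/-mono-≤ {+ (m DivMod./ suc d)} {+ m} {0} {d}
      (subst₂ ℤ._≤_ (ℤ.pos-* (m DivMod./ suc d) (suc d)) (sym (ℤ.*-identityʳ (+ m))) (ℤ.+≤+ (DivMod.m/n*n≤m m (suc d))))) ,
    λ n n≤x → subst (ℕ._≤ m DivMod./ suc d) (DivMod.m*n/n≡m n (suc d)) (DivMod./-monoˡ-≤ {n ℕ.* suc d} {m} (suc d)
      (ℤ.drop‿+≤+ {n ℕ.* suc d} {m} (subst₂ ℤ._≤_ (sym (ℤ.pos-* n (suc d))) (ℤ.*-identityʳ (+ m)) (/-cancel-≤ {+ n} {+ m} {0} {d} (subst (fromℕ n ≤_) (sym (↥p/↧p≡p x)) n≤x)))))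
    where import Data.Nat.DivMod as DivMod

  p≤∣p∣ : ∀ p → p ≤ ∣ p ∣
  p≤∣p∣ p with ≤-total 0ℚ p
  ... | inj₁ 0≤p = ≤-reflexive (sym (0≤p⇒∣p∣≡p 0≤p))
  ... | inj₂ p≤0 = ≤-trans p≤0 (0≤∣p∣ p)

  <ʳ-lower : ∀ (X : ℝ) m {q} → X <ʳ q → seq X m - 1/1+ m < q
  <ʳ-lower X m {q} (n , X<q) = ≤-<-trans (begin
    seq X m - 1/1+ m                                          ≡⟨ solve 3 (λ x y e → x :- e := (x :- y) :+ (y :- e)) refl (seq X m) (seq X n) (1/1+ m) ⟩
    (seq X m - seq X n) + (seq X n - 1/1+ m)                  ≤⟨ +-monoˡ-≤ (seq X n - 1/1+ m) (≤-trans (p≤∣p∣ (seq X m - seq X n)) (regular X m n)) ⟩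
    (1/1+ m + 1/1+ n) + (seq X n - 1/1+ m)                    ≡⟨ solve 3 (λ e e' y → (e :+ e') :+ (y :- e) := y :+ e') refl (1/1+ m) (1/1+ n) (seq X n) ⟩
    seq X n + 1/1+ n                                          ∎) X<q
    where open ≤-Reasoning

  ≤ˡ-<ʳ : ∀ (X : ℝ) {p q} → p ≤ˡ X → X <ʳ q → p < q
  ≤ˡ-<ʳ X p≤X (n , X<q) = ≤-<-trans (p≤X n) X<q

  -- The numerator exceeds A (Q + 1) by 2: one unit is the loss 1/q of the mean value, the other is
  -- the power of x that absorbs its constant.
  fraction-bound : ∀ A ρ → 0ℚ < ρ → ∃[ Q ] (+ suc (A ℕ.* suc Q ℕ.+ 1)) / suc Q ≤ fromℕ A + ρ
  fraction-bound A (mkℚ (+ zero)  d c) (*<* (ℤ.+<+ ()))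
  fraction-bound A (mkℚ -[1+ n ] d c) (*<* ())
  fraction-bound A ρ@(mkℚ (+ suc n) d c) _ = Q , ≤-trans (≤-reflexive split)
    (+-monoʳ-≤ (fromℕ A) (subst (+ 1 / suc d ≤_) (↥p/↧p≡p ρ) (/-mono-≤ {+ 1} {+ suc n} {d} {d} (ℤ.*-monoʳ-≤-nonNeg (+ suc d) {+ 1} {+ suc n} (ℤ.+≤+ (s≤s (z≤n {n})))))))
    where
    -- Q + 1 = 2 (d + 1), so two units 1/(Q + 1) make 1/(d + 1), which is at most ρ.
    Q = d ℕ.+ (suc d ℕ.+ 0)
    m = suc (A ℕ.* suc Q ℕ.+ 1)
    split : + m / suc Q ≡ fromℕ A + + 1 / suc d
    split = toℚᵘ-injective (ℚᵘ.≃-trans (toℚᵘ-fromℚᵘ (mkℚᵘ (+ m) Q)) (ℚᵘ.≃-trans (ℚᵘ.*≡* cross)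
      (ℚᵘ.≃-sym (ℚᵘ.≃-trans (toℚᵘ-homo-+ (fromℕ A) (+ 1 / suc d)) (ℚᵘ.+-cong (toℚᵘ-fromℚᵘ (mkℚᵘ (+ A) 0)) (toℚᵘ-fromℚᵘ (mkℚᵘ (+ 1) d)))))))
      where
      open import Data.Nat.Tactic.RingSolver using (solve-∀)
      lemma : ∀ A d → suc (A ℕ.* (2 ℕ.* suc d) ℕ.+ 1) ℕ.* (1 ℕ.* suc d) ≡ (A ℕ.* suc d ℕ.+ 1) ℕ.* (2 ℕ.* suc d)
      lemma = solve-∀
      cross : + m ℤ.* + (1 ℕ.* suc d) ≡ (+ A ℤ.* + suc d ℤ.+ + 1 ℤ.* + 1) ℤ.* + suc Q
      cross = begin
        + m ℤ.* + (1 ℕ.* suc d)                                  ≡⟨ ℤ.pos-* m (1 ℕ.* suc d) ⟨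
        + (m ℕ.* (1 ℕ.* suc d))                                  ≡⟨ cong +_ (lemma A d) ⟩
        + ((A ℕ.* suc d ℕ.+ 1) ℕ.* suc Q)                        ≡⟨ ℤ.pos-* (A ℕ.* suc d ℕ.+ 1) (suc Q) ⟩
        + (A ℕ.* suc d ℕ.+ 1) ℤ.* + suc Q                        ≡⟨ cong (ℤ._* + suc Q) (trans (ℤ.pos-+ (A ℕ.* suc d) 1) (cong (ℤ._+ + 1) (ℤ.pos-* A (suc d)))) ⟩
        (+ A ℤ.* + suc d ℤ.+ + 1 ℤ.* + 1) ℤ.* + suc Q            ∎
        where open ≡-Reasoning

-- The bound for real X.

module MainBound where

  open Rationals
  open import Data.Integer as ℤ using (ℤ; +_; -[1+_])
  import Data.Integer.Properties as ℤ
  open import Data.List using (length)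
  open import Data.List.Membership.Propositional using (_∈_)
  open import Data.List.Membership.Propositional.Properties using (∈-applyUpTo⁺)
  open import Data.Nat as ℕ using (ℕ; suc; z≤n; s≤s)
  import Data.Nat.Properties as ℕ
  open import Data.Product using (_,_; _×_; ∃-syntax; proj₁; proj₂)
  open import Data.Rational
  open import Data.Rational.Properties
  open import Data.Vec using (Vec)
  open import Data.Vec.Relation.Unary.All as Vec using ()
  open import Function using (Equivalence)
  open import Relation.Binary.PropositionalEquality hiding (J)

  inRange : ∀ {k n s x} {v : Vec ℤ s} (X : ℝ) → X <ʳ x → (∀ m → fromℕ m ≤ x → m ℕ.≤ n) →
            InRange X v → Vec.All (_∈ Counting.interval k n) v
  inRange {k} {n} {x = x} X X<x n-largest = Vec.map λ { {+ suc m} (_ , m≤X) → ∈-applyUpTo⁺ (λ i → + suc i) (n-largest (suc m) (<⇒≤ (≤ˡ-<ʳ X m≤X X<x)))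
                                                  ; {+ 0} (ℤ.+≤+ () , _) ; { -[1+ _ ]} (() , _) }

  fraction-<⇒ : ∀ m Q a b d → (+ m) / suc Q < (a ℤ.⊖ b) / suc d → m ℕ.* suc d ℕ.+ b ℕ.* suc Q ℕ.≤ a ℕ.* suc Q
  fraction-<⇒ m Q a b d m/Q< = ℤ.drop‿+≤+ (begin
    + (m ℕ.* suc d ℕ.+ b ℕ.* suc Q)                          ≡⟨ trans (ℤ.pos-+ (m ℕ.* suc d) (b ℕ.* suc Q)) (cong₂ ℤ._+_ (ℤ.pos-* m (suc d)) (ℤ.pos-* b (suc Q))) ⟩
    + m ℤ.* + suc d ℤ.+ + b ℤ.* + suc Q                      ≤⟨ ℤ.+-monoˡ-≤ (+ b ℤ.* + suc Q) (ℤ.<⇒≤ (/-cancel-< {+ m} {a ℤ.⊖ b} {Q} {d} m/Q<)) ⟩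
    (a ℤ.⊖ b) ℤ.* + suc Q ℤ.+ + b ℤ.* + suc Q                ≡⟨ cong (λ i → i ℤ.* + suc Q ℤ.+ + b ℤ.* + suc Q) (sym (ℤ.m-n≡m⊖n a b)) ⟩
    (+ a ℤ.- + b) ℤ.* + suc Q ℤ.+ + b ℤ.* + suc Q            ≡⟨ lemma (+ a) (+ b) (+ suc Q) ⟩
    + a ℤ.* + suc Q                                          ≡⟨ ℤ.pos-* a (suc Q) ⟨
    + (a ℕ.* suc Q)                                          ∎)
    where
    open ℤ.≤-Reasoning
    open import Data.Integer.Tactic.RingSolver using (solve-∀)
    lemma : ∀ a b q → (a ℤ.- b) ℤ.* q ℤ.+ b ℤ.* q ≡ a ℤ.* q
    lemma = solve-∀

  module _ (r₁ d₀ r₀ : ℕ) where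

    private
      r = suc r₁
      k = r ℕ.+ 2 ℕ.+ d₀
      t = Naturals.△ k
      s = r₀ ℕ.+ t
      A = 2 ℕ.* r₀ ℕ.+ t

    -- The integer part of X cannot be computed, but a proof that X^θ < q contains a rational x > X,
    -- and the mean value is applied to the integer part of x. Taking `fromℕ K` as X₀ gives K < x,
    -- so that one power of x absorbs the constant K.
    upper-bound : ∀ ε → 0ℚ <ˡ ε → ∃[ X₀ ] ((X : ℝ) → X₀ ≤ˡ X → (N : ℕ) → J s k X N → N ≤ 1ℚ · X ^ʳ (exponent s k r +ˡ ε))
    upper-bound ε (m₀ , 0<ρ) = fromℕ K , bound
      where
      ρ = seq ε m₀ - 1/1+ m₀
      Q = proj₁ (fraction-bound A ρ 0<ρ)
      m = A ℕ.* suc Q ℕ.+ 1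
      m/Q≤ : + suc m / suc Q ≤ fromℕ A + ρ
      m/Q≤ = proj₂ (fraction-bound A ρ 0<ρ)
      mean-value = MeanValue.mean-value k (suc Q) (s≤s z≤n) (s≤s z≤n)
      K = proj₁ mean-value
      bound : (X : ℝ) → fromℕ K ≤ˡ X → (N : ℕ) → J s k X N → N ≤ 1ℚ · X ^ʳ (exponent s k r +ˡ ε)
      bound X K≤X N (xs , |xs| , xs! , xs⇔) q (x , a , b , d , X<x , θ<t , 0<q , xᵃ<) =
        ≤-trans (subst (λ N → fromℕ N ≤ q) |xs| (root-bound {x} {q} {a} {b} {d} {K} {n} {length xs} {m} Q 1≤x (<⇒≤ K<x) n≤x 0<q xᵃ<
          (proj₂ (proj₂ mean-value) r₀ n xs 1≤n xs! solution) exponents)) (≤-reflexive (sym (*-identityˡ q)))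
        where
        K<x : fromℕ K < x
        K<x = ≤ˡ-<ʳ X K≤X X<x
        1≤x : 1ℚ ≤ x
        1≤x = ≤-trans (fromℕ-mono-≤ {1} {K} (proj₁ (proj₂ mean-value))) (<⇒≤ K<x)
        floored = floor-ℕ x (≤-trans (nonNegative⁻¹ 1ℚ) 1≤x)
        n = proj₁ floored
        n≤x = proj₁ (proj₂ floored)
        n-largest = proj₂ (proj₂ floored)
        1≤n : 1 ℕ.≤ n
        1≤n = n-largest 1 1≤x
        solution : ∀ {a} → a ∈ xs → MeanValue.IsIntegerSolution k n a
        solution {v , w} a∈ = let v∈ , w∈ , sums = Equivalence.to (xs⇔ (v , w)) a∈ in
          inRange {k} X X<x n-largest v∈ , inRange {k} X X<x n-largest w∈ , sums
        exponents : suc m ℕ.* suc d ℕ.+ b ℕ.* suc Q ℕ.≤ a ℕ.* suc Q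
        exponents = fraction-<⇒ (suc m) Q a b d (begin-strict
          + suc m / suc Q                                        ≤⟨ m/Q≤ ⟩
          fromℕ A + ρ                                            ≤⟨ +-monoˡ-≤ ρ (Parameters.exponent≥ r₁ d₀ s r₀ refl) ⟩
          exponent s k r + (seq ε m₀ - 1/1+ m₀)                  ≡⟨ +-assoc (exponent s k r) (seq ε m₀) (- 1/1+ m₀) ⟨
          (exponent s k r + seq ε m₀) - 1/1+ m₀                  <⟨ <ʳ-lower (exponent s k r +ˡ ε) m₀ θ<t ⟩
          (a ℤ.⊖ b) / suc d                                      ∎)
          where open ≤-Reasoning

  r+2≤k : ∀ {k r} → fromℕ r ≤ (fromℕ k - fromℕ 2) ⊓ (½ * (fromℕ k + 1ℚ)) → r ℕ.+ 2 ℕ.≤ k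
  r+2≤k {k} {r} r≤ = fromℕ-cancel-≤ (begin
    fromℕ (r ℕ.+ 2)                           ≡⟨ fromℕ-+ r 2 ⟩
    fromℕ r + fromℕ 2                         ≤⟨ +-monoˡ-≤ (fromℕ 2) (≤-trans r≤ (p⊓q≤p (fromℕ k - fromℕ 2) (½ * (fromℕ k + 1ℚ)))) ⟩
    fromℕ k - fromℕ 2 + fromℕ 2               ≡⟨ +-assoc (fromℕ k) (- fromℕ 2) (fromℕ 2) ⟩
    fromℕ k + (- fromℕ 2 + fromℕ 2)           ≡⟨ cong (λ u → fromℕ k + u) (+-inverseˡ (fromℕ 2)) ⟩
    fromℕ k + 0ℚ                              ≡⟨ +-identityʳ (fromℕ k) ⟩
    fromℕ k                                   ∎)
    where open ≤-Reasoning

  k≤△ : ∀ k → k ℕ.≤ Naturals.△ k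
  k≤△ ℕ.zero  = z≤n
  k≤△ (suc k) = ℕ.m≤m+n (suc k) (Naturals.△ k)

  m≤n⇒∃[o]o+m≡n : ∀ {m n} → m ℕ.≤ n → ∃[ o ] o ℕ.+ m ≡ n
  m≤n⇒∃[o]o+m≡n {m} {n} m≤n = n ℕ.∸ m , ℕ.m∸n+n≡m m≤n

  Conclusion : (k r s : ℕ) .{{_ : ℕ.NonZero k}} → Set
  Conclusion k r s =
    ((ε : ℝ) (ε>0 : 0ℚ <ˡ ε) →
      ∃[ X₀ ] ((X : ℝ) → X₀ ≤ˡ X → (N : ℕ) → J s k X N → N ≤ 1ℚ · X ^ʳ (exponent s k r +ˡ ε)))
    ×
    (fromℕ s ≥ (fromℕ k - ½ * fromℕ r) * (fromℕ k - ½ * fromℕ r)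
      + (+ 1 / 4) * ((fromℕ r + fromℕ 3) * (fromℕ r + fromℕ 3)) →
      δ s k r < + (r ℕ.* r) / k)

  conclusion : (k r s : ℕ) .{{_ : ℕ.NonZero k}} .{{_ : ℕ.NonZero r}} →
    fromℕ r ≤ (fromℕ k - fromℕ 2) ⊓ (½ * (fromℕ k + 1ℚ)) →
    fromℕ s ≥ fromℕ k * fromℕ k - fromℕ r * fromℕ k + ½ * fromℕ r * (fromℕ r + fromℕ 3) - 1ℚ →
    Conclusion k r s
  conclusion k ℕ.zero s {{_}} {{()}}
  conclusion k (suc r₁) s r≤ s≥ =
    let d , eq = ℕ.m≤n⇒∃[o]m+o≡n (r+2≤k {k} {suc r₁} r≤) in split-k d k eq s≥
    where
    split-s : ∀ d r₀ s → r₀ ℕ.+ Naturals.△ (suc r₁ ℕ.+ 2 ℕ.+ d) ≡ s → Conclusion (suc r₁ ℕ.+ 2 ℕ.+ d) (suc r₁) s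
    split-s d r₀ _ refl = upper-bound r₁ d r₀ ,
      Parameters.δ<r²/k r₁ d (r₀ ℕ.+ Naturals.△ (suc r₁ ℕ.+ 2 ℕ.+ d))
        (ℕ.≤-trans (k≤△ (suc r₁ ℕ.+ 2 ℕ.+ d)) (ℕ.m≤n+m _ r₀))
    split-k : ∀ d k .{{_ : ℕ.NonZero k}} → suc r₁ ℕ.+ 2 ℕ.+ d ≡ k →
      fromℕ s ≥ fromℕ k * fromℕ k - fromℕ (suc r₁) * fromℕ k + ½ * fromℕ (suc r₁) * (fromℕ (suc r₁) + fromℕ 3) - 1ℚ →
      Conclusion k (suc r₁) s
    split-k d _ refl s≥ = let r₀ , eq = m≤n⇒∃[o]o+m≡n (Parameters.△≤s r₁ d s s≥) in split-s d r₀ s eq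

open import Defs
open import Data.Integer using (+_)
open import Data.Nat as ℕ using (ℕ; NonZero)
open import Data.Product using (_×_; Σ; ∃-syntax)
open import Data.Rational using (ℚ; 0ℚ; 1ℚ; ½; _+_; _-_; _*_; _/_; _≤_; _<_; _≥_; _⊓_)
open import Data.Product using (_,_)

theorem1p1 :
  Σ ((s k : ℕ) (ε : ℝ) → 0ℚ <ˡ ε → ℚ) λ C →
    (k r s : ℕ) .{{_ : NonZero k}} .{{_ : NonZero r}} .{{_ : NonZero s}} →
    k ℕ.≥ 3 →
    fromℕ r ≤ (fromℕ k - fromℕ 2) ⊓ (½ * (fromℕ k + 1ℚ)) →
    fromℕ s ≥ fromℕ k * fromℕ k - fromℕ r * fromℕ k + ½ * fromℕ r * (fromℕ r + fromℕ 3) - 1ℚ →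
    ((ε : ℝ) (ε>0 : 0ℚ <ˡ ε) →
      ∃[ X₀ ] ((X : ℝ) → X₀ ≤ˡ X → (N : ℕ) → J s k X N →
        N ≤ C s k ε ε>0 · X ^ʳ (exponent s k r +ˡ ε)))
    ×
    (fromℕ s ≥ (fromℕ k - ½ * fromℕ r) * (fromℕ k - ½ * fromℕ r)
             + (+ 1 / 4) * ((fromℕ r + fromℕ 3) * (fromℕ r + fromℕ 3)) →
      δ s k r < + (r ℕ.* r) / k)
-- The implicit constant is 1, since X₀ in `upper-bound` is large enough to absorb the constant of
-- the mean value.
theorem1p1 = (λ _ _ _ _ → 1ℚ) , λ k r s _ → MainBound.conclusion k r s
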